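{- Let $n\ge1$ and let $c$ be a standard Coxeter element of $\mathfrak S_{n+1}$. The map $\mathsf{inv}_c:\mathsf{NC}(\mathfrak S_{n+1},c)\to\mathsf{NC}(\mathfrak S_{n+1},c)$ is an involution such that for all $x\in\mathsf{NC}(\mathfrak S_{n+1},c)$ $$(D_{\mathsf{inv}_c(x)}^c,U_{\mathsf{inv}_c(x)}^c)=\big((D_x^c\setminus M_x^c)\cup N_x^c,\ (U_x^c\setminus M_x^c)\cup N_x^c\big).$$ Moreover $\mathsf{inv}_c$ preserves both the set of initial indices and the set of terminal indices (of polygons of $x$), and $|\mathsf{Pol}(x)|=|\mathsf{Pol}(\mathsf{inv}_c(x))|$.
   Context: Write $[n+1]=\{1,\dots,n+1\}$, $s_i=(i,i+1)\in\mathfrak S_{n+1}$. Permutations are composed right to left. $\ell_{\mathcal T}(w)$ is the minimal number of transpositions needed to write $w$, and $u\leq_{\mathcal T}v$ iff $\ell_{\mathcal T}(u)+\ell_{\mathcal T}(u^{ -1}v)=\ell_{\mathcal T}(v)$. A standard Coxeter element $c$ is a product of $s_1,\dots,s_n$, each once, in some order; it is an $(n+1)$-cycle $c=(i_1,\dots,i_{n+1})$ with $i_1=1$, $i_k=n+1$, $i_1<\dots<i_k$ and $i_k>i_{k+1}>\dots>i_{n+1}$. Put $R_c=\{i_1,\dots,i_k\}$, $L_c=\{i_k,\dots,i_{n+1},i_1\}$. $\mathsf{NC}(\mathfrak S_{n+1},c)=\{u:u\leq_{\mathcal T}c\}$. Label $n+1$ points on a circle clockwise by $i_1,\dots,i_{n+1}$;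 for $x\in\mathsf{NC}(\mathfrak S_{n+1},c)$, each nontrivial cycle of $x$ is represented by the convex hull of the points in its support, and these "polygons" (edges count as polygons, single points do not) are pairwise disjoint; conversely every such collection of pairwise disjoint polygons represents a unique element of $\mathsf{NC}(\mathfrak S_{n+1},c)$ (each cycle being obtained by going clockwise around its polygon). $\mathsf{Pol}(x)$ is the set of polygons of $x$, $\mathsf{Vert}(P)$ the set of labels of vertices of $P$; $\min P$ (resp. $\max P$), the smallest (resp. largest) element of $\mathsf{Vert}(P)$, is the initial (resp. terminal) index of $P$. An index $\ell$ is nested in $P$ if $\ell\notin\mathsf{Vert}(P)$ and $\min P<\ell<\max P$. $\mathsf{supp}(x)$ is the set of non-fixed points of $x$, $D_x^c=\mathsf{supp}(x)\setminus\{\text{terminal indices of polygons of }x\}$, $U_x^c=\mathsf{supp}(x)\setminus\{\text{initial indices of polygons of }x\}$. Definition of $\mathsf{inv}_c$: put $M_x^c=D_x^c\cap U_x^c\cap L_c$ and let $N_x^c$ be the set of $k\in L_c\setminus\mathsf{supp}(x)$ nested in at least one polygon of $x$. For $k\in N_x^c$ there is a unique polygon $P\in\mathsf{Pol}(x)$ in which $k$ is nested such that replacing $P$ by the polygon with vertex set $\mathsf{Vert}(P)\cup\{k\}$ keeps the diagram noncrossing. Adding in this way, one after the other, all $k\in N_x^c$ to polygons of $x$ (the result does not depend on the order) yields $x'\in\mathsf{NC}(\mathfrak S_{n+1},c)$; removing then from the polygons of $x'$ all vertices with label in $M_x^c$ yields $\mathsf{inv}_c(x)\in\mathsf{NC}(\mathfrak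 S_{n+1},c)$. -}

module Defs where

open import Data.Bool.Base using (if_then_else_)
import Data.Bool.Properties as Bool
open import Data.Fin.Base using (Fin; zero; suc; inject₁; fromℕ; toℕ; _≤_; _<_)
open import Data.Fin.Properties using (_≟_; _≤?_; _<?_; any?; all?)
open import Data.Fin.Permutation
  using (Permutation′; _⟨$⟩ʳ_; _≈_; id; flip; _∘ₚ_; transpose)
open import Data.Fin.Subset
  using (Subset; _∈_; _∉_; _∩_; _∪_; _─_; ⁅_⁆; Empty)
open import Data.Fin.Subset.Properties using (_∈?_; nonempty?)
open import Data.List.Base as List using (List; []; _∷_; length; allFin; filter; foldr; foldl; deduplicate)
open import Data.List.Relation.Binary.Permutation.Propositional using (_↭_)
open import Data.List.Relation.Unary.All using (All)
open import Data.List.Relation.Unary.AllPairs using (AllPairs; allPairs?)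
open import Data.List.Relation.Unary.Any as Any using ()
open import Data.Nat.Base as ℕ using (ℕ; suc)
open import Data.Nat.GeneralisedArithmetic using (iterate)
open import Data.Product.Base using (_×_; ∃-syntax)
open import Data.Vec.Base as Vec using ()
open import Data.Vec.Properties using (≡-dec)
open import Relation.Binary.PropositionalEquality.Core using (_≡_; _≢_)
open import Relation.Nullary.Decidable
  using (Dec; does; ¬?; _×-dec_; _⊎-dec_; _→-dec_)
open import Relation.Nullary.Negation using (¬_)
open import Relation.Unary using (Decidable)

private
  variable
    n : ℕ

infixr 9 _·_

-- Right-to-left product: (u · v) i = u (v i).
_·_ : Permutation′ n → Permutation′ n → Permutation′ n
u · v = v ∘ₚ u

∏ : List (Permutation′ n) → Permutation′ n
∏ = foldr _·_ id

IsTransposition : Permutation′ n → Set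
IsTransposition t = ∃[ i ] ∃[ j ] i ≢ j × t ≈ transpose i j

-- IsℓT w k states that ℓ_T(w) = k.
IsℓT : Permutation′ n → ℕ → Set
IsℓT w k =
  (∃[ ts ] All IsTransposition ts × ∏ ts ≈ w × length ts ≡ k)
  × (∀ ts → All IsTransposition ts → ∏ ts ≈ w → k ℕ.≤ length ts)

infix 4 _≤T_

_≤T_ : Permutation′ n → Permutation′ n → Set
u ≤T v = ∃[ a ] ∃[ b ] IsℓT u a × IsℓT (flip u · v) b × IsℓT v (a ℕ.+ b)

-- The label ℓ ∈ {1, …, n+1} is the element of Fin (suc n) with value ℓ - 1.
-- The argument i : Fin n likewise stands for the index i + 1 of s.
s : Fin n → Permutation′ (suc n)
s i = transpose (inject₁ i) (suc i)

IsStandardCoxeter : Permutation′ (suc n) → Set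
IsStandardCoxeter {n} c = ∃[ is ] is ↭ allFin n × c ≈ ∏ (List.map s is)

InNC : Permutation′ (suc n) → Permutation′ (suc n) → Set
InNC c u = u ≤T c

-- Below, a polygon is given by the set of labels of its vertices.

⟦_⟧ : {P : Fin n → Set} → Decidable P → Subset n
⟦ P? ⟧ = Vec.tabulate (λ i → does (P? i))

infix 4 _≟ˢ_

_≟ˢ_ : (P Q : Subset n) → Dec (P ≡ Q)
_≟ˢ_ = ≡-dec Bool._≟_

IsMin IsMax : Subset n → Fin n → Set
IsMin P i = i ∈ P × (∀ j → j ∈ P → i ≤ j)
IsMax P i = i ∈ P × (∀ j → j ∈ P → j ≤ i)

isMin? : (P : Subset n) → Decidable (IsMin P)
isMin? P i = (i ∈? P) ×-dec all? (λ j → (j ∈? P) →-dec (i ≤? j))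

isMax? : (P : Subset n) → Decidable (IsMax P)
isMax? P i = (i ∈? P) ×-dec all? (λ j → (j ∈? P) →-dec (j ≤? i))

Nested : Subset n → Fin n → Set
Nested P i = i ∉ P × (∃[ a ] IsMin P a × a < i) × (∃[ b ] IsMax P b × i < b)

nested? : (P : Subset n) → Decidable (Nested P)
nested? P i =
  ¬? (i ∈? P)
  ×-dec any? (λ a → isMin? P a ×-dec (a <? i))
  ×-dec any? (λ b → isMax? P b ×-dec (i <? b))

supp : Permutation′ n → Subset n
supp x = ⟦ (λ i → ¬? (x ⟨$⟩ʳ i ≟ i)) ⟧

-- Each cycle of a permutation of Fin n has length at most n, so that the
-- exponents 0, …, n-1 reach all of it.
orbit : Permutation′ n → Fin n → Subset n
orbit {n} x i = ⟦ (λ j → any? {n} (λ m → iterate (x ⟨$⟩ʳ_) i (toℕ m) ≟ j)) ⟧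

-- The duplicate-free list of the supports of the nontrivial cycles.
Pol : Permutation′ n → List (Subset n)
Pol {n} x =
  deduplicate _≟ˢ_ (List.map (orbit x) (filter (_∈? supp x) (allFin n)))

initialIndices terminalIndices : Permutation′ n → Subset n
initialIndices  x = ⟦ (λ i → Any.any? (λ P → isMin? P i) (Pol x)) ⟧
terminalIndices x = ⟦ (λ i → Any.any? (λ P → isMax? P i) (Pol x)) ⟧

D U : Permutation′ n → Subset n
D x = supp x ─ terminalIndices x
U x = supp x ─ initialIndices x

-- point c j is the label i_{j+1} in c = (i_1, …, i_{n+1}), where i_1 = 1.
point : Permutation′ (suc n) → Fin (suc n) → Fin (suc n)
point c j = iterate (c ⟨$⟩ʳ_) zero (toℕ j)

-- L_c = {i_k, …, i_{n+1}, i_1}, where i_k = n+1.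
L : Permutation′ (suc n) → Subset (suc n)
L {n} c = ⟦ (λ ℓ →
  (ℓ ≟ point c zero)
  ⊎-dec any? (λ k → any? (λ j →
          (point c k ≟ fromℕ n) ×-dec (k ≤? j) ×-dec (ℓ ≟ point c j)))) ⟧

-- Going clockwise from i_1, one meets a vertex of P, then one of Q, then one
-- of P, then one of Q.
Alternate : Permutation′ (suc n) → Subset (suc n) → Subset (suc n) → Set
Alternate c P Q = ∃[ i ] ∃[ j ] ∃[ k ] ∃[ l ]
  i < j × j < k × k < l
  × point c i ∈ P × point c j ∈ Q × point c k ∈ P × point c l ∈ Q

alternate? : (c : Permutation′ (suc n)) (P Q : Subset (suc n)) →
             Dec (Alternate c P Q)
alternate? c P Q = any? λ i → any? λ j → any? λ k → any? λ l →
  (i <? j) ×-dec (j <? k) ×-dec (k <? l)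
  ×-dec (point c i ∈? P) ×-dec (point c j ∈? Q)
  ×-dec (point c k ∈? P) ×-dec (point c l ∈? Q)

-- The convex hulls of P and Q are disjoint: P and Q have no common vertex,
-- and no chord of P crosses a chord of Q.
DisjointHulls : Permutation′ (suc n) → Subset (suc n) → Subset (suc n) → Set
DisjointHulls c P Q = Empty (P ∩ Q) × ¬ Alternate c P Q × ¬ Alternate c Q P

disjointHulls? : (c : Permutation′ (suc n)) (P Q : Subset (suc n)) →
                 Dec (DisjointHulls c P Q)
disjointHulls? c P Q =
  ¬? (nonempty? (P ∩ Q)) ×-dec ¬? (alternate? c P Q) ×-dec ¬? (alternate? c Q P)

Noncrossing : Permutation′ (suc n) → List (Subset (suc n)) → Set
Noncrossing c = AllPairs (DisjointHulls c)

noncrossing? : (c : Permutation′ (suc n)) → Decidable (Noncrossing c)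
noncrossing? c = allPairs? (disjointHulls? c)

-- The cycle a₁ ↦ a₂ ↦ … ↦ aₘ ↦ a₁, as (a₁ a₂)(a₂ a₃)⋯(aₘ₋₁ aₘ).
cycle : List (Fin n) → Permutation′ n
cycle []           = id
cycle (a ∷ [])     = id
cycle (a ∷ b ∷ as) = transpose a b · cycle (b ∷ as)

clockwise : Permutation′ (suc n) → Subset (suc n) → List (Fin (suc n))
clockwise {n} c P = filter (_∈? P) (List.map (point c) (allFin (suc n)))

-- The permutation represented by a diagram of pairwise disjoint polygons.
fromPol : Permutation′ (suc n) → List (Subset (suc n)) → Permutation′ (suc n)
fromPol c Ps = ∏ (List.map (λ P → cycle (clockwise c P)) Ps)

M : Permutation′ (suc n) → Permutation′ (suc n) → Subset (suc n)
M c x = D x ∩ U x ∩ L c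

N : Permutation′ (suc n) → Permutation′ (suc n) → Subset (suc n)
N c x = ⟦ (λ k →
  (k ∈? L c ─ supp x) ×-dec Any.any? (λ P → nested? P k) (Pol x)) ⟧

replace : Subset n → Subset n → List (Subset n) → List (Subset n)
replace P P′ = List.map (λ Q → if does (Q ≟ˢ P) then P′ else Q)

-- P is a polygon in which k is nested and to which k can be added so that
-- the diagram Ps stays noncrossing.
Admits : Permutation′ (suc n) → List (Subset (suc n)) → Fin (suc n) →
         Subset (suc n) → Set
Admits c Ps k P = Nested P k × Noncrossing c (replace P (P ∪ ⁅ k ⁆) Ps)

admits? : (c : Permutation′ (suc n)) (Ps : List (Subset (suc n)))
          (k : Fin (suc n)) → Decidable (Admits c Ps k)
admits? c Ps k P = nested? P k ×-dec noncrossing? c (replace P (P ∪ ⁅ k ⁆) Ps)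

-- The polygon admitting k is unique in the situations of interest, so that
-- exactly one member of the list is changed.
addVertex : Permutation′ (suc n) → List (Subset (suc n)) → Fin (suc n) →
            List (Subset (suc n))
addVertex c Ps k =
  List.map (λ P → if does (admits? c Ps k P) then P ∪ ⁅ k ⁆ else P) Ps

-- The polygons of x′; the elements of N_x^c are added in increasing order.
addN : Permutation′ (suc n) → Permutation′ (suc n) → List (Subset (suc n))
addN {n} c x = foldl (addVertex c) (Pol x) (filter (_∈? N c x) (allFin (suc n)))

inv : Permutation′ (suc n) → Permutation′ (suc n) → Permutation′ (suc n)
inv c x = fromPol c (List.map (_─ M c x) (addN c x))

{-# OPTIONS --safe #-}
module Submission where

-- Place the labels on a circle in the order of c and let C a b d say that a, b, d
-- are met clockwise in this order.  An element of the absolute order interval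
-- below c is the same as a permutation x mapping every open arc from i to x i
-- into itself.  Indeed a factorisation of c into n transpositions is a spanning
-- tree, so undoing one of its factors always cuts a cycle along a chord, which
-- preserves this property.  Conversely such an x is a product of as many
-- transpositions as it has ascents, x⁻¹c inherits the property, and the ascents
-- of x and of x⁻¹c add up to at most n.
--
-- The only fact used about c itself is that for a < k < b the points k, a, b are
-- met in this order if k lies on the left-hand side, and k, b, a otherwise.  It
-- shows that exactly one polygon admits a new vertex k, and that an element is
-- determined by its sets D and U.  As inv c exchanges the sets M and N and
-- changes D and U by replacing M with N, it is an involution.

open import Defs
open import Data.Nat.Base using (ℕ; suc; _≤_)
open import Data.Fin.Permutation using (Permutation′; _≈_)
open import Data.Fin.Subset using (_∪_; _─_)
open import Data.List.Base using (length)
open import Data.Product.Base using (_×_)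
open import Relation.Binary.PropositionalEquality.Core using (_≡_)

open import Data.Bool.Base using (Bool; true; false; if_then_else_)
open import Data.Empty using (⊥)
open import Data.Fin.Base as Fin using (Fin; toℕ; fromℕ; fromℕ<; inject₁)
import Data.Fin.Properties as Fin
open import Data.Fin.Properties using (_≟_; any?)
open import Data.Fin.Permutation as Perm using (_⟨$⟩ʳ_; _⟨$⟩ˡ_; inverseˡ; inverseʳ; flip; transpose)
open import Data.Fin.Subset using (Subset; _∈_; _∉_; _⊆_; _∩_; ⁅_⁆)
open import Data.Fin.Subset.Properties
  using (_∈?_; ⊆-antisym; x∈⁅x⁆; x∈⁅y⁆⇒x≡y; x∈p∩q⁺; x∈p∩q⁻; x∈p∪q⁺; x∈p∪q⁻;
         x∈p∧x∉q⇒x∈p─q; p─q⊆p)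
open import Data.List.Base as List using (List; []; _∷_; _++_; allFin; filter; foldl)
import Data.List.Properties as List
open import Data.List.Membership.Propositional using (find; lose) renaming (_∈_ to _∈ₗ_; _∉_ to _∉ₗ_)
open import Data.List.Membership.Propositional.Properties as ∈ₗ
  using (∈-allFin; ∈-filter⁺; ∈-filter⁻; ∈-map⁺; ∈-map⁻; ∈-deduplicate⁺; ∈-deduplicate⁻; ∈-++⁻)
open import Data.List.Relation.Binary.Permutation.Propositional using (_↭_; ↭-sym; ↭⇒↭ₛ)
open import Data.List.Relation.Binary.Permutation.Propositional.Properties
  using (↭-length; ∈-resp-↭)
open import Data.List.Relation.Binary.Pointwise as Pointwise using (Pointwise; []; _∷_)
open import Data.List.Relation.Unary.All as All using (All; []; _∷_)
import Data.List.Relation.Unary.All.Properties as All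
open import Data.List.Relation.Unary.AllPairs as AllPairs using (AllPairs; []; _∷_)
import Data.List.Relation.Unary.AllPairs.Properties as AllPairs
open import Data.List.Relation.Unary.Any as Any using (Any; here; there)
open import Data.List.Relation.Unary.Unique.Propositional using (Unique)
open import Data.List.Relation.Unary.Unique.Propositional.Properties as Unique
  using (allFin⁺; Unique[x∷xs]⇒x∉xs)
open import Data.List.Relation.Unary.Unique.DecPropositional.Properties using (deduplicate-!)
open import Data.Nat.Base as ℕ using (zero; _<_; _+_; _∸_; z≤n; s≤s)
import Data.Nat.Properties as ℕ
open import Data.Nat.GeneralisedArithmetic using (iterate)
open import Data.Product.Base using (∃-syntax; _,_; proj₁; proj₂; -,_)
open import Data.Sum.Base using (_⊎_; inj₁; inj₂; [_,_]′)
import Data.List.Relation.Binary.Permutation.Setoid.Properties as Permutation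
open import Data.Vec.Base using (_∷_; here; there)
import Data.Vec.Properties as Vec
open import Function.Base using (_∘_)
open import Relation.Binary.Core using (Rel)
open import Relation.Binary.Definitions using (Transitive; Irreflexive; tri<; tri≈; tri>)
open import Relation.Binary.PropositionalEquality
  using (_≢_; refl; sym; trans; cong; cong₂; subst; subst₂; setoid; module ≡-Reasoning)
open import Relation.Nullary.Decidable
  using (Dec; yes; no; does; ¬?; _×-dec_; _⊎-dec_; dec-true; dec-false; decidable-stable)
open import Relation.Nullary.Negation using (¬_; contradiction)
open import Relation.Unary using (Decidable)
open import Level using (0ℓ)

-- The recipe for `inv c` chooses a polygon for every added label, and nothing in it says directly
-- that a second application returns a removed label to the polygon it came from. The detour through
-- `D` and `U` avoids following individual vertices. Labels in `M` are neither initial nor terminal,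
-- and labels in `N` lie strictly between the extremes of their polygons, so that every polygon
-- keeps its smallest and its largest vertex. Hence a removed label is nested afterwards, an added
-- one is neither initial nor terminal, and `M` and `N` trade places. Membership in the interval is
-- phrased through minimal lengths, which say nothing about polygons. Lower bounds on lengths come
-- from counting classes of points: a transposition merges at most two classes and `c` has a single
-- cycle, so that n factors are needed and a factorisation with exactly n factors wastes none of
-- them.

private
  variable
    n : ℕ
    A B : Set

-- Finite sets and lists

unique-⊆⇒length≤ : {xs ys : List A} → Unique xs → (∀ {a} → a ∈ₗ xs → a ∈ₗ ys) →
                   length xs ≤ length ys
unique-⊆⇒length≤ {xs = []} u sub = z≤n
unique-⊆⇒length≤ {xs = x ∷ xs} (x≢ ∷ u) sub
  with as , bs , refl ← ∈ₗ.∈-∃++ (sub (here refl)) =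
  ℕ.≤-trans (s≤s (unique-⊆⇒length≤ u sub′)) (ℕ.≤-reflexive len)
  where
  sub′ : ∀ {a} → a ∈ₗ xs → a ∈ₗ as ++ bs
  sub′ a∈ with ∈-++⁻ as (sub (there a∈))
  ... | inj₁ p = ∈ₗ.∈-++⁺ˡ p
  ... | inj₂ (here refl) = contradiction refl (All.lookup x≢ a∈)
  ... | inj₂ (there p) = ∈ₗ.∈-++⁺ʳ as p
  len : suc (length (as ++ bs)) ≡ length (as ++ x ∷ bs)
  len rewrite List.length-++ as {bs} | List.length-++ as {x ∷ bs} =
    sym (ℕ.+-suc (length as) (length bs))

-- Besides linear orders, this is applied to `C a`, the clockwise order as seen from `a`, in which
-- `a` itself is comparable to nothing.
maximum-∈ : {_⋖_ : Rel A 0ℓ} → (∀ a b → Dec (a ⋖ b)) → Transitive _⋖_ → Irreflexive _≡_ _⋖_ →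
            (xs : List A) {a : A} → a ∈ₗ xs → ∃[ m ] m ∈ₗ xs × (∀ {b} → b ∈ₗ xs → ¬ (m ⋖ b))
maximum-∈ _⋖?_ tr irr (x ∷ []) _ = x , here refl , λ { (here refl) → irr refl }
maximum-∈ _⋖?_ tr irr (x ∷ xs@(_ ∷ _)) _
  with m , m∈ , max ← maximum-∈ _⋖?_ tr irr xs (here refl) | m ⋖? x
... | no m⋖̸x = m , there m∈ , λ { (here refl) → m⋖̸x ; (there b∈) → max b∈ }
... | yes m⋖x = x , here refl , λ { (here refl) → irr refl ; (there b∈) x⋖b → max b∈ (tr m⋖x x⋖b) }

maximum : {_⋖_ : Rel (Fin n) 0ℓ} {S : Fin n → Set} →
          (∀ a b → Dec (a ⋖ b)) → Transitive _⋖_ → Irreflexive _≡_ _⋖_ →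
          Decidable S → ∀ {i} → S i → ∃[ m ] S m × (∀ {j} → S j → ¬ (m ⋖ j))
maximum _⋖?_ tr irr S? {i} Si
  with m , m∈ , max ← maximum-∈ _⋖?_ tr irr (filter S? (allFin _)) (∈-filter⁺ S? (∈-allFin i) Si) =
  m , proj₂ (∈-filter⁻ S? {xs = allFin _} m∈) , λ Sj → max (∈-filter⁺ S? (∈-allFin _) Sj)

∈⟦⟧⁺ : {P : Fin n → Set} (P? : Decidable P) {i : Fin n} → P i → i ∈ ⟦ P? ⟧
∈⟦⟧⁺ P? {i} Pi = Vec.lookup⇒[]= i _ (trans (Vec.lookup∘tabulate _ i) (dec-true (P? i) Pi))

∈⟦⟧⁻ : {P : Fin n → Set} (P? : Decidable P) {i : Fin n} → i ∈ ⟦ P? ⟧ → P i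
∈⟦⟧⁻ P? {i} i∈ with P? i | trans (sym (Vec.lookup∘tabulate _ i)) (Vec.[]=⇒lookup i∈)
... | yes Pi | _ = Pi

∉─ : (p q : Subset n) {i : Fin n} → i ∈ p ─ q → i ∉ q
∉─ (_ ∷ p) (false ∷ q) here ()
∉─ (_ ∷ p) (false ∷ q) (there i∈) (there i∈q) = ∉─ p q i∈ i∈q
∉─ (_ ∷ p) (true ∷ q) (there i∈) (there i∈q) = ∉─ p q i∈ i∈q

-- Orbits

perm-injective : (x : Permutation′ n) {i j : Fin n} → x ⟨$⟩ʳ i ≡ x ⟨$⟩ʳ j → i ≡ j
perm-injective x eq = trans (sym (inverseˡ x)) (trans (cong (x ⟨$⟩ˡ_) eq) (inverseˡ x))

iterate-suc : (f : A → A) (a : A) (k : ℕ) → iterate f a (suc k) ≡ f (iterate f a k)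
iterate-suc f a zero = refl
iterate-suc f a (suc k) = iterate-suc f (f a) k

iterate-+ : (f : A → A) (a : A) (k l : ℕ) → iterate f a (k + l) ≡ iterate f (iterate f a k) l
iterate-+ f a zero l = refl
iterate-+ f a (suc k) l = iterate-+ f (f a) k l

iterate-injective : {f : A → A} → (∀ {a b} → f a ≡ f b → a ≡ b) →
                    ∀ k {a b} → iterate f a k ≡ iterate f b k → a ≡ b
iterate-injective inj zero eq = eq
iterate-injective inj (suc k) eq = inj (iterate-injective inj k eq)

-- Two of the first `n + 1` iterates coincide, and injectivity cancels their common initial steps.
-- The bound `m < n` lets an orbit close up within the exponents that `orbit` inspects.
period : (x : Permutation′ n) (i : Fin n) → ∃[ m ] m < n × iterate (x ⟨$⟩ʳ_) i (suc m) ≡ i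
period {n} x i
  with a , b , a<b , eq ← Fin.pigeonhole (ℕ.n<1+n n) (λ k → iterate (x ⟨$⟩ʳ_) i (toℕ k)) =
  toℕ b ∸ suc (toℕ a) , bound ,
  iterate-injective (perm-injective x) (toℕ a)
    (trans (sym (iterate-+ (x ⟨$⟩ʳ_) i (suc (toℕ b ∸ suc (toℕ a))) (toℕ a)))
      (trans (cong (iterate (x ⟨$⟩ʳ_) i) arith) (sym eq)))
  where
  arith : suc (toℕ b ∸ suc (toℕ a)) + toℕ a ≡ toℕ b
  arith = trans (sym (ℕ.+-suc _ (toℕ a))) (ℕ.m∸n+n≡m a<b)
  bound : toℕ b ∸ suc (toℕ a) < n
  bound = ℕ.≤-trans (ℕ.+-monoʳ-≤ 1 (ℕ.m≤m+n _ (toℕ a)))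
            (ℕ.≤-trans (ℕ.≤-reflexive arith) (Fin.toℕ≤pred[n] b))

module _ (x : Permutation′ n) where
  private
    f : Fin n → Fin n
    f = x ⟨$⟩ʳ_
    hits? : (i : Fin n) → Decidable (λ j → ∃[ m ] iterate f i (toℕ {n} m) ≡ j)
    hits? i j = any? (λ m → iterate f i (toℕ m) ≟ j)

  ∈orbit⁻ : ∀ {i j} → j ∈ orbit x i → ∃[ k ] iterate f i k ≡ j
  ∈orbit⁻ {i} j∈ = let m , eq = ∈⟦⟧⁻ (hits? i) j∈ in toℕ m , eq

  ∈orbit-< : ∀ {i} k → k < n → iterate f i k ∈ orbit x i
  ∈orbit-< {i} k k<n = ∈⟦⟧⁺ (hits? i) (fromℕ< k<n , cong (iterate f i) (Fin.toℕ-fromℕ< k<n))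

  orbit-step : ∀ {i j} → j ∈ orbit x i → f j ∈ orbit x i
  orbit-step {i} {j} j∈ with m , eq ← ∈⟦⟧⁻ (hits? i) j∈ | suc (toℕ m) ℕ.<? n
  ... | yes lt = subst (_∈ orbit x i) (trans (iterate-suc f i (toℕ m)) (cong f eq)) (∈orbit-< _ lt)
  -- Here `suc m` equals `n`, just outside the range of `orbit`; subtracting the period `suc p`
  -- brings the exponent back into it.
  ... | no ≮ with p , p<n , per ← period x i =
    subst (_∈ orbit x i)
      (trans (trans (trans (cong (λ a → iterate f a (n ∸ suc p)) (sym per)) (sym (iterate-+ f i (suc p) (n ∸ suc p))))
        (cong (iterate f i) (trans (ℕ.m+[n∸m]≡n p<n) (ℕ.≤-antisym (ℕ.≮⇒≥ ≮) (Fin.toℕ<n m)))))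
        (trans (iterate-suc f i (toℕ m)) (cong f eq)))
      (∈orbit-< (n ∸ suc p) (ℕ.∸-monoʳ-< {o = 0} (s≤s z≤n) p<n))

  orbit-refl : ∀ {i} → i ∈ orbit x i
  orbit-refl {i} = ∈orbit-< 0 (ℕ.≤-<-trans z≤n (Fin.toℕ<n i))

  orbit-induction : (S : Fin n → Set) → (∀ {j} → S j → S (f j)) →
                    ∀ {i j} → S i → j ∈ orbit x i → S j
  orbit-induction S step {i} Si j∈ with k , refl ← ∈orbit⁻ j∈ = go i Si k
    where
    go : ∀ i → S i → ∀ k → S (iterate f i k)
    go i Si zero = Si
    go i Si (suc k) = go (f i) (step Si) k

  orbit-trans : ∀ {i j k} → j ∈ orbit x i → k ∈ orbit x j → k ∈ orbit x i
  orbit-trans {i} = orbit-induction (_∈ orbit x i) orbit-step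

  orbit-sym : ∀ {i j} → j ∈ orbit x i → i ∈ orbit x j
  orbit-sym {i} = orbit-induction (λ j → i ∈ orbit x j)
    (λ {j} i∈ → orbit-trans (back j) i∈) orbit-refl
    where
    back : ∀ j → j ∈ orbit x (f j)
    back j with p , p<n , per ← period x j = subst (_∈ orbit x (f j)) per (∈orbit-< p p<n)

  orbit-image : ∀ {i} → f i ∈ orbit x i
  orbit-image = orbit-step orbit-refl

  orbit-≡ : ∀ {i j} → j ∈ orbit x i → orbit x j ≡ orbit x i
  orbit-≡ j∈ = ⊆-antisym (orbit-trans j∈) (orbit-trans (orbit-sym j∈))

  private
    moved? : Decidable (λ i → f i ≢ i)
    moved? i = ¬? (f i ≟ i)

  ∈supp⁺ : ∀ {i} → f i ≢ i → i ∈ supp x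
  ∈supp⁺ = ∈⟦⟧⁺ moved?

  ∈supp⁻ : ∀ {i} → i ∈ supp x → f i ≢ i
  ∈supp⁻ = ∈⟦⟧⁻ moved?

  ∈Pol⁺ : ∀ {i} → i ∈ supp x → orbit x i ∈ₗ Pol x
  ∈Pol⁺ {i} i∈ = ∈-deduplicate⁺ _≟ˢ_ (∈-map⁺ (orbit x) (∈-filter⁺ (_∈? supp x) (∈-allFin i) i∈))

  ∈Pol⁻ : ∀ {P} → P ∈ₗ Pol x → ∃[ i ] i ∈ supp x × P ≡ orbit x i
  ∈Pol⁻ P∈ with i , i∈ , eq ← ∈-map⁻ (orbit x) (∈-deduplicate⁻ _≟ˢ_ _ P∈) =
    i , proj₂ (∈-filter⁻ (_∈? supp x) {xs = allFin n} i∈) , eq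

  unique-Pol : Unique (Pol x)
  unique-Pol = deduplicate-! _≟ˢ_ _

  fixed-orbit : ∀ {i j} → f i ≡ i → j ∈ orbit x i → j ≡ i
  fixed-orbit {i} fix = orbit-induction (_≡ i) (λ { refl → fix }) refl

  supp-orbit : ∀ {i j} → i ∈ supp x → j ∈ orbit x i → j ∈ supp x
  supp-orbit i∈ j∈ = ∈supp⁺ λ fix → ∈supp⁻ i∈
    (trans (cong f (fixed-orbit fix (orbit-sym j∈))) (trans fix (sym (fixed-orbit fix (orbit-sym j∈)))))

  ≢⇒∈supp : ∀ {i j} → j ∈ orbit x i → j ≢ i → i ∈ supp x
  ≢⇒∈supp j∈ j≢i = ∈supp⁺ λ fix → j≢i (fixed-orbit fix j∈)

  Pol-orbit : ∀ {P i} → P ∈ₗ Pol x → i ∈ P → P ≡ orbit x i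
  Pol-orbit P∈ i∈ with _ , _ , refl ← ∈Pol⁻ P∈ = sym (orbit-≡ i∈)

  Pol⊆supp : ∀ {P i} → P ∈ₗ Pol x → i ∈ P → i ∈ supp x
  Pol⊆supp P∈ i∈ with _ , j∈ , refl ← ∈Pol⁻ P∈ = supp-orbit j∈ i∈

-- Cyclic orders

module CyclicOrder (key : Fin n → ℕ) (key-injective : ∀ {i j} → key i ≡ key j → i ≡ j) where

  infix 4 _≺_

  _≺_ : Rel (Fin n) 0ℓ
  i ≺ j = key i < key j

  -- Going clockwise from a, one meets b before d; the three points are distinct.
  C : Fin n → Fin n → Fin n → Set
  C a b d = (a ≺ b × b ≺ d) ⊎ (b ≺ d × d ≺ a) ⊎ (d ≺ a × a ≺ b)

  ≺-cmp : ∀ {a b} → a ≢ b → a ≺ b ⊎ b ≺ a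
  ≺-cmp {a} {b} a≢b with ℕ.<-cmp (key a) (key b)
  ... | tri< lt _ _ = inj₁ lt
  ... | tri≈ _ eq _ = contradiction (key-injective eq) a≢b
  ... | tri> _ _ gt = inj₂ gt

  ≺-trans : Transitive _≺_
  ≺-trans = ℕ.<-trans

  ≺-asym : ∀ {a b} → a ≺ b → ¬ (b ≺ a)
  ≺-asym = ℕ.<-asym

  ≺⇒≢ : ∀ {a b} → a ≺ b → a ≢ b
  ≺⇒≢ a≺b refl = ℕ.<-irrefl refl a≺b

  C? : ∀ a b d → Dec (C a b d)
  C? a b d = (a ≺? b ×-dec b ≺? d) ⊎-dec (b ≺? d ×-dec d ≺? a) ⊎-dec (d ≺? a ×-dec a ≺? b)
    where
    _≺?_ : ∀ i j → Dec (i ≺ j)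
    i ≺? j = key i ℕ.<? key j

  C-rot : ∀ {a b d} → C a b d → C b d a
  C-rot (inj₁ p) = inj₂ (inj₂ p)
  C-rot (inj₂ (inj₁ p)) = inj₁ p
  C-rot (inj₂ (inj₂ p)) = inj₂ (inj₁ p)

  C-rot² : ∀ {a b d} → C a b d → C d a b
  C-rot² = C-rot ∘ C-rot

  C-asym : ∀ {a b d} → C a b d → ¬ C a d b
  C-asym (inj₁ (ab , bd)) (inj₁ (ad , db)) = ≺-asym bd db
  C-asym (inj₁ (ab , bd)) (inj₂ (inj₁ (db , ba))) = ≺-asym bd db
  C-asym (inj₁ (ab , bd)) (inj₂ (inj₂ (ba , ad))) = ≺-asym ab ba
  C-asym (inj₂ (inj₁ (bd , da))) (inj₁ (ad , db)) = ≺-asym bd db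
  C-asym (inj₂ (inj₁ (bd , da))) (inj₂ (inj₁ (db , ba))) = ≺-asym bd db
  C-asym (inj₂ (inj₁ (bd , da))) (inj₂ (inj₂ (ba , ad))) = ≺-asym ad da
  C-asym (inj₂ (inj₂ (da , ab))) (inj₁ (ad , db)) = ≺-asym ad da
  C-asym (inj₂ (inj₂ (da , ab))) (inj₂ (inj₁ (db , ba))) = ≺-asym ab ba
  C-asym (inj₂ (inj₂ (da , ab))) (inj₂ (inj₂ (ba , ad))) = ≺-asym ad da

  C-trans : ∀ {a b d e} → C a b d → C a d e → C a b e
  C-trans (inj₁ (ab , bd)) (inj₁ (ad , de)) = inj₁ (ab , ≺-trans bd de)
  C-trans (inj₁ (ab , bd)) (inj₂ (inj₁ (de , ea))) =
    contradiction (≺-trans de ea) (≺-asym (≺-trans ab bd))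
  C-trans (inj₁ (ab , bd)) (inj₂ (inj₂ (ea , ad))) = inj₂ (inj₂ (ea , ab))
  C-trans (inj₂ (inj₁ (bd , da))) (inj₁ (ad , de)) = contradiction da (≺-asym ad)
  C-trans (inj₂ (inj₁ (bd , da))) (inj₂ (inj₁ (de , ea))) = inj₂ (inj₁ (≺-trans bd de , ea))
  C-trans (inj₂ (inj₁ (bd , da))) (inj₂ (inj₂ (ea , ad))) = contradiction da (≺-asym ad)
  C-trans (inj₂ (inj₂ (da , ab))) (inj₁ (ad , de)) = contradiction da (≺-asym ad)
  C-trans (inj₂ (inj₂ (da , ab))) (inj₂ (inj₁ (de , ea))) = inj₂ (inj₂ (ea , ab))
  C-trans (inj₂ (inj₂ (da , ab))) (inj₂ (inj₂ (ea , ad))) = contradiction da (≺-asym ad)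

  C-total : ∀ {a b d} → a ≢ b → b ≢ d → a ≢ d → C a b d ⊎ C a d b
  C-total a≢b b≢d a≢d with ≺-cmp a≢b | ≺-cmp b≢d | ≺-cmp a≢d
  ... | inj₁ ab | inj₁ bd | _ = inj₁ (inj₁ (ab , bd))
  ... | inj₁ ab | inj₂ db | inj₁ ad = inj₂ (inj₁ (ad , db))
  ... | inj₁ ab | inj₂ db | inj₂ da = inj₁ (inj₂ (inj₂ (da , ab)))
  ... | inj₂ ba | inj₁ bd | inj₁ ad = inj₂ (inj₂ (inj₂ (ba , ad)))
  ... | inj₂ ba | inj₁ bd | inj₂ da = inj₁ (inj₂ (inj₁ (bd , da)))
  ... | inj₂ ba | inj₂ db | _ = inj₂ (inj₂ (inj₁ (db , ba)))

  C⇒≢₁₂ : ∀ {a b d} → C a b d → a ≢ b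
  C⇒≢₁₂ (inj₁ (ab , _)) refl = ℕ.<-irrefl refl ab
  C⇒≢₁₂ (inj₂ (inj₁ (bd , da))) refl = ≺-asym bd da
  C⇒≢₁₂ (inj₂ (inj₂ (_ , ab))) refl = ℕ.<-irrefl refl ab

  C⇒≢₂₃ : ∀ {a b d} → C a b d → b ≢ d
  C⇒≢₂₃ = C⇒≢₁₂ ∘ C-rot

  C⇒≢₁₃ : ∀ {a b d} → C a b d → a ≢ d
  C⇒≢₁₃ cy eq = C⇒≢₁₂ (C-rot² cy) (sym eq)

  C-compare : ∀ {a b d} → a ≢ b → a ≢ d → ¬ C a d b → b ≡ d ⊎ C a b d
  C-compare {a} {b} {d} a≢b a≢d ¬C with b ≟ d
  ... | yes eq = inj₁ eq
  ... | no b≢d with C-total a≢b b≢d a≢d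
  ... | inj₁ c = inj₂ c
  ... | inj₂ c = contradiction c ¬C

  C-drop : ∀ {a b d e} → C a b d → C a d e → C b d e
  C-drop abd ade = C-rot² (C-trans (C-rot ade) (C-rot² abd))

-- Transpositions

transposeˡ : (i j : Fin n) → transpose i j ⟨$⟩ʳ i ≡ j
transposeˡ i j with i ≟ i
... | yes _ = refl
... | no i≢i = contradiction refl i≢i

transposeʳ : (i j : Fin n) → transpose i j ⟨$⟩ʳ j ≡ i
transposeʳ i j with j ≟ i
... | yes eq = eq
... | no _ with j ≟ j
... | yes _ = refl
... | no j≢j = contradiction refl j≢j

transpose-≢ : {i j k : Fin n} → k ≢ i → k ≢ j → transpose i j ⟨$⟩ʳ k ≡ k
transpose-≢ {i = i} {j} {k} k≢i k≢j with k ≟ i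
... | yes eq = contradiction eq k≢i
... | no _ with k ≟ j
... | yes eq = contradiction eq k≢j
... | no _ = refl

transpose-involutive : (i j k : Fin n) → transpose i j ⟨$⟩ʳ (transpose i j ⟨$⟩ʳ k) ≡ k
transpose-involutive i j k with i ≟ k | j ≟ k
... | yes refl | _ = trans (cong (transpose i j ⟨$⟩ʳ_) (transposeˡ i j)) (transposeʳ i j)
... | no _ | yes refl = trans (cong (transpose i j ⟨$⟩ʳ_) (transposeʳ i j)) (transposeˡ i j)
... | no i≢k | no j≢k = trans (cong (transpose i j ⟨$⟩ʳ_) fix) fix
  where fix = transpose-≢ {i = i} {j} (i≢k ∘ sym) (j≢k ∘ sym)

transpose-isTransposition : {i j : Fin n} → i ≢ j → IsTransposition (transpose i j)
transpose-isTransposition {i = i} {j} i≢j = i , j , i≢j , λ _ → refl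

∏-++ : (us vs : List (Permutation′ n)) → ∏ (us ++ vs) ≈ ∏ us · ∏ vs
∏-++ [] vs i = refl
∏-++ (u ∷ us) vs i = cong (u ⟨$⟩ʳ_) (∏-++ us vs i)

-- Noncrossing permutations

module NoncrossingPermutations
  (key : Fin n → ℕ) (key-injective : ∀ {i j} → key i ≡ key j → i ≡ j) where
  open CyclicOrder key key-injective

  -- The open arc from i to x i is mapped into itself: no cycle crosses an edge
  -- of another one, and every cycle runs clockwise around the circle just once.
  record Gap (x : Permutation′ n) : Set where
    constructor mkGap
    field
      gap : ∀ {i j} → C i j (x ⟨$⟩ʳ i) → C i (x ⟨$⟩ʳ j) (x ⟨$⟩ʳ i)

  open Gap public

  Gap-resp-≈ : ∀ {x y} → x ≈ y → Gap x → Gap y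
  Gap-resp-≈ eq g .gap {i} {j} rewrite sym (eq i) | sym (eq j) = g .gap

  IsSuccessor : Permutation′ n → Set
  IsSuccessor c = ∀ i → c ⟨$⟩ʳ i ≢ i × (∀ j → ¬ C i j (c ⟨$⟩ʳ i))

  module _ {x : Permutation′ n} (gx : Gap x) where
    gap-orbit : ∀ {i j k} → C i j (x ⟨$⟩ʳ i) → k ∈ orbit x j → C i k (x ⟨$⟩ʳ i)
    gap-orbit {i} = orbit-induction x (λ k → C i k (x ⟨$⟩ʳ i)) (gx .gap)

    -- Otherwise the whole orbit, `i` included, would lie in the open arc that begins at `i`.
    orbit-∉gap : ∀ {i j} → j ∈ orbit x i → ¬ C i j (x ⟨$⟩ʳ i)
    orbit-∉gap j∈ cy = C⇒≢₁₂ (gap-orbit cy (orbit-sym x j∈)) refl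

  -- Let `m` be the last point of the orbit met clockwise from `j`. Its image cannot come later
  -- still, so the arc from `m` to `x m` passes over `j`.
  orbit-cover : ∀ (x : Permutation′ n) {i j} → j ∉ orbit x i → x ⟨$⟩ʳ i ≢ i →
                ∃[ o ] o ∈ orbit x i × C o j (x ⟨$⟩ʳ o)
  orbit-cover x {i} {j} j∉ xi≢i
    with m , m∈ , max ← maximum {_⋖_ = C j} (C? j) C-trans (λ { refl cy → C⇒≢₂₃ cy refl })
                          (_∈? orbit x i) (orbit-refl x)
    with C-total {j} {m} {x ⟨$⟩ʳ m} (λ { refl → j∉ m∈ })
           (λ eq → ∈supp⁻ x (supp-orbit x (∈supp⁺ x xi≢i) m∈) (sym eq))
           (λ { refl → j∉ (orbit-step x m∈) })
  ... | inj₁ cy = contradiction cy (max (orbit-step x m∈))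
  ... | inj₂ cy = m , m∈ , C-rot² cy

  -- If `q` lay on another cycle, some edge from `o` to `z` of the cycle of `p` would pass over `q`.
  -- Its arc avoids `p` and `p′`, so it ends before `q′`; but it must contain the whole cycle of
  -- `q`.
  orbits-noncrossing : ∀ {x p p′ q q′} → Gap x → p′ ∈ orbit x p → q′ ∈ orbit x q →
                       C p q p′ → C p′ q′ p → q ∈ orbit x p
  orbits-noncrossing {x} {p} {p′} {q} {q′} gx p′∈ q′∈ pqp′ p′q′p with q ∈? orbit x p
  ... | yes q∈ = q∈
  ... | no q∉ with o , o∈ , oqz ← orbit-cover x q∉ (λ fix → C⇒≢₁₃ pqp′ (sym (fixed-orbit x fix p′∈))) =
    contradiction (C-rot (C-drop qzq′ qq′o)) (C-asym (C-rot (gap-orbit gx oqz q′∈)))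
    where
    z = x ⟨$⟩ʳ o
    p∉gap : ¬ C o p z
    p∉gap = orbit-∉gap gx (orbit-sym x o∈)
    p′∉gap : ¬ C o p′ z
    p′∉gap = orbit-∉gap gx (orbit-trans x (orbit-sym x o∈) p′∈)
    qp′q′ : C q p′ q′
    qp′q′ = C-drop pqp′ (C-rot² p′q′p)
    qq′p : C q q′ p
    qq′p = C-rot (C-trans pqp′ (C-rot² p′q′p))
    qzo : C q z o
    qzo = C-rot oqz
    qzq′ : C q z q′
    qzq′ with C-compare (C⇒≢₂₃ oqz) (C⇒≢₂₃ pqp′) (λ qp′z → p′∉gap (C-rot² (C-drop qp′z qzo)))
    ... | inj₁ eq = subst (λ a → C q a q′) (sym eq) qp′q′
    ... | inj₂ qzp′ = C-trans qzp′ qp′q′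
    qq′o : C q q′ o
    qq′o with C-compare {q} {p} {o} (C⇒≢₁₂ pqp′ ∘ sym) (C⇒≢₁₂ oqz ∘ sym) (λ qop → p∉gap (C-rot (C-drop qzo qop)))
    ... | inj₁ refl = qq′p
    ... | inj₂ qpo = C-trans qq′p qpo

  private
    -- Two points of one cycle exchange their images. This common form serves multiplication by a
    -- transposition on either side.
    record Splits (x x′ : Permutation′ n) (i j : Fin n) : Set where
      field
        i≢j : i ≢ j
        j∈ : j ∈ orbit x i
        at-i : x′ ⟨$⟩ʳ i ≡ x ⟨$⟩ʳ j
        at-j : x′ ⟨$⟩ʳ j ≡ x ⟨$⟩ʳ i
        at-≢ : ∀ {k} → k ≢ i → k ≢ j → x′ ⟨$⟩ʳ k ≡ x ⟨$⟩ʳ k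

    Splits-sym : ∀ {x x′ i j} → Splits x x′ i j → Splits x x′ j i
    Splits-sym {x} s = record
      { i≢j = i≢j ∘ sym ; j∈ = orbit-sym x j∈ ; at-i = at-j ; at-j = at-i
      ; at-≢ = λ k≢j k≢i → at-≢ k≢i k≢j }
      where open Splits s

    gap-at : ∀ {x x′ i j l} → Gap x → Splits x x′ i j →
             C i l (x ⟨$⟩ʳ j) → C i (x′ ⟨$⟩ʳ l) (x ⟨$⟩ʳ j)
    gap-at {x} {x′} {i} {j} {l} gx splits ilz with l ≟ j
    ... | yes refl = subst (λ a → C i a (x ⟨$⟩ʳ j)) (sym at-j) goal
      where
      open Splits splits
      goal : C i (x ⟨$⟩ʳ i) (x ⟨$⟩ʳ j)
      goal with C-compare (λ eq → i≢j (sym (fixed-orbit x (sym eq) j∈))) i≢j (orbit-∉gap gx j∈)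
      ... | inj₁ eq = subst (λ a → C i a (x ⟨$⟩ʳ j)) (sym eq) ilz
      ... | inj₂ cy = C-trans cy ilz
    ... | no l≢j = subst (λ a → C i a z) (sym (at-≢ (C⇒≢₁₂ ilz ∘ sym) l≢j)) goal
      where
      open Splits splits
      z = x ⟨$⟩ʳ j
      i≢z : i ≢ z
      i≢z = C⇒≢₁₃ ilz
      ijz : C i j z
      ijz with C-compare {j} {z} {i} (λ eq → i≢j (fixed-orbit x (sym eq) (orbit-sym x j∈))) (i≢j ∘ sym)
                 (orbit-∉gap gx (orbit-sym x j∈))
      ... | inj₁ eq = contradiction (sym eq) i≢z
      ... | inj₂ jzi = C-rot² jzi
      goal : C i (x ⟨$⟩ʳ l) z
      goal with C-total (C⇒≢₁₂ ilz) l≢j i≢j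
      ... | inj₂ ijl = C-rot (C-trans (C-rot² ijz) (C-rot² (gx .gap (C-drop ijl ilz))))
      -- Now `l` lies between `i` and `j`. If its image were `i` or lay beyond `j`, the arc from `l`
      -- to it would contain `j` but not `i`, although these lie on one cycle.
      ... | inj₁ ilj with x ⟨$⟩ʳ l ≟ i | x ⟨$⟩ʳ l ≟ j
      ... | yes eq | _ = contradiction (sym eq)
        (C⇒≢₂₃ (gap-orbit gx {l} (subst (C l j) (sym eq) (C-rot ilj)) (orbit-sym x j∈)))
      ... | no _ | yes eq = subst (λ a → C i a z) (sym eq) ijz
      ... | no xl≢i | no xl≢j with C-total (xl≢i ∘ sym) xl≢j i≢j
      ... | inj₁ ixlj = C-trans ixlj ijz
      ... | inj₂ ijxl = contradiction (C-rot (C-trans ilj ijxl))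
        (C-asym (gap-orbit gx (C-drop ilj ijxl) (orbit-sym x j∈)))

    Splits⇒Gap : ∀ {x x′ i j} → Gap x → Splits x x′ i j → Gap x′
    Splits⇒Gap {x} {x′} {i} {j} gx splits .gap {k} {l} kl with k ≟ i | k ≟ j
    ... | yes refl | _ =
      subst (C i (x′ ⟨$⟩ʳ l)) (sym at-i) (gap-at gx splits (subst (C i l) at-i kl))
      where open Splits splits
    ... | no _ | yes refl =
      subst (C j (x′ ⟨$⟩ʳ l)) (sym at-j) (gap-at gx (Splits-sym splits) (subst (C j l) at-j kl))
      where open Splits splits
    ... | no k≢i | no k≢j =
      subst (C k (x′ ⟨$⟩ʳ l)) (sym at-k) (gap-orbit gx (subst (C k l) at-k kl) x′l∈)
      where
      open Splits splits
      at-k = at-≢ k≢i k≢j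
      x′l∈ : x′ ⟨$⟩ʳ l ∈ orbit x l
      x′l∈ with l ≟ i | l ≟ j
      ... | yes refl | _ = subst (_∈ orbit x i) (sym at-i) (orbit-step x j∈)
      ... | no _ | yes refl = subst (_∈ orbit x j) (sym at-j) (orbit-step x (orbit-sym x j∈))
      ... | no l≢i | no l≢j = subst (_∈ orbit x l) (sym (at-≢ l≢i l≢j)) (orbit-image x)

  -- Multiplying by a transposition of two points of one cycle cuts its polygon
  -- along a chord.
  Gap-splitʳ : ∀ {x i j} → Gap x → i ≢ j → j ∈ orbit x i → Gap (x · transpose i j)
  Gap-splitʳ {x} {i} {j} gx i≢j j∈ = Splits⇒Gap gx record
    { i≢j = i≢j ; j∈ = j∈
    ; at-i = cong (x ⟨$⟩ʳ_) (transposeˡ i j)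
    ; at-j = cong (x ⟨$⟩ʳ_) (transposeʳ i j)
    ; at-≢ = λ k≢i k≢j → cong (x ⟨$⟩ʳ_) (transpose-≢ k≢i k≢j) }

  -- The points cut apart are `i` and its preimage: the product fixes `i` and sends the preimage
  -- straight to `x i`.
  Gap-splitˡ : ∀ {x i} → Gap x → x ⟨$⟩ʳ i ≢ i → Gap (transpose i (x ⟨$⟩ʳ i) · x)
  Gap-splitˡ {x} {i} gx xi≢i = Splits⇒Gap gx record
    { i≢j = λ eq → xi≢i (trans (cong (x ⟨$⟩ʳ_) (sym eq)) (inverseʳ x))
    ; j∈ = subst (_∈ orbit x k) (inverseʳ x) (orbit-image x)
    ; at-i = trans (cong (transpose i (x ⟨$⟩ʳ i) ⟨$⟩ʳ_) (inverseʳ x)) (transposeˡ i _)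
    ; at-j = trans (transposeʳ i (x ⟨$⟩ʳ i)) (sym (inverseʳ x))
    ; at-≢ = λ l≢k l≢i → transpose-≢ (λ eq → l≢k (trans (sym (inverseˡ x)) (cong (x ⟨$⟩ˡ_) eq)))
                           (λ eq → l≢i (perm-injective x eq)) }
    where k = x ⟨$⟩ˡ i

  module _ {c : Permutation′ n} (succ : IsSuccessor c) where
    Gap-successor : Gap c
    Gap-successor .gap {i} {j} cy = contradiction cy (proj₂ (succ i) j)

    -- This is the Kreweras complement. As `w` maps `k` to `c i`, a point `l` strictly between `k`
    -- and `c i` would have its image `c j` there too; but `j` lies between `i` and `k`, so that
    -- `c j` lies after `c i` and not beyond `k`.
    Gap-complement : ∀ {w} → Gap w → Gap (flip w · c)
    Gap-complement {w} gw .gap {i} {j} ijk = ilk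
      where
      k = w ⟨$⟩ˡ (c ⟨$⟩ʳ i)
      l = w ⟨$⟩ˡ (c ⟨$⟩ʳ j)
      wk : w ⟨$⟩ʳ k ≡ c ⟨$⟩ʳ i
      wk = inverseʳ w
      wl : w ⟨$⟩ʳ l ≡ c ⟨$⟩ʳ j
      wl = inverseʳ w
      ci≤j : c ⟨$⟩ʳ i ≡ j ⊎ C i (c ⟨$⟩ʳ i) j
      ci≤j = C-compare (proj₁ (succ i) ∘ sym) (C⇒≢₁₂ ijk) (proj₂ (succ i) j)
      cj≤k : c ⟨$⟩ʳ j ≡ k ⊎ C j (c ⟨$⟩ʳ j) k
      cj≤k = C-compare (proj₁ (succ j) ∘ sym) (C⇒≢₂₃ ijk) (proj₂ (succ j) k)
      i-ci-k : C i (c ⟨$⟩ʳ i) k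
      i-ci-k with ci≤j
      ... | inj₁ eq = subst (λ a → C i a k) (sym eq) ijk
      ... | inj₂ cy = C-trans cy ijk
      ci≢cj : c ⟨$⟩ʳ i ≢ c ⟨$⟩ʳ j
      ci≢cj eq = C⇒≢₁₂ ijk (perm-injective c eq)
      cj∉ : ¬ C k (c ⟨$⟩ʳ j) (c ⟨$⟩ʳ i)
      cj∉ cy with cj≤k
      ... | inj₁ eq = C⇒≢₁₂ cy (sym eq)
      ... | inj₂ j-cj-k with ci≤j
      ... | inj₁ eq = C-asym (C-rot² (subst (C k (c ⟨$⟩ʳ j)) eq cy)) j-cj-k
      ... | inj₂ i-ci-j = C-asym (C-trans (C-rot² (C-drop i-ci-j ijk)) (C-rot² j-cj-k)) cy
      l∉ : ¬ C k l (c ⟨$⟩ʳ i)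
      l∉ cy = cj∉ (subst₂ (C k) wl wk (gw .gap (subst (C k l) (sym wk) cy)))
      l≢k : l ≢ k
      l≢k eq = ci≢cj (trans (sym wk) (trans (cong (w ⟨$⟩ʳ_) (sym eq)) wl))
      ilk : C i l k
      ilk with i ≟ l
      ... | yes eq = contradiction (subst (λ a → C k a (c ⟨$⟩ʳ i)) eq (C-rot² i-ci-k)) l∉
      ... | no i≢l with C-total i≢l l≢k (C⇒≢₁₃ ijk)
      ... | inj₁ cy = cy
      ... | inj₂ ikl = contradiction (C-rot (C-drop i-ci-k ikl)) l∉

-- Union-find on the edges of a factorisation into transpositions: f maps a
-- point to the representative of its class.

Idempotent : (Fin n → Fin n) → Set
Idempotent f = ∀ i → f (f i) ≡ f i

Respects : (Fin n → Fin n) → Permutation′ n → Set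
Respects f u = ∀ i → f (u ⟨$⟩ʳ i) ≡ f i

fixedPoints : (Fin n → Fin n) → List (Fin n)
fixedPoints f = filter (λ i → f i ≟ i) (allFin _)

∈fixedPoints⁺ : {f : Fin n → Fin n} {i : Fin n} → f i ≡ i → i ∈ₗ fixedPoints f
∈fixedPoints⁺ {f = f} {i} = ∈-filter⁺ (λ i → f i ≟ i) (∈-allFin i)

∈fixedPoints⁻ : {f : Fin n → Fin n} {i : Fin n} → i ∈ₗ fixedPoints f → f i ≡ i
∈fixedPoints⁻ {f = f} i∈ = proj₂ (∈-filter⁻ (λ i → f i ≟ i) {xs = allFin _} i∈)

fixedPoints-unique : (f : Fin n → Fin n) → Unique (fixedPoints f)
fixedPoints-unique f = Unique.filter⁺ (λ i → f i ≟ i) (allFin⁺ _)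

length-allFin : ∀ n → length (allFin n) ≡ n
length-allFin n = List.length-tabulate (λ i → i)

merge : (Fin n → Fin n) → Fin n → Fin n → Fin n → Fin n
merge f i j k with f k ≟ f i
... | yes _ = f j
... | no _ = f k

module _ (f : Fin n → Fin n) (i j : Fin n) where
  merge-yes : ∀ {k} → f k ≡ f i → merge f i j k ≡ f j
  merge-yes {k} eq with f k ≟ f i
  ... | yes _ = refl
  ... | no neq = contradiction eq neq

  merge-no : ∀ {k} → f k ≢ f i → merge f i j k ≡ f k
  merge-no {k} neq with f k ≟ f i
  ... | yes eq = contradiction eq neq
  ... | no _ = refl

  merge-cong : ∀ {k l} → f k ≡ f l → merge f i j k ≡ merge f i j l
  merge-cong {k} {l} eq with f k ≟ f i | f l ≟ f i
  ... | yes _ | yes _ = refl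
  ... | yes p | no ¬q = contradiction (trans (sym eq) p) ¬q
  ... | no ¬p | yes q = contradiction (trans eq q) ¬p
  ... | no _ | no _ = eq

  merge-joins : merge f i j i ≡ merge f i j j
  merge-joins with f j ≟ f i
  ... | yes _ = merge-yes refl
  ... | no _ = merge-yes refl

  merge-idempotent : Idempotent f → Idempotent (merge f i j)
  merge-idempotent idem k with f k ≟ f i
  ... | no neq = trans (merge-no (neq ∘ trans (sym (idem k)))) (idem k)
  ... | yes _ with f (f j) ≟ f i
  ... | yes _ = refl
  ... | no _ = idem j

  merge-respects : ∀ {u t} → t ≈ transpose i j → Respects f u → Respects (merge f i j) (u · t)
  merge-respects {u} {t} t≈ resp k = trans (merge-cong (resp (t ⟨$⟩ʳ k))) swap
    where
    swap : merge f i j (t ⟨$⟩ʳ k) ≡ merge f i j k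
    swap with i ≟ k | j ≟ k
    ... | yes refl | _ rewrite trans (t≈ i) (transposeˡ i j) = sym merge-joins
    ... | no _ | yes refl rewrite trans (t≈ j) (transposeʳ i j) = merge-joins
    ... | no i≢k | no j≢k rewrite trans (t≈ k) (transpose-≢ {i = i} {j} (i≢k ∘ sym) (j≢k ∘ sym)) = refl

  -- Only `f i` can cease to be a representative.
  fixedPoints-merge : length (fixedPoints f) ≤ suc (length (fixedPoints (merge f i j)))
  fixedPoints-merge = unique-⊆⇒length≤ {ys = f i ∷ fixedPoints (merge f i j)} (fixedPoints-unique f) sub
    where
    sub : ∀ {k} → k ∈ₗ fixedPoints f → k ∈ₗ f i ∷ fixedPoints (merge f i j)
    sub {k} k∈ with f k ≟ f i
    ... | yes eq = here (trans (sym (∈fixedPoints⁻ k∈)) eq)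
    ... | no neq = there (∈fixedPoints⁺ (trans (merge-no neq) (∈fixedPoints⁻ k∈)))

-- From `i` the product jumps to `u j` and then follows the cycle of `u` through `j`. That cycle
-- stays in the class of `j`, so it never meets `i`, and it can only be left at `j` itself.
joined-orbit : {f : Fin n → Fin n} {u : Permutation′ n} {i j : Fin n} →
               Respects f u → f i ≢ f j → j ∈ orbit (u · transpose i j) i
joined-orbit {f = f} {u} {i} {j} resp fi≢fj = decidable-stable (j ∈? orbit v i) λ j∉ →
  j∉ (subst (_∈ orbit v i) (proj₂ (proj₂ (period u j)))
       (proj₁ (go j∉ (proj₁ (period u j)))))
  where
  v = u · transpose i j
  S : Fin _ → Set
  S k = k ∈ orbit v i × f k ≡ f j
  go : j ∉ orbit v i → ∀ m → S (iterate (u ⟨$⟩ʳ_) j (suc m))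
  go j∉ zero = subst (_∈ orbit v i) (cong (u ⟨$⟩ʳ_) (transposeˡ i j)) (orbit-image v) , resp j
  go j∉ (suc m) with k∈ , fk ← go j∉ m =
    subst S (sym (iterate-suc (u ⟨$⟩ʳ_) j (suc m)))
      ( subst (_∈ orbit v i)
          (cong (u ⟨$⟩ʳ_) (transpose-≢ (λ eq → fi≢fj (trans (cong f (sym eq)) fk))
                                        (λ eq → j∉ (subst (_∈ orbit v i) eq k∈))))
          (orbit-step v k∈)
      , trans (resp _) fk)

-- Each factor costs at most one class. The permutation `u` collects the factors already read, so
-- that the final `g` is constant on the cycles of the whole product.
classes : {f : Fin n → Fin n} {u : Permutation′ n} (ts : List (Permutation′ n)) →
          All IsTransposition ts → Idempotent f → Respects f u →
          ∃[ g ] Idempotent g × Respects g (u · ∏ ts)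
                 × length (fixedPoints f) ≤ length ts + length (fixedPoints g)
classes [] [] idem resp = -, idem , resp , ℕ.≤-refl
classes {f = f} {u} (t ∷ ts) ((i , j , _ , t≈) ∷ ps) idem resp
  with g , idem′ , resp′ , le ← classes {u = u · t} ts ps (merge-idempotent f i j idem) (merge-respects f i j {u} {t} t≈ resp) =
  g , idem′ , resp′ , ℕ.≤-trans (fixedPoints-merge f i j) (s≤s le)

-- Factorisations of a long cycle and the absolute order

module AbsoluteOrder
  (key : Fin (suc n) → ℕ) (key-injective : ∀ {i j} → key i ≡ key j → i ≡ j) where
  open CyclicOrder key key-injective
  open NoncrossingPermutations key key-injective

  module _ {c : Permutation′ (suc n)} (succ : IsSuccessor c)
    (transitive : ∀ i → i ∈ orbit c Fin.zero) (first : ∀ i → ¬ (i ≺ Fin.zero))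
    (factors : ∃[ ts ] All IsTransposition ts × ∏ ts ≈ c × length ts ≡ n) where

    private
      -- The orbit of `c` is everything, so a single class survives the whole factorisation.
      factors-classes : ∀ {f u} ts → All IsTransposition ts → Idempotent f → Respects f u →
                        u · ∏ ts ≈ c → length (fixedPoints f) ≤ length ts + 1
      factors-classes {f} {u} ts ps idem resp eq
        with g , _ , resp′ , le ← classes {u = u} ts ps idem resp =
        ℕ.≤-trans le (ℕ.+-monoʳ-≤ (length ts)
          (unique-⊆⇒length≤ {ys = g Fin.zero ∷ []} (fixedPoints-unique g)
            λ i∈ → here (trans (sym (∈fixedPoints⁻ {f = g} i∈)) (constant (transitive _)))))
        where
        constant : ∀ {i} → i ∈ orbit c Fin.zero → g i ≡ g Fin.zero
        constant = orbit-induction c (λ i → g i ≡ g Fin.zero)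
          (λ {j} gj → trans (trans (cong g (sym (eq j))) (resp′ j)) gj) refl

      -- The hypothesis on the length makes the count of `factors-classes` tight: every remaining
      -- factor has to join two classes. Starting from `c`, the factors are then undone one by one,
      -- each time cutting a cycle.
      factors-Gap : ∀ {f u} ts → All IsTransposition ts → Idempotent f → Respects f u →
                    u · ∏ ts ≈ c → length ts + 1 ≤ length (fixedPoints f) → Gap u
      factors-Gap {u = u} [] [] idem resp eq le = Gap-resp-≈ {y = u} (λ i → sym (eq i)) (Gap-successor {c} succ)
      factors-Gap {f} {u} (t ∷ ts) ((i , j , i≢j , t≈) ∷ ps) idem resp eq le with f i ≟ f j
      -- A factor within one class leaves the classes as they are, and the factors after it are too
      -- few to merge them all.
      ... | yes fi≡fj = contradiction
        (ℕ.≤-trans le (factors-classes {u = u · t} ts ps idem resp′ eq)) (ℕ.n≮n _)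
        where
        resp′ : Respects f (u · t)
        resp′ k with i ≟ k | j ≟ k
        ... | yes refl | _ = trans (resp _) (trans (cong f (trans (t≈ i) (transposeˡ i j))) (sym fi≡fj))
        ... | no _ | yes refl = trans (resp _) (trans (cong f (trans (t≈ j) (transposeʳ i j))) fi≡fj)
        ... | no i≢k | no j≢k = trans (resp _) (cong f (trans (t≈ k) (transpose-≢ (i≢k ∘ sym) (j≢k ∘ sym))))
      ... | no fi≢fj = Gap-resp-≈ (λ k → cong (u ⟨$⟩ʳ_) (transpose-involutive i j k))
          (Gap-splitʳ gap-ut i≢j (joined-orbit {f = f} {u = u} resp fi≢fj))
        where
        gap-ut : Gap (u · transpose i j)
        gap-ut = Gap-resp-≈ (λ k → cong (u ⟨$⟩ʳ_) (t≈ k))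
          (factors-Gap {u = u · t} ts ps (merge-idempotent f i j idem) (merge-respects f i j {u} {t} t≈ resp) eq
            (ℕ.≤-pred (ℕ.≤-trans le (fixedPoints-merge f i j))))

      all-classes : suc n ≤ length (fixedPoints {suc n} (λ i → i))
      all-classes = ℕ.≤-trans (ℕ.≤-reflexive (sym (length-allFin (suc n))))
        (unique-⊆⇒length≤ {ys = fixedPoints {suc n} (λ i → i)} (allFin⁺ (suc n))
          (λ _ → ∈fixedPoints⁺ {f = λ i → i} refl))

      factors-length : ∀ ts → All IsTransposition ts → ∏ ts ≈ c → n ≤ length ts
      factors-length ts ps eq = ℕ.≤-pred (ℕ.≤-trans all-classes (ℕ.≤-trans
        (factors-classes {f = λ i → i} {u = Perm.id} ts ps (λ _ → refl) (λ _ → refl) eq)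
        (ℕ.≤-reflexive (ℕ.+-comm (length ts) 1))))

    -- The `a` factors of `x` leave at least `n + 1 - a` of the initial `n + 1` singleton classes,
    -- hence at least `b + 1`, and the `b` factors of the complement must use up all of the surplus.
    NC⇒Gap : ∀ {x} → InNC c x → Gap x
    NC⇒Gap {x} (a , b , ((as , as-trans , as≈ , refl) , _) , ((bs , bs-trans , bs≈ , refl) , _) , (_ , minimal))
      with f , idem , resp , le ← classes {f = λ i → i} {u = Perm.id} as as-trans (λ _ → refl) (λ _ → refl) =
      factors-Gap bs bs-trans idem (λ i → trans (cong f (sym (as≈ i))) (resp i))
        (λ i → trans (cong (x ⟨$⟩ʳ_) (bs≈ i)) (inverseʳ x)) bound
      where
      a+b≤n : length as + length bs ≤ n
      a+b≤n = let ts , ts-trans , ts≈ , len = factors in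
        subst (length as + length bs ≤_) len (minimal ts ts-trans ts≈)
      bound : length bs + 1 ≤ length (fixedPoints f)
      bound = ℕ.+-cancelˡ-≤ (length as) _ _ (ℕ.≤-trans
        (ℕ.≤-reflexive (trans (sym (ℕ.+-assoc (length as) (length bs) 1)) (ℕ.+-comm _ 1)))
        (ℕ.≤-trans (s≤s a+b≤n) (ℕ.≤-trans all-classes le)))

    private
      ascent? : (w : Permutation′ (suc n)) → Decidable (λ i → i ≺ w ⟨$⟩ʳ i)
      ascent? w i = key i ℕ.<? key (w ⟨$⟩ʳ i)

    ascents : Permutation′ (suc n) → List (Fin (suc n))
    ascents w = filter (ascent? w) (allFin (suc n))

    private
      ∈ascents⁺ : ∀ w {i} → i ≺ w ⟨$⟩ʳ i → i ∈ₗ ascents w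
      ∈ascents⁺ w = ∈-filter⁺ (ascent? w) (∈-allFin _)

      ∈ascents⁻ : ∀ w {i} → i ∈ₗ ascents w → i ≺ w ⟨$⟩ʳ i
      ∈ascents⁻ w i∈ = proj₂ (∈-filter⁻ (ascent? w) {xs = allFin (suc n)} i∈)

      ascents-unique : ∀ w → Unique (ascents w)
      ascents-unique w = Unique.filter⁺ (ascent? w) (allFin⁺ _)

      -- The first moved point `i` is an ascent, and splitting it off its cycle creates no new
      -- ascent. The number `m` only bounds the recursion.
      factorise : ∀ m {w} → Gap w → length (ascents w) ≤ m →
                  ∃[ ts ] All IsTransposition ts × ∏ ts ≈ w × length ts ≤ length (ascents w)
      factorise m {w} gw le with any? (λ i → ¬? (w ⟨$⟩ʳ i ≟ i))
      ... | no fixed = [] , [] , (λ i → sym (decidable-stable (w ⟨$⟩ʳ i ≟ i) λ neq → fixed (i , neq))) , z≤n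
      ... | yes (_ , moved)
        with i , wi≢i , least ← maximum {_⋖_ = λ a b → b ≺ a} {S = λ i → w ⟨$⟩ʳ i ≢ i}
               (λ a b → key b ℕ.<? key a) (λ p q → ≺-trans q p) (λ { refl → ℕ.<-irrefl refl })
               (λ i → ¬? (w ⟨$⟩ʳ i ≟ i)) moved = step m le
        where
        j = w ⟨$⟩ʳ i
        t = transpose i j
        k = w ⟨$⟩ˡ i
        k≢i : k ≢ i
        k≢i eq = wi≢i (trans (cong (w ⟨$⟩ʳ_) (sym eq)) (inverseʳ w))
        ≺-of-moved : ∀ {l} → l ≢ i → w ⟨$⟩ʳ l ≢ l → i ≺ l
        ≺-of-moved l≢i wl≢l with ≺-cmp l≢i
        ... | inj₁ lt = contradiction lt (least wl≢l)
        ... | inj₂ lt = lt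
        i≺j : i ≺ j
        i≺j = ≺-of-moved wi≢i (λ eq → wi≢i (perm-injective w eq))
        i≺k : i ≺ k
        i≺k = ≺-of-moved k≢i (λ eq → k≢i (trans (sym eq) (inverseʳ w)))
        k∈ : k ∈ orbit w i
        k∈ = orbit-sym w (subst (_∈ orbit w k) (inverseʳ w) (orbit-image w))
        sub : ∀ {l} → l ∈ₗ i ∷ ascents (t · w) → l ∈ₗ ascents w
        sub (here refl) = ∈ascents⁺ w i≺j
        sub {l} (there l∈) with l≺ ← ∈ascents⁻ (t · w) l∈ | l ≟ i | l ≟ k
        ... | yes refl | _ = contradiction (transposeʳ i j) (≺⇒≢ l≺ ∘ sym)
        -- The preimage `k` of `i` now goes to `j`. As an ascent it would lie in the open arc from
        -- `i` to `j`, which its own cycle avoids.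
        ... | no _ | yes refl = contradiction (inj₁ (i≺k , k≺j)) (orbit-∉gap gw k∈)
          where k≺j = subst (k ≺_) (trans (cong (t ⟨$⟩ʳ_) (inverseʳ w)) (transposeˡ i j)) l≺
        ... | no l≢i | no l≢k = ∈ascents⁺ w (subst (l ≺_) (transpose-≢
                (λ eq → l≢k (trans (sym (inverseˡ w)) (cong (w ⟨$⟩ˡ_) eq))) (λ eq → l≢i (perm-injective w eq))) l≺)
        fewer : suc (length (ascents (t · w))) ≤ length (ascents w)
        fewer = unique-⊆⇒length≤
          (All.¬Any⇒All¬ (ascents (t · w)) (λ i∈ → ≺⇒≢ (∈ascents⁻ (t · w) i∈) (sym (transposeʳ i j)))
            ∷ ascents-unique (t · w)) sub
        step : ∀ m → length (ascents w) ≤ m →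
               ∃[ ts ] All IsTransposition ts × ∏ ts ≈ w × length ts ≤ length (ascents w)
        step zero le = contradiction (ℕ.≤-trans fewer le) λ ()
        step (suc m) le
          with ts , ps , eq , len ← factorise m (Gap-splitˡ gw wi≢i) (ℕ.≤-pred (ℕ.≤-trans fewer le)) =
          t ∷ ts , transpose-isTransposition (wi≢i ∘ sym) ∷ ps ,
          (λ l → trans (cong (t ⟨$⟩ʳ_) (eq l)) (transpose-involutive i j _)) ,
          ℕ.≤-trans (s≤s len) fewer

      -- An ascent i of w⁻¹c gives the non-ascent w⁻¹ (c i) of w, and so does the
      -- point that c maps to the first one.
      ascents-complement : ∀ w → length (ascents w) + length (ascents (flip w · c)) ≤ n
      ascents-complement w = ℕ.≤-pred (subst₂ _≤_ len (length-allFin (suc n))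
        (unique-⊆⇒length≤ (Unique.++⁺ (Unique.map⁺ (perm-injective v) unique-z∷) (ascents-unique w) disjoint)
          (λ {i} _ → ∈-allFin i)))
        where
        v = flip w · c
        z = c ⟨$⟩ˡ Fin.zero
        cz : c ⟨$⟩ʳ z ≡ Fin.zero
        cz = inverseʳ c
        z-last : ∀ {i} → ¬ (z ≺ i)
        z-last {i} z≺i = proj₂ (succ z) i (inj₂ (inj₂ (cz≺z , z≺i)))
          where
          cz≺z : c ⟨$⟩ʳ z ≺ z
          cz≺z with ≺-cmp (proj₁ (succ z))
          ... | inj₁ lt = lt
          ... | inj₂ gt = contradiction (subst (z ≺_) cz gt) (first z)
        wv : ∀ i → w ⟨$⟩ʳ (v ⟨$⟩ʳ i) ≡ c ⟨$⟩ʳ i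
        wv i = inverseʳ w
        unique-z∷ : Unique (z ∷ ascents v)
        unique-z∷ = All.¬Any⇒All¬ (ascents v) (λ z∈ → z-last (∈ascents⁻ v z∈)) ∷ ascents-unique v
        disjoint : ∀ {k} → ¬ (k ∈ₗ List.map (v ⟨$⟩ʳ_) (z ∷ ascents v) × k ∈ₗ ascents w)
        disjoint (k∈ , k∈w) with ∈-map⁻ (v ⟨$⟩ʳ_) k∈
        ... | i , here refl , refl =
          first _ (subst (v ⟨$⟩ʳ z ≺_) (trans (wv z) cz) (∈ascents⁻ w k∈w))
        ... | i , there i∈ , refl =
          proj₂ (succ i) _ (inj₁ (∈ascents⁻ v i∈ , subst (v ⟨$⟩ʳ i ≺_) (wv i) (∈ascents⁻ w k∈w)))
        len : length (List.map (v ⟨$⟩ʳ_) (z ∷ ascents v) ++ ascents w) ≡ suc (length (ascents w) + length (ascents v))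
        len = trans (List.length-++ (List.map (v ⟨$⟩ʳ_) (z ∷ ascents v)))
          (trans (cong (_+ length (ascents w)) (List.length-map (v ⟨$⟩ʳ_) (z ∷ ascents v)))
            (cong suc (ℕ.+-comm (length (ascents v)) _)))

    -- The two factorisations have at most `n` factors in total, and `c` needs at least `n`.
    -- Replacing either one by a shorter one would thus factor `c` too cheaply, which proves all
    -- three lengths minimal.
    Gap⇒NC : ∀ {x} → Gap x → InNC c x
    Gap⇒NC {x} gx
      with as , as-trans , as≈ , as-len ← factorise _ {x} gx ℕ.≤-refl
         | bs , bs-trans , bs≈ , bs-len ← factorise _ {flip x · c} (Gap-complement {c} succ {x} gx) ℕ.≤-refl =
      length as , length bs ,
      ((as , as-trans , as≈ , refl) , λ ts ps eq → ℕ.+-cancelʳ-≤ (length bs) _ _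
        (ℕ.≤-trans a+b≤n (minimal ts bs ps bs-trans (product ts bs eq bs≈)))) ,
      ((bs , bs-trans , bs≈ , refl) , λ ts ps eq → ℕ.+-cancelˡ-≤ (length as) _ _
        (ℕ.≤-trans a+b≤n (minimal as ts as-trans ps (product as ts as≈ eq)))) ,
      ((as ++ bs , All.++⁺ as-trans bs-trans , product as bs as≈ bs≈ , List.length-++ as) ,
        λ ts ps eq → ℕ.≤-trans a+b≤n (factors-length ts ps eq))
      where
      a+b≤n : length as + length bs ≤ n
      a+b≤n = ℕ.≤-trans (ℕ.+-mono-≤ as-len bs-len) (ascents-complement x)
      minimal : ∀ us vs → All IsTransposition us → All IsTransposition vs → ∏ (us ++ vs) ≈ c →
                n ≤ length us + length vs
      minimal us vs ps qs eq = subst (n ≤_) (List.length-++ us) (factors-length (us ++ vs) (All.++⁺ ps qs) eq)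
      product : ∀ us vs → ∏ us ≈ x → ∏ vs ≈ flip x · c → ∏ (us ++ vs) ≈ c
      product us vs eq eq′ i = trans (∏-++ us vs i)
        (trans (eq (∏ vs ⟨$⟩ʳ i)) (trans (cong (x ⟨$⟩ʳ_) (eq′ i)) (inverseʳ x)))

-- Standard Coxeter elements

module _ {key : Fin (suc n) → ℕ} {key-injective : ∀ {i j} → key i ≡ key j → i ≡ j} where
  open CyclicOrder key key-injective

  -- The restriction to labels up to `m` allows `c` to be built by inserting one label after the
  -- other in increasing order.
  record IsSuccessorUpTo (m : ℕ) (u : Permutation′ (suc n)) : Set where
    field
      bounded : ∀ {i} → toℕ i ≤ m → toℕ (u ⟨$⟩ʳ i) ≤ m
      moved : ∀ {i} → toℕ i ≤ m → u ⟨$⟩ʳ i ≢ i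
      gapfree : ∀ {i j} → toℕ i ≤ m → toℕ j ≤ m → ¬ C i j (u ⟨$⟩ʳ i)
      fixed : ∀ {i} → m < toℕ i → u ⟨$⟩ʳ i ≡ i

  module _ {m : ℕ} {u u′ : Permutation′ (suc n)} {p q : Fin (suc n)}
    (U : IsSuccessorUpTo m u) (toℕp : toℕ p ≡ m) (toℕq : toℕ q ≡ suc m) where
    open IsSuccessorUpTo U

    private
      data View : Fin (suc n) → Set where
        is-p : View p
        is-q : View q
        less : ∀ {i} → toℕ i < m → View i

      view : ∀ {i} → toℕ i ≤ suc m → View i
      view {i} i≤ with i ≟ p | i ≟ q
      ... | yes refl | _ = is-p
      ... | no _ | yes refl = is-q
      ... | no i≢p | no i≢q = less (ℕ.≤∧≢⇒< (ℕ.≤-pred (ℕ.≤∧≢⇒< i≤ (λ eq → i≢q (Fin.toℕ-injective (trans eq (sym toℕq))))))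
                                 (λ eq → i≢p (Fin.toℕ-injective (trans eq (sym toℕp)))))

      p≤m : toℕ p ≤ m
      p≤m = ℕ.≤-reflexive toℕp

      m<q : m < toℕ q
      m<q = ℕ.≤-reflexive (sym toℕq)

      ≤m⇒≢q : ∀ {i} → toℕ i ≤ m → i ≢ q
      ≤m⇒≢q i≤m refl = ℕ.<⇒≱ m<q i≤m

      <m⇒≢p : ∀ {i} → toℕ i < m → i ≢ p
      <m⇒≢p i<m refl = ℕ.<-irrefl toℕp i<m

      ≤m⇒<m : ∀ {i} → toℕ i ≤ m → i ≢ p → toℕ i < m
      ≤m⇒<m i≤m i≢p = ℕ.≤∧≢⇒< i≤m (λ eq → i≢p (Fin.toℕ-injective (trans eq (sym toℕp))))

      up<m : toℕ (u ⟨$⟩ʳ p) < m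
      up<m = ≤m⇒<m (bounded p≤m) (moved p≤m)

      suc-bounded : ∀ {i : Fin (suc n)} → toℕ i ≤ m → toℕ i ≤ suc m
      suc-bounded = ℕ.m≤n⇒m≤1+n

      above : ∀ {i} → suc m < toℕ i → i ≢ p × i ≢ q
      above lt = (λ { refl → ℕ.<⇒≱ lt (ℕ.≤-trans p≤m (ℕ.n≤1+n m)) }) , (λ { refl → ℕ.<-irrefl (sym toℕq) lt })

    -- The product sends `p` to `q` and `q` to the old successor of `p`; by `side`, `q` is the first
    -- label after `p` among those present.
    insert-after : (∀ {a} → toℕ a < m → C p q a) → u′ ≈ u · transpose p q → IsSuccessorUpTo (suc m) u′
    insert-after side u′≈ = record { bounded = bounded′ ; moved = moved′ ; gapfree = gapfree′ ; fixed = fixed′ }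
      where
      at-p : u′ ⟨$⟩ʳ p ≡ q
      at-p = trans (u′≈ p) (trans (cong (u ⟨$⟩ʳ_) (transposeˡ p q)) (fixed m<q))
      at-q : u′ ⟨$⟩ʳ q ≡ u ⟨$⟩ʳ p
      at-q = trans (u′≈ q) (cong (u ⟨$⟩ʳ_) (transposeʳ p q))
      at-≢ : ∀ {i} → i ≢ p → i ≢ q → u′ ⟨$⟩ʳ i ≡ u ⟨$⟩ʳ i
      at-≢ i≢p i≢q = trans (u′≈ _) (cong (u ⟨$⟩ʳ_) (transpose-≢ i≢p i≢q))
      at-less : ∀ {i} → toℕ i < m → u′ ⟨$⟩ʳ i ≡ u ⟨$⟩ʳ i
      at-less i<m = at-≢ (<m⇒≢p i<m) (≤m⇒≢q (ℕ.<⇒≤ i<m))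
      bounded′ : ∀ {i} → toℕ i ≤ suc m → toℕ (u′ ⟨$⟩ʳ i) ≤ suc m
      bounded′ i≤ with view i≤
      ... | is-p rewrite at-p = ℕ.≤-reflexive toℕq
      ... | is-q rewrite at-q = suc-bounded (bounded p≤m)
      ... | less i<m rewrite at-less i<m = suc-bounded (bounded (ℕ.<⇒≤ i<m))
      moved′ : ∀ {i} → toℕ i ≤ suc m → u′ ⟨$⟩ʳ i ≢ i
      moved′ i≤ with view i≤
      ... | is-p rewrite at-p = ≤m⇒≢q p≤m ∘ sym
      ... | is-q rewrite at-q = ≤m⇒≢q (bounded p≤m)
      ... | less i<m rewrite at-less i<m = moved (ℕ.<⇒≤ i<m)
      gapfree′ : ∀ {i j} → toℕ i ≤ suc m → toℕ j ≤ suc m → ¬ C i j (u′ ⟨$⟩ʳ i)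
      gapfree′ i≤ j≤ cy with view i≤
      gapfree′ i≤ j≤ cy | is-p rewrite at-p with view j≤
      ... | is-p = C⇒≢₁₂ cy refl
      ... | is-q = C⇒≢₂₃ cy refl
      ... | less j<m = C-asym cy (side j<m)
      gapfree′ i≤ j≤ cy | is-q rewrite at-q with view j≤
      ... | is-p = C-asym (C-rot cy) (side up<m)
      ... | is-q = C⇒≢₁₂ cy refl
      ... | less j<m = gapfree p≤m (ℕ.<⇒≤ j<m) (C-rot (C-trans (C-rot² (side up<m)) (C-rot² cy)))
      gapfree′ i≤ j≤ cy | less i<m rewrite at-less i<m with view j≤
      ... | is-p = gapfree (ℕ.<⇒≤ i<m) p≤m cy
      ... | is-q = gapfree (ℕ.<⇒≤ i<m) p≤m (C-trans (C-rot² (side i<m)) cy)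
      ... | less j<m = gapfree (ℕ.<⇒≤ i<m) (ℕ.<⇒≤ j<m) cy
      fixed′ : ∀ {i} → suc m < toℕ i → u′ ⟨$⟩ʳ i ≡ i
      fixed′ lt = let i≢p , i≢q = above lt in trans (at-≢ i≢p i≢q) (fixed (ℕ.<-trans (ℕ.n<1+n m) lt))

    -- The product sends the predecessor of `p` to `q` and `q` to `p`; by `side`, `q` is the last
    -- label before `p` among those present.
    insert-before : (∀ {a} → toℕ a < m → C p a q) → u′ ≈ transpose p q · u → IsSuccessorUpTo (suc m) u′
    insert-before side u′≈ = record { bounded = bounded′ ; moved = moved′ ; gapfree = gapfree′ ; fixed = fixed′ }
      where
      at-q : u′ ⟨$⟩ʳ q ≡ p
      at-q = trans (u′≈ q) (trans (cong (transpose p q ⟨$⟩ʳ_) (fixed m<q)) (transposeʳ p q))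
      at-pre : ∀ {i} → u ⟨$⟩ʳ i ≡ p → u′ ⟨$⟩ʳ i ≡ q
      at-pre eq = trans (u′≈ _) (trans (cong (transpose p q ⟨$⟩ʳ_) eq) (transposeˡ p q))
      at-≢ : ∀ {i} → u ⟨$⟩ʳ i ≢ p → u ⟨$⟩ʳ i ≢ q → u′ ⟨$⟩ʳ i ≡ u ⟨$⟩ʳ i
      at-≢ ≢p ≢q = trans (u′≈ _) (transpose-≢ ≢p ≢q)

      data View′ : Fin (suc n) → Set where
        is-q : View′ q
        pre : ∀ {i} → toℕ i < m → u ⟨$⟩ʳ i ≡ p → u′ ⟨$⟩ʳ i ≡ q → View′ i
        else : ∀ {i} → toℕ i ≤ m → toℕ (u ⟨$⟩ʳ i) < m → u′ ⟨$⟩ʳ i ≡ u ⟨$⟩ʳ i → View′ i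

      view′ : ∀ {i} → toℕ i ≤ suc m → View′ i
      view′ {i} i≤ with i ≟ q
      ... | yes refl = is-q
      ... | no i≢q with i≤m ← ℕ.≤-pred (ℕ.≤∧≢⇒< i≤ (λ eq → i≢q (Fin.toℕ-injective (trans eq (sym toℕq)))))
                   with u ⟨$⟩ʳ i ≟ p
      ... | yes eq = pre (≤m⇒<m i≤m λ { refl → moved i≤m eq }) eq (at-pre eq)
      ... | no neq = else i≤m (≤m⇒<m (bounded i≤m) neq) (at-≢ neq (≤m⇒≢q (bounded i≤m)))

      bounded′ : ∀ {i} → toℕ i ≤ suc m → toℕ (u′ ⟨$⟩ʳ i) ≤ suc m
      bounded′ i≤ with view′ i≤
      ... | is-q rewrite at-q = suc-bounded p≤m
      ... | pre _ _ eq rewrite eq = ℕ.≤-reflexive toℕq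
      ... | else i≤m _ eq rewrite eq = suc-bounded (bounded i≤m)
      moved′ : ∀ {i} → toℕ i ≤ suc m → u′ ⟨$⟩ʳ i ≢ i
      moved′ i≤ with view′ i≤
      ... | is-q rewrite at-q = ≤m⇒≢q p≤m
      ... | pre i<m _ eq rewrite eq = ≤m⇒≢q (ℕ.<⇒≤ i<m) ∘ sym
      ... | else i≤m _ eq rewrite eq = moved i≤m
      gapfree′ : ∀ {i j} → toℕ i ≤ suc m → toℕ j ≤ suc m → ¬ C i j (u′ ⟨$⟩ʳ i)
      gapfree′ i≤ j≤ cy with view′ i≤
      gapfree′ i≤ j≤ cy | is-q rewrite at-q with view j≤
      ... | is-p = C⇒≢₂₃ cy refl
      ... | is-q = C⇒≢₁₂ cy refl
      ... | less j<m = C-asym (side j<m) (C-rot² cy)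
      gapfree′ {i} i≤ j≤ cy | pre i<m ui≡p eq rewrite eq = go (view j≤)
        where
        contra : ∀ {j} → toℕ j ≤ m → ¬ C i j q
        contra j≤m cy = gapfree (ℕ.<⇒≤ i<m) j≤m (subst (C i _) (sym ui≡p) (C-trans cy (C-rot (side i<m))))
        go : View _ → ⊥
        go is-p = contra p≤m cy
        go is-q = C⇒≢₂₃ cy refl
        go (less j<m) = contra (ℕ.<⇒≤ j<m) cy
      gapfree′ {i} i≤ j≤ cy | else i≤m ui<m eq rewrite eq with view j≤
      ... | is-p = gapfree i≤m p≤m cy
      ... | less j<m = gapfree i≤m (ℕ.<⇒≤ j<m) cy
      ... | is-q with i ≟ p
      ... | yes refl = C-asym cy (side ui<m)
      ... | no i≢p with C-total (i≢p) (<m⇒≢p ui<m ∘ sym) (C⇒≢₁₃ cy)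
      ... | inj₁ ipd = gapfree i≤m p≤m ipd
      ... | inj₂ idp = C-asym (side ui<m) (C-rot² (C-drop cy idp))
      fixed′ : ∀ {i} → suc m < toℕ i → u′ ⟨$⟩ʳ i ≡ i
      fixed′ lt with m<i ← ℕ.<-trans (ℕ.n<1+n m) lt =
        trans (at-≢ (λ eq → proj₁ (above lt) (trans (sym (fixed m<i)) eq))
                    (λ eq → proj₂ (above lt) (trans (sym (fixed m<i)) eq))) (fixed m<i)

-- Products of simple transpositions

toℕ-inject₁-<suc : (k : Fin n) → toℕ (inject₁ k) < toℕ (Fin.suc k)
toℕ-inject₁-<suc k = s≤s (ℕ.≤-reflexive (Fin.toℕ-inject₁ k))

s-≢ : {k : Fin n} {i : Fin (suc n)} → toℕ i ≢ toℕ k → toℕ i ≢ suc (toℕ k) → s k ⟨$⟩ʳ i ≡ i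
s-≢ {k = k} i≢k i≢sk = transpose-≢ (λ { refl → i≢k (Fin.toℕ-inject₁ k) }) (λ { refl → i≢sk refl })

s-comm-< : {k l : Fin n} → suc (toℕ k) < toℕ l → s k · s l ≈ s l · s k
s-comm-< {k = k} {l} k+1<l i with toℕ i ℕ.≤? suc (toℕ k)
... | yes i≤ = trans (cong (s k ⟨$⟩ʳ_) (low i≤)) (sym (low (small i≤)))
  where
  low : ∀ {i} → toℕ i ≤ suc (toℕ k) → s l ⟨$⟩ʳ i ≡ i
  low i≤ = s-≢ (ℕ.<⇒≢ (ℕ.≤-<-trans i≤ k+1<l)) (ℕ.<⇒≢ (ℕ.<-trans (ℕ.≤-<-trans i≤ k+1<l) (ℕ.n<1+n _)))
  small : ∀ {i} → toℕ i ≤ suc (toℕ k) → toℕ (s k ⟨$⟩ʳ i) ≤ suc (toℕ k)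
  small {i} i≤ with inject₁ k ≟ i | Fin.suc k ≟ i
  ... | yes refl | _ rewrite transposeˡ (inject₁ k) (Fin.suc k) = ℕ.≤-refl
  ... | no _ | yes refl rewrite transposeʳ (inject₁ k) (Fin.suc k) = ℕ.<⇒≤ (toℕ-inject₁-<suc k)
  ... | no ≢k | no ≢sk rewrite transpose-≢ {i = inject₁ k} {Fin.suc k} (≢k ∘ sym) (≢sk ∘ sym) = i≤
... | no i≰ = trans (high big) (cong (s l ⟨$⟩ʳ_) (sym (high (ℕ.≰⇒> i≰))))
  where
  high : ∀ {i} → suc (toℕ k) < toℕ i → s k ⟨$⟩ʳ i ≡ i
  high lt = s-≢ (ℕ.<⇒≢ (ℕ.<-trans (ℕ.n<1+n _) lt) ∘ sym) (ℕ.<⇒≢ lt ∘ sym)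
  big : suc (toℕ k) < toℕ (s l ⟨$⟩ʳ i)
  big with inject₁ l ≟ i | Fin.suc l ≟ i
  ... | yes refl | _ rewrite transposeˡ (inject₁ l) (Fin.suc l) = ℕ.<-trans k+1<l (ℕ.n<1+n _)
  ... | no _ | yes refl rewrite transposeʳ (inject₁ l) (Fin.suc l) | Fin.toℕ-inject₁ l = k+1<l
  ... | no ≢l | no ≢sl rewrite transpose-≢ {i = inject₁ l} {Fin.suc l} (≢l ∘ sym) (≢sl ∘ sym) = ℕ.≰⇒> i≰

-- The factors that move labels up to `m` only: the stages of the inductive construction of `c`.
subproduct : ℕ → List (Fin n) → Permutation′ (suc n)
subproduct m [] = Perm.id
subproduct m (k ∷ ks) with toℕ k ℕ.<? m
... | yes _ = s k · subproduct m ks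
... | no _ = subproduct m ks

module _ {m : ℕ} where
  subproduct-< : ∀ {k : Fin n} ks → toℕ k < m → subproduct m (k ∷ ks) ≡ s k · subproduct m ks
  subproduct-< {k = k} ks lt with toℕ k ℕ.<? m
  ... | yes _ = refl
  ... | no ≮ = contradiction lt ≮

  subproduct-≮ : ∀ {k : Fin n} ks → ¬ (toℕ k < m) → subproduct m (k ∷ ks) ≡ subproduct m ks
  subproduct-≮ {k = k} ks ≮ with toℕ k ℕ.<? m
  ... | yes lt = contradiction lt ≮
  ... | no _ = refl

subproduct-all : (ks : List (Fin n)) → subproduct n ks ≡ ∏ (List.map s ks)
subproduct-all [] = refl
subproduct-all (k ∷ ks) = trans (subproduct-< ks (Fin.toℕ<n k)) (cong (s k ·_) (subproduct-all ks))

subproduct-0 : (ks : List (Fin n)) → subproduct 0 ks ≡ Perm.id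
subproduct-0 [] = refl
subproduct-0 (k ∷ ks) = trans (subproduct-≮ {k = k} ks λ ()) (subproduct-0 ks)

module _ {k₀ : Fin n} where
  private
    m = toℕ k₀

  s-subproduct-comm : ∀ ks → All (λ k → suc (toℕ k) ≢ m) ks → s k₀ · subproduct m ks ≈ subproduct m ks · s k₀
  s-subproduct-comm [] _ i = refl
  s-subproduct-comm (k ∷ ks) (sk≢m ∷ ps) i with toℕ k ℕ.<? m
  ... | yes k<m = trans (sym (s-comm-< (ℕ.≤∧≢⇒< k<m sk≢m) (subproduct m ks ⟨$⟩ʳ i)))
                    (cong (s k ⟨$⟩ʳ_) (s-subproduct-comm ks ps i))
  ... | no _ = s-subproduct-comm ks ps i

  <suc⇒< : ∀ {k : Fin n} → k ≢ k₀ → toℕ k < suc m → toℕ k < m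
  <suc⇒< k≢ lt = ℕ.≤∧≢⇒< (ℕ.≤-pred lt) (λ eq → k≢ (Fin.toℕ-injective eq))

  subproduct-∉ : ∀ ks → k₀ ∉ₗ ks → subproduct (suc m) ks ≡ subproduct m ks
  subproduct-∉ [] _ = refl
  subproduct-∉ (k ∷ ks) k₀∉ with toℕ k ℕ.<? m
  ... | yes k<m = trans (subproduct-< ks (ℕ.<-trans k<m (ℕ.n<1+n m))) (cong (s k ·_) (subproduct-∉ ks (k₀∉ ∘ there)))
  ... | no k≮m = trans (subproduct-≮ ks (λ lt → k≮m (<suc⇒< {k} (λ { refl → k₀∉ (here refl) }) lt))) (subproduct-∉ ks (k₀∉ ∘ there))

  subproduct-k₀∷ : ∀ ks → k₀ ∉ₗ ks →
    subproduct (suc m) (k₀ ∷ ks) ≡ s k₀ · subproduct m ks × subproduct m (k₀ ∷ ks) ≡ subproduct m ks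
  subproduct-k₀∷ ks k₀∉ =
    trans (subproduct-< ks (ℕ.n<1+n m)) (cong (s k₀ ·_) (subproduct-∉ ks k₀∉)) , subproduct-≮ ks (ℕ.n≮n m)

  subproduct-snoc : ∀ ks → Unique ks → k₀ ∈ₗ ks → All (λ k → suc (toℕ k) ≢ m) ks →
                    subproduct (suc m) ks ≈ subproduct m ks · s k₀
  subproduct-snoc (_ ∷ ks) u (here refl) (_ ∷ ps) i
    rewrite proj₁ (subproduct-k₀∷ ks (Unique[x∷xs]⇒x∉xs u)) | proj₂ (subproduct-k₀∷ ks (Unique[x∷xs]⇒x∉xs u)) =
    s-subproduct-comm ks ps i
  subproduct-snoc (k ∷ ks) u@(k≢ ∷ u′) (there k₀∈) (_ ∷ ps) i with toℕ k ℕ.<? m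
  ... | yes k<m rewrite subproduct-< {k = k} ks (ℕ.<-trans k<m (ℕ.n<1+n m)) =
    cong (s k ⟨$⟩ʳ_) (subproduct-snoc ks u′ k₀∈ ps i)
  ... | no k≮m rewrite subproduct-≮ {k = k} ks (k≮m ∘ <suc⇒< (All.lookup k≢ k₀∈)) =
    subproduct-snoc ks u′ k₀∈ ps i

  -- s k₀ commutes with every s k for k < m except k = m - 1, so that it can be
  -- moved to one of the two ends.
  subproduct-step : ∀ ks → Unique ks → k₀ ∈ₗ ks →
    (subproduct (suc m) ks ≈ subproduct m ks · s k₀) ⊎ (subproduct (suc m) ks ≈ s k₀ · subproduct m ks)
  subproduct-step (_ ∷ ks) u (here refl)
    rewrite proj₁ (subproduct-k₀∷ ks (Unique[x∷xs]⇒x∉xs u)) | proj₂ (subproduct-k₀∷ ks (Unique[x∷xs]⇒x∉xs u)) =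
    inj₂ (λ _ → refl)
  subproduct-step (k ∷ ks) u@(k≢ ∷ u′) (there k₀∈) with suc (toℕ k) ℕ.≟ m
  ... | yes sk≡m
    rewrite subproduct-< {m = suc m} {k = k} ks (ℕ.≤-trans (ℕ.≤-reflexive sk≡m) (ℕ.n≤1+n m))
          | subproduct-< {m = m} {k = k} ks (ℕ.≤-reflexive sk≡m) =
    inj₁ λ i → cong (s k ⟨$⟩ʳ_) (subproduct-snoc ks u′ k₀∈
      (All.map (λ k≢l eq → k≢l (Fin.toℕ-injective (ℕ.suc-injective (trans sk≡m (sym eq))))) k≢) i)
  ... | no sk≢m with toℕ k ℕ.<? m
  ... | no k≮m rewrite subproduct-≮ {k = k} ks (k≮m ∘ <suc⇒< (All.lookup k≢ k₀∈)) = subproduct-step ks u′ k₀∈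
  ... | yes k<m rewrite subproduct-< {k = k} ks (ℕ.<-trans k<m (ℕ.n<1+n m)) with subproduct-step ks u′ k₀∈
  ... | inj₁ eq = inj₁ λ i → cong (s k ⟨$⟩ʳ_) (eq i)
  ... | inj₂ eq = inj₂ λ i → trans (cong (s k ⟨$⟩ʳ_) (eq i)) (s-comm-< (ℕ.≤∧≢⇒< k<m sk≢m) (subproduct m ks ⟨$⟩ʳ i))

-- A clockwise arrangement of the labels along which c moves every label to the
-- next one, with the members of L c on the left-hand side of the circle and
-- the other labels on the right-hand side, larger labels being higher up.
record Layout (c : Permutation′ (suc n)) : Set where
  field
    key : Fin (suc n) → ℕ
    key-injective : ∀ {i j} → key i ≡ key j → i ≡ j
  open CyclicOrder key key-injective public
  open NoncrossingPermutations key key-injective public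
  field
    successor : IsSuccessor c
    first : ∀ i → ¬ (i ≺ Fin.zero)
    left : ∀ {a k b} → k ∈ L c → toℕ a < toℕ k → toℕ k < toℕ b → C k a b
    right : ∀ {a k b} → k ∉ L c → toℕ a < toℕ k → toℕ k < toℕ b → C k b a
    transitive : ∀ i → i ∈ orbit c Fin.zero
    point-mono : ∀ {i j} → i Fin.< j → point c i ≺ point c j

  point-surjective : ∀ i → ∃[ j ] point c j ≡ i
  point-surjective i = ∈⟦⟧⁻ (λ j → any? (λ m → iterate (c ⟨$⟩ʳ_) Fin.zero (toℕ m) ≟ j)) (transitive i)

-- The layout of a standard Coxeter element

module CoxeterLayout (c : Permutation′ (suc (suc n))) (ks : List (Fin (suc n))) (u : Unique ks)
  (∈ks : ∀ k → k ∈ₗ ks) (c≈ : c ≈ ∏ (List.map s ks)) where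
  private
    top : ℕ
    top = suc n

    -- If `s k` moves to the right end of the product, label `k + 1` is inserted directly after
    -- label `k`, so that one climbs clockwise past `k`; at the left end it is inserted directly
    -- before, and one descends.
    isRight′ : Fin top → Bool
    isRight′ k with subproduct-step {k₀ = k} ks u (∈ks k)
    ... | inj₁ _ = true
    ... | inj₂ _ = false

    -- The lowest and the highest label belong to both sides; counted as right, they receive the
    -- keys `0` and `top`.
    isRight : Fin (suc top) → Bool
    isRight Fin.zero = true
    isRight i@(Fin.suc _) with toℕ i ℕ.<? top
    ... | yes i<n = isRight′ (fromℕ< i<n)
    ... | no _ = true

  abstract
    -- Clockwise from the lowest label one climbs the right-hand side, where the key is the label,
    -- and then descends the left-hand side, where the key `2 top - i` exceeds `top` for every `i`
    -- below `top`.
    key : Fin (suc top) → ℕ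
    key i = if isRight i then toℕ i else top + (top ∸ toℕ i)

    key-zero : key Fin.zero ≡ 0
    key-zero = refl

    key-right : ∀ {i} → isRight i ≡ true → key i ≡ toℕ i
    key-right {i} = cong (λ b → if b then toℕ i else top + (top ∸ toℕ i))

    key-left : ∀ {i} → isRight i ≡ false → key i ≡ top + (top ∸ toℕ i)
    key-left {i} = cong (λ b → if b then toℕ i else top + (top ∸ toℕ i))

  private
    data KeyView (i : Fin (suc top)) : Set where
      onRight : isRight i ≡ true → key i ≡ toℕ i → KeyView i
      onLeft : isRight i ≡ false → key i ≡ top + (top ∸ toℕ i) → KeyView i

    keyView : ∀ i → KeyView i
    keyView i with isRight i in eq
    ... | true = onRight eq (key-right eq)
    ... | false = onLeft eq (key-left eq)

    ≤top : ∀ (i : Fin (suc top)) → toℕ i ≤ top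
    ≤top = Fin.toℕ≤pred[n]

    left-right-injective : ∀ {i j} → key i ≡ top + (top ∸ toℕ i) → key j ≡ toℕ j → key i ≡ key j → i ≡ j
    left-right-injective {i} {j} ki kj eq = Fin.toℕ-injective (trans i≡top (sym j≡top))
      where
      sum : top + (top ∸ toℕ i) ≡ toℕ j
      sum = trans (sym ki) (trans eq kj)
      j≡top : toℕ j ≡ top
      j≡top = ℕ.≤-antisym (≤top j) (ℕ.≤-trans (ℕ.m≤m+n top _) (ℕ.≤-reflexive sum))
      i≡top : toℕ i ≡ top
      i≡top = ℕ.≤-antisym (≤top i) (ℕ.m∸n≡0⇒m≤n
        (ℕ.+-cancelˡ-≡ top _ _ (trans sum (trans j≡top (sym (ℕ.+-identityʳ top))))))

  key-injective : ∀ {i j} → key i ≡ key j → i ≡ j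
  key-injective {i} {j} eq with keyView i | keyView j
  ... | onRight _ ki | onRight _ kj = Fin.toℕ-injective (trans (sym ki) (trans eq kj))
  ... | onLeft _ ki | onRight _ kj = left-right-injective ki kj eq
  ... | onRight _ ki | onLeft _ kj = sym (left-right-injective kj ki (sym eq))
  ... | onLeft _ ki | onLeft _ kj = Fin.toℕ-injective (ℕ.∸-cancelˡ-≡ (≤top i) (≤top j)
    (ℕ.+-cancelˡ-≡ top _ _ (trans (sym ki) (trans eq kj))))

  open CyclicOrder key key-injective
  open NoncrossingPermutations key key-injective

  private
    toℕ≤key : ∀ i → toℕ i ≤ key i
    toℕ≤key i with keyView i
    ... | onRight _ ki = ℕ.≤-reflexive (sym ki)
    ... | onLeft _ ki = ℕ.≤-trans (≤top i) (ℕ.≤-trans (ℕ.m≤m+n top _) (ℕ.≤-reflexive (sym ki)))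

    below-left : ∀ {k b} → key k ≡ top + (top ∸ toℕ k) → toℕ k < toℕ b → b ≺ k
    below-left {k} {b} kk k<b rewrite kk with keyView b
    ... | onRight _ kb rewrite kb =
      ℕ.≤-<-trans (≤top b) (ℕ.m<m+n top (ℕ.m<n⇒0<n∸m (ℕ.<-≤-trans k<b (≤top b))))
    ... | onLeft _ kb rewrite kb = ℕ.+-monoʳ-< top (ℕ.∸-monoʳ-< k<b (≤top b))

    above-right : ∀ {k b} → key k ≡ toℕ k → toℕ k < toℕ b → k ≺ b
    above-right {k} {b} kk k<b rewrite kk = ℕ.<-≤-trans k<b (toℕ≤key b)

  isRight⇒C : ∀ {a k b} → isRight k ≡ true → toℕ a < toℕ k → toℕ k < toℕ b → C k b a
  isRight⇒C {a} {k} {b} r a<k k<b with keyView k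
  ... | onLeft l _ = contradiction (trans (sym l) r) λ ()
  ... | onRight _ kk with keyView a
  ... | onRight _ ka = inj₂ (inj₂ (above-right ka a<k , above-right kk k<b))
  ... | onLeft _ ka = inj₁ (above-right kk k<b , below-left ka (ℕ.<-trans a<k k<b))

  isLeft⇒C : ∀ {a k b} → isRight k ≡ false → toℕ a < toℕ k → toℕ k < toℕ b → C k a b
  isLeft⇒C {a} {k} {b} l a<k k<b with keyView k
  ... | onRight r _ = contradiction (trans (sym l) r) λ ()
  ... | onLeft _ kk with keyView a
  ... | onRight _ ka = inj₂ (inj₁ (above-right ka (ℕ.<-trans a<k k<b) , below-left kk k<b))
  ... | onLeft _ ka = inj₂ (inj₂ (below-left kk k<b , below-left ka a<k))

  private
    isRight-inject₁ : (k : Fin top) → 1 ≤ toℕ k → isRight (inject₁ k) ≡ isRight′ k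
    isRight-inject₁ k@(Fin.suc k′) _ with suc (toℕ (inject₁ k′)) ℕ.<? top
    ... | yes lt = cong isRight′ (Fin.toℕ-injective (trans (Fin.toℕ-fromℕ< lt) (Fin.toℕ-inject₁ k)))
    ... | no ≮ = contradiction (subst (_< top) (sym (Fin.toℕ-inject₁ k)) (Fin.toℕ<n k)) ≮

    UpTo : ℕ → Set
    UpTo m = IsSuccessorUpTo {key = key} {key-injective} m (subproduct m ks)

    -- The induction starts at `1`, because on the label `0` alone a successor map would have a
    -- fixed point.
    upTo-1 : UpTo 1
    upTo-1 = record { bounded = λ {i} → bounded {i} ; moved = λ {i} → moved {i}
                    ; gapfree = λ {i} {j} → gapfree {i} {j} ; fixed = λ {i} → fixed {i} }
      where
      v = subproduct 1 ks
      v≈ : v ≈ s Fin.zero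
      v≈ i with subproduct-step {k₀ = Fin.zero} ks u (∈ks Fin.zero)
      ... | inj₁ eq rewrite subproduct-0 ks = eq i
      ... | inj₂ eq rewrite subproduct-0 ks = eq i
      v0 : v ⟨$⟩ʳ Fin.zero ≡ Fin.suc Fin.zero
      v0 = v≈ _
      v1 : v ⟨$⟩ʳ Fin.suc Fin.zero ≡ Fin.zero
      v1 = v≈ _
      bounded : ∀ {i} → toℕ i ≤ 1 → toℕ (v ⟨$⟩ʳ i) ≤ 1
      bounded {Fin.zero} _ rewrite v0 = s≤s z≤n
      bounded {Fin.suc Fin.zero} _ rewrite v1 = z≤n
      bounded {Fin.suc (Fin.suc _)} (s≤s ())
      moved : ∀ {i} → toℕ i ≤ 1 → v ⟨$⟩ʳ i ≢ i
      moved {Fin.zero} _ rewrite v0 = λ ()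
      moved {Fin.suc Fin.zero} _ rewrite v1 = λ ()
      moved {Fin.suc (Fin.suc _)} (s≤s ())
      gapfree : ∀ {i j} → toℕ i ≤ 1 → toℕ j ≤ 1 → ¬ C i j (v ⟨$⟩ʳ i)
      gapfree {Fin.zero} {Fin.zero} _ _ cy = C⇒≢₁₂ cy refl
      gapfree {Fin.zero} {Fin.suc Fin.zero} _ _ cy = C⇒≢₂₃ cy (sym v0)
      gapfree {Fin.suc Fin.zero} {Fin.zero} _ _ cy = C⇒≢₂₃ cy (sym v1)
      gapfree {Fin.suc Fin.zero} {Fin.suc Fin.zero} _ _ cy = C⇒≢₁₂ cy refl
      gapfree {Fin.suc (Fin.suc _)} (s≤s ())
      gapfree {_} {Fin.suc (Fin.suc _)} _ (s≤s ())
      fixed : ∀ {i} → 1 < toℕ i → v ⟨$⟩ʳ i ≡ i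
      fixed {i} lt = trans (v≈ i) (s-≢ (ℕ.<⇒≢ (ℕ.<-trans (s≤s z≤n) lt) ∘ sym) (ℕ.<⇒≢ lt ∘ sym))

    upTo-suc : ∀ k → 1 ≤ toℕ k → UpTo (toℕ k) → UpTo (suc (toℕ k))
    upTo-suc k 1≤k U with subproduct-step {k₀ = k} ks u (∈ks k) in stepeq
    ... | inj₁ eq = insert-after U (Fin.toℕ-inject₁ k) refl
        (λ {a} a<k → isRight⇒C side (subst (toℕ a <_) (sym (Fin.toℕ-inject₁ k)) a<k) (toℕ-inject₁-<suc k)) eq
      where
      side : isRight (inject₁ k) ≡ true
      side rewrite isRight-inject₁ k 1≤k | stepeq = refl
    ... | inj₂ eq = insert-before U (Fin.toℕ-inject₁ k) refl
        (λ {a} a<k → isLeft⇒C side (subst (toℕ a <_) (sym (Fin.toℕ-inject₁ k)) a<k) (toℕ-inject₁-<suc k)) eq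
      where
      side : isRight (inject₁ k) ≡ false
      side rewrite isRight-inject₁ k 1≤k | stepeq = refl

    upTo : ∀ m → 1 ≤ m → m ≤ top → UpTo m
    upTo 1 _ _ = upTo-1
    upTo (suc m@(suc _)) _ m<top =
      subst (UpTo ∘ suc) (Fin.toℕ-fromℕ< m<top)
        (upTo-suc (fromℕ< m<top) (subst (1 ≤_) (sym (Fin.toℕ-fromℕ< m<top)) (s≤s z≤n))
          (subst UpTo (sym (Fin.toℕ-fromℕ< m<top))
            (upTo m (s≤s z≤n) (ℕ.<⇒≤ m<top))))

    successor : IsSuccessor c
    successor i with c ⟨$⟩ʳ i | trans (c≈ i) (cong (_⟨$⟩ʳ i) (sym (subproduct-all ks)))
    ... | _ | refl = moved (≤top i) , λ j → gapfree (≤top i) (≤top j)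
      where open IsSuccessorUpTo (upTo top (s≤s z≤n) ℕ.≤-refl)

    first : ∀ i → ¬ (i ≺ Fin.zero)
    first i lt = contradiction (subst (key i <_) key-zero lt) λ ()

    f : Fin (suc top) → Fin (suc top)
    f = c ⟨$⟩ʳ_

    z : ℕ → Fin (suc top)
    z = iterate f Fin.zero

    -- A label outside of the orbit would lie under one of its edges, but the edges of a successor
    -- map span empty arcs.
    transitive : ∀ i → i ∈ orbit c Fin.zero
    transitive i with i ∈? orbit c Fin.zero
    ... | yes i∈ = i∈
    ... | no i∉ = let o , _ , cy = orbit-cover c i∉ (proj₁ (successor Fin.zero)) in
      contradiction cy (proj₂ (successor o) i)

    -- A shorter period would leave labels outside of the only cycle.
    no-return : ∀ p → p < top → z (suc p) ≢ Fin.zero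
    no-return p p<top ret = ℕ.<⇒≱ (s≤s p<top) (subst₂ _≤_ (length-allFin (suc top))
      (trans (List.length-map z (List.upTo (suc p))) (List.length-upTo (suc p)))
      (unique-⊆⇒length≤ (allFin⁺ (suc top)) λ {i} _ → visited i))
      where
      step : ∀ {j} → ∃[ k ] k < suc p × z k ≡ j → ∃[ k ] k < suc p × z k ≡ f j
      step (k , k<p , refl) with suc k ℕ.<? suc p
      ... | yes lt = suc k , lt , iterate-suc f Fin.zero k
      ... | no ≮ with refl ← ℕ.≤-antisym (ℕ.≤-pred k<p) (ℕ.≤-pred (ℕ.≮⇒≥ ≮)) =
        0 , s≤s z≤n , trans (sym ret) (iterate-suc f Fin.zero k)
      visited : ∀ i → i ∈ₗ List.map z (List.upTo (suc p))
      visited i with k , k<p , refl ← orbit-induction c (λ i → ∃[ k ] k < suc p × z k ≡ i) step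
                                        (0 , s≤s z≤n , refl) (transitive i) =
        ∈-map⁺ z (∈ₗ.∈-upTo⁺ k<p)

    -- A descending step would wrap around and pass over the first label, or end there; the former
    -- contradicts the empty arcs, the latter `no-return`.
    z-step : ∀ p → p < top → z p ≺ z (suc p)
    z-step p p<top rewrite iterate-suc f Fin.zero p with ≺-cmp (proj₁ (successor (z p)))
    ... | inj₂ lt = lt
    ... | inj₁ gt with ≺-cmp {Fin.zero} (no-return p p<top ∘ trans (iterate-suc f Fin.zero p) ∘ sym)
    ... | inj₁ lt = contradiction (inj₂ (inj₁ (lt , gt))) (proj₂ (successor (z p)) Fin.zero)
    ... | inj₂ lt = contradiction lt (first (f (z p)))

    z-mono : ∀ {p q} → p < q → q ≤ top → z p ≺ z q
    z-mono {p} {suc q} p<q q≤ with ℕ.m≤n⇒m<n∨m≡n (ℕ.≤-pred p<q)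
    ... | inj₁ lt = ≺-trans {z p} {z q} {z (suc q)} (z-mono lt (ℕ.<⇒≤ q≤)) (z-step q q≤)
    ... | inj₂ refl = z-step q q≤

    point-mono : ∀ {i j} → i Fin.< j → point c i ≺ point c j
    point-mono {j = j} i<j = z-mono i<j (≤top j)

    inL? : Decidable (λ ℓ → ℓ ≡ point c Fin.zero ⊎ ∃[ k ] ∃[ j ] point c k ≡ fromℕ top × k Fin.≤ j × ℓ ≡ point c j)
    inL? ℓ = (ℓ ≟ point c Fin.zero) ⊎-dec any? λ k → any? λ j →
      (point c k ≟ fromℕ top) ×-dec (k Fin.≤? j) ×-dec (ℓ ≟ point c j)

    point-of : ∀ i → ∃[ j ] point c j ≡ i
    point-of i = ∈⟦⟧⁻ (λ j → any? (λ m → z (toℕ m) ≟ j)) (transitive i)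

    key-top : key (fromℕ top) ≡ top
    key-top with keyView (fromℕ top)
    ... | onRight _ eq = trans eq (Fin.toℕ-fromℕ top)
    ... | onLeft _ eq = trans eq (trans (cong (λ t → top + (top ∸ t)) (Fin.toℕ-fromℕ top))
                           (trans (cong (top +_) (ℕ.n∸n≡0 top)) (ℕ.+-identityʳ top)))

    -- From the top label onwards all keys are at least `top`, whereas a right-hand label below some
    -- other label has a smaller key.
    ∈L⇒left : ∀ {a k b} → k ∈ L c → toℕ a < toℕ k → toℕ k < toℕ b → C k a b
    ∈L⇒left {a} {k} {b} k∈ a<k k<b with keyView k
    ... | onLeft l _ = isLeft⇒C l a<k k<b
    ... | onRight _ kk with ∈⟦⟧⁻ inL? k∈
    ... | inj₁ refl = contradiction a<k λ ()
    ... | inj₂ (t , j , t≡ , t≤j , refl) =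
      contradiction top≤ (ℕ.<⇒≱ (subst (_< top) (sym kk) (ℕ.<-≤-trans k<b (≤top b))))
      where
      top≤ : top ≤ key (point c j)
      top≤ with ℕ.m≤n⇒m<n∨m≡n t≤j
      ... | inj₁ t<j = ℕ.<⇒≤ (subst (_< key (point c j)) (trans (cong key t≡) key-top) (point-mono t<j))
      ... | inj₂ eq with refl ← Fin.toℕ-injective eq = ℕ.≤-reflexive (sym (trans (cong key t≡) key-top))

    ∉L⇒right : ∀ {a k b} → k ∉ L c → toℕ a < toℕ k → toℕ k < toℕ b → C k b a
    ∉L⇒right {a} {k} {b} k∉ a<k k<b with keyView k
    ... | onRight r _ = isRight⇒C r a<k k<b
    ... | onLeft _ kk with t , t≡ ← point-of (fromℕ top) | j , refl ← point-of k =
      contradiction (∈⟦⟧⁺ inL? (inj₂ (t , j , t≡ , t≤j , refl))) k∉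
      where
      t≤j : t Fin.≤ j
      t≤j = ℕ.≮⇒≥ λ j<t → ℕ.<⇒≱ (point-mono j<t) (subst (_≤ key (point c j)) (sym (trans (cong key t≡) key-top))
        (subst (top ≤_) (sym kk) (ℕ.m≤m+n top _)))

  layout : Layout c
  layout = record
    { key = key ; key-injective = key-injective ; successor = successor ; first = first
    ; left = ∈L⇒left ; right = ∉L⇒right ; transitive = transitive ; point-mono = point-mono }

AllPairs-∈ : {R : Rel A 0ℓ} {xs : List A} → AllPairs R xs → ∀ {a b} → a ∈ₗ xs → b ∈ₗ xs →
             a ≡ b ⊎ R a b ⊎ R b a
AllPairs-∈ (_ ∷ _) (here refl) (here refl) = inj₁ refl
AllPairs-∈ (rs ∷ _) (here refl) (there b∈) = inj₂ (inj₁ (All.lookup rs b∈))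
AllPairs-∈ (rs ∷ _) (there a∈) (here refl) = inj₂ (inj₂ (All.lookup rs a∈))
AllPairs-∈ (_ ∷ ps) (there a∈) (there b∈) = AllPairs-∈ ps a∈ b∈

AllPairs-map-∈ : {R S : Rel A 0ℓ} {xs : List A} →
                 (∀ {a b} → a ∈ₗ xs → b ∈ₗ xs → R a b → S a b) → AllPairs R xs → AllPairs S xs
AllPairs-map-∈ f [] = []
AllPairs-map-∈ f (rs ∷ ps) =
  All.tabulate (λ b∈ → f (here refl) (there b∈) (All.lookup rs b∈))
    ∷ AllPairs-map-∈ (λ a∈ b∈ → f (there a∈) (there b∈)) ps

-- Diagrams of polygons

module Diagrams {c : Permutation′ (suc n)} (layout : Layout c) where
  open Layout layout

  -- For `y` equal to `i` no `C i j y` can hold and `none-between` is void; `alone` settles this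
  -- case, in which `i` is the only point.
  record IsNext (S : Fin (suc n) → Set) (i y : Fin (suc n)) : Set where
    field
      next∈ : S y
      none-between : ∀ {j} → S j → ¬ C i j y
      alone : y ≡ i → ∀ {j} → S j → j ≡ i

  open IsNext public

  IsNext-unique : ∀ {S i y y′} → IsNext S i y → IsNext S i y′ → y ≡ y′
  IsNext-unique {i = i} {y} {y′} ny ny′ with y ≟ i | y′ ≟ i
  ... | yes y≡i | _ = trans y≡i (sym (alone ny y≡i (next∈ ny′)))
  ... | no _ | yes y′≡i = trans (alone ny′ y′≡i (next∈ ny)) (sym y′≡i)
  ... | no y≢i | no y′≢i with C-compare {i} {y} {y′} (y≢i ∘ sym) (y′≢i ∘ sym) (none-between ny (next∈ ny′))
  ... | inj₁ eq = eq
  ... | inj₂ cy = contradiction cy (none-between ny′ (next∈ ny))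

  IsNext-map : ∀ {S T : Fin (suc n) → Set} {i y} → (∀ {j} → S j → T j) → (∀ {j} → T j → S j) →
               IsNext S i y → IsNext T i y
  IsNext-map to from ny = record
    { next∈ = to (next∈ ny) ; none-between = none-between ny ∘ from ; alone = λ eq → alone ny eq ∘ from }

  cycle-∉ : ∀ (l : List (Fin (suc n))) {i} → i ∉ₗ l → cycle l ⟨$⟩ʳ i ≡ i
  cycle-∉ [] _ = refl
  cycle-∉ (a ∷ []) _ = refl
  cycle-∉ (a ∷ b ∷ as) i∉ = trans (cong (transpose a b ⟨$⟩ʳ_) (cycle-∉ (b ∷ as) (i∉ ∘ there)))
    (transpose-≢ (λ { refl → i∉ (here refl) }) (λ { refl → i∉ (there (here refl)) }))

  -- Prepending an entry `a` that precedes all others redirects only the edge that wrapped around to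
  -- `b`: it now ends in `a`, which is sent on to `b`.
  cycle-∈ : ∀ {l : List (Fin (suc n))} → AllPairs _≺_ l → ∀ {i} → i ∈ₗ l → IsNext (_∈ₗ l) i (cycle l ⟨$⟩ʳ i)
  cycle-∈ {a ∷ []} _ (here refl) = record
    { next∈ = here refl ; none-between = λ { (here refl) cy → C⇒≢₁₂ cy refl } ; alone = λ { _ (here refl) → refl } }
  cycle-∈ {a ∷ b ∷ as} ((a≺b ∷ a≺as) ∷ (b≺as ∷ _)) (here refl)
    rewrite cycle-∉ (b ∷ as) {a} (λ a∈ → ≺⇒≢ (All.lookup (a≺b ∷ a≺as) a∈) refl) | transposeˡ a b = record
    { next∈ = there (here refl)
    ; none-between = λ { (here refl) cy → C⇒≢₁₂ cy refl ; (there (here refl)) cy → C⇒≢₂₃ cy refl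
                       ; (there (there j∈)) cy → C-asym cy (inj₁ (a≺b , All.lookup b≺as j∈)) }
    ; alone = λ eq → contradiction (sym eq) (≺⇒≢ a≺b) }
  cycle-∈ {a ∷ b ∷ as} (a≺ ∷ sorted@(b≺as ∷ _)) {i} (there i∈) with ih ← cycle-∈ sorted i∈ | cycle (b ∷ as) ⟨$⟩ʳ i ≟ b
  ... | yes y≡b rewrite y≡b | transposeʳ a b = record
    { next∈ = here refl
    ; none-between = λ { (here refl) cy → C⇒≢₂₃ cy refl ; (there j∈) cy → beyond i∈ j∈ cy }
    ; alone = λ eq → contradiction eq (≺⇒≢ (All.lookup a≺ i∈)) }
    where
    after : ∀ {j} → j ∈ₗ b ∷ as → C i j a → i ≺ j
    after j∈ (inj₁ (i≺j , _)) = i≺j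
    after j∈ (inj₂ (inj₁ (j≺a , _))) = contradiction j≺a (≺-asym (All.lookup a≺ j∈))
    after j∈ (inj₂ (inj₂ (_ , i≺j))) = i≺j
    beyond : ∀ {j} → i ∈ₗ b ∷ as → j ∈ₗ b ∷ as → ¬ C i j a
    beyond (here i≡b) j∈ cy = C⇒≢₁₂ cy (sym (alone ih (sym i≡b) j∈))
    beyond (there i∈as) j∈ cy = none-between ih j∈ (inj₂ (inj₂ (All.lookup b≺as i∈as , after j∈ cy)))
  ... | no y≢b rewrite transpose-≢ {i = a} {b} (λ eq → ≺⇒≢ (All.lookup a≺ (next∈ ih)) (sym eq)) y≢b = record
    { next∈ = there (next∈ ih)
    ; none-between = λ { (here refl) cy → around (next∈ ih) cy ; (there j∈) cy → none-between ih j∈ cy }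
    ; alone = λ eq → contradiction (trans eq (sym (alone ih eq (here refl)))) y≢b }
    where
    y = cycle (b ∷ as) ⟨$⟩ʳ i
    before : C i a y → y ≺ i
    before (inj₁ (i≺a , _)) = contradiction i≺a (≺-asym (All.lookup a≺ i∈))
    before (inj₂ (inj₁ (_ , y≺i))) = y≺i
    before (inj₂ (inj₂ (y≺i , _))) = y≺i
    around : y ∈ₗ b ∷ as → ¬ C i a y
    around (here y≡b) _ = y≢b y≡b
    around (there y∈as) cy = none-between ih (here refl) (inj₂ (inj₁ (All.lookup b≺as y∈as , before cy)))

  clockwise-sorted : ∀ P → AllPairs _≺_ (clockwise c P)
  clockwise-sorted P = AllPairs.filter⁺ (_∈? P)
    (AllPairs.map⁺ {f = point c} {xs = allFin (suc n)} (AllPairs.tabulate⁺-< {f = λ i → i} point-mono))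

  ∈clockwise⁺ : ∀ {P i} → i ∈ P → i ∈ₗ clockwise c P
  ∈clockwise⁺ {P} {i} i∈ with j , refl ← point-surjective i =
    ∈-filter⁺ (_∈? P) (∈-map⁺ (point c) (∈-allFin j)) i∈

  ∈clockwise⁻ : ∀ {P i} → i ∈ₗ clockwise c P → i ∈ P
  ∈clockwise⁻ {P} i∈ = proj₂ (∈-filter⁻ (_∈? P) {xs = List.map (point c) (allFin (suc n))} i∈)

  DisjointHulls-sym : ∀ {P Q} → DisjointHulls c P Q → DisjointHulls c Q P
  DisjointHulls-sym {P} {Q} (disj , noPQ , noQP) =
    (λ { (i , i∈) → let i∈Q , i∈P = x∈p∩q⁻ Q P i∈ in disj (i , x∈p∩q⁺ (i∈P , i∈Q)) }) , noQP , noPQ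

  DisjointHulls-disjoint : ∀ {P Q i} → DisjointHulls c P Q → i ∈ P → i ∉ Q
  DisjointHulls-disjoint (disj , _) i∈P i∈Q = disj (-, x∈p∩q⁺ (i∈P , i∈Q))

  private
    alternate : ∀ {P Q p q p′ q′} → p ≺ q → q ≺ p′ → p′ ≺ q′ →
                p ∈ P → q ∈ Q → p′ ∈ P → q′ ∈ Q → Alternate c P Q
    alternate {p = p} {q} {p′} {q′} pq qp′ p′q′ p∈ q∈ p′∈ q′∈
      with i , refl ← point-surjective p | j , refl ← point-surjective q
         | k , refl ← point-surjective p′ | l , refl ← point-surjective q′ =
      i , j , k , l , ≺⇒< pq , ≺⇒< qp′ , ≺⇒< p′q′ , p∈ , q∈ , p′∈ , q′∈
      where
      ≺⇒< : ∀ {i j} → point c i ≺ point c j → i Fin.< j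
      ≺⇒< {i} {j} lt with Fin.<-cmp i j
      ... | tri< i<j _ _ = i<j
      ... | tri≈ _ refl _ = contradiction refl (≺⇒≢ lt)
      ... | tri> _ _ j<i = contradiction (point-mono j<i) (≺-asym lt)

  -- `Alternate` reads the circle from its first point, while the crossing is cyclic. Of the nine
  -- ways to cut the two cyclic triples open, four are consistent, and each is an alternation
  -- starting with `P` or with `Q`.
  DisjointHulls-noncrossing : ∀ {P Q p p′ q q′} → DisjointHulls c P Q →
                              p ∈ P → p′ ∈ P → q ∈ Q → q′ ∈ Q → C p q p′ → ¬ C p′ q′ p
  DisjointHulls-noncrossing (_ , noPQ , noQP) p∈ p′∈ q∈ q′∈ = go
    where
    go : C _ _ _ → ¬ C _ _ _
    go (inj₁ (pq , qp′)) (inj₁ (p′q′ , q′p)) = ≺-asym (≺-trans pq qp′) (≺-trans p′q′ q′p)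
    go (inj₁ (pq , qp′)) (inj₂ (inj₁ (q′p , pp′))) = noQP (alternate q′p pq qp′ q′∈ p∈ q∈ p′∈)
    go (inj₁ (pq , qp′)) (inj₂ (inj₂ (pp′ , p′q′))) = noPQ (alternate pq qp′ p′q′ p∈ q∈ p′∈ q′∈)
    go (inj₂ (inj₁ (qp′ , p′p))) (inj₁ (p′q′ , q′p)) = noQP (alternate qp′ p′q′ q′p q∈ p′∈ q′∈ p∈)
    go (inj₂ (inj₁ (qp′ , p′p))) (inj₂ (inj₁ (q′p , pp′))) = ≺-asym p′p pp′
    go (inj₂ (inj₁ (qp′ , p′p))) (inj₂ (inj₂ (pp′ , p′q′))) = ≺-asym p′p pp′
    go (inj₂ (inj₂ (p′p , pq))) (inj₁ (p′q′ , q′p)) = noPQ (alternate p′q′ q′p pq p′∈ q′∈ p∈ q∈)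
    go (inj₂ (inj₂ (p′p , pq))) (inj₂ (inj₁ (q′p , pp′))) = ≺-asym p′p pp′
    go (inj₂ (inj₂ (p′p , pq))) (inj₂ (inj₂ (pp′ , p′q′))) = ≺-asym p′p pp′

  disjointHulls : ∀ {P Q} → (∀ {i} → i ∈ P → i ∉ Q) →
                  (∀ {p p′ q q′} → p ∈ P → p′ ∈ P → q ∈ Q → q′ ∈ Q → C p q p′ → ¬ C p′ q′ p) →
                  DisjointHulls c P Q
  disjointHulls {P} {Q} disj nc =
    (λ { (i , i∈) → let i∈P , i∈Q = x∈p∩q⁻ P Q i∈ in disj i∈P i∈Q }) ,
    (λ { (i , j , k , l , i<j , j<k , k<l , p∈ , q∈ , p′∈ , q′∈) →
      nc p∈ p′∈ q∈ q′∈ (inj₁ (point-mono i<j , point-mono j<k))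
        (inj₂ (inj₂ (point-mono (Fin.<-trans i<j j<k) , point-mono k<l))) }) ,
    (λ { (i , j , k , l , i<j , j<k , k<l , q∈ , p∈ , q′∈ , p′∈) →
      nc p∈ p′∈ q′∈ q∈ (inj₁ (point-mono j<k , point-mono k<l))
        (inj₂ (inj₁ (point-mono i<j , point-mono (Fin.<-trans j<k k<l)))) })

  DisjointHulls-⊆ : ∀ {P P′ Q Q′} → P′ ⊆ P → Q′ ⊆ Q → DisjointHulls c P Q → DisjointHulls c P′ Q′
  DisjointHulls-⊆ P′⊆ Q′⊆ dh = disjointHulls (λ p∈ q∈ → DisjointHulls-disjoint dh (P′⊆ p∈) (Q′⊆ q∈))
    (λ p∈ p′∈ q∈ q′∈ → DisjointHulls-noncrossing dh (P′⊆ p∈) (P′⊆ p′∈) (Q′⊆ q∈) (Q′⊆ q′∈))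

  Noncrossing-∈ : ∀ {Ps P Q} → Noncrossing c Ps → P ∈ₗ Ps → Q ∈ₗ Ps → P ≡ Q ⊎ DisjointHulls c P Q
  Noncrossing-∈ nc P∈ Q∈ with AllPairs-∈ nc P∈ Q∈
  ... | inj₁ eq = inj₁ eq
  ... | inj₂ (inj₁ dh) = inj₂ dh
  ... | inj₂ (inj₂ dh) = inj₂ (DisjointHulls-sym dh)

  fromPol-∉ : ∀ Ps {i} → (∀ {P} → P ∈ₗ Ps → i ∉ P) → fromPol c Ps ⟨$⟩ʳ i ≡ i
  fromPol-∉ [] _ = refl
  fromPol-∉ (P ∷ Ps) i∉ = trans (cong (cycle (clockwise c P) ⟨$⟩ʳ_) (fromPol-∉ Ps (i∉ ∘ there)))
    (cycle-∉ (clockwise c P) (i∉ (here refl) ∘ ∈clockwise⁻))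

  fromPol-∈ : ∀ {Ps} → Noncrossing c Ps → ∀ {P i} → P ∈ₗ Ps → i ∈ P → IsNext (_∈ P) i (fromPol c Ps ⟨$⟩ʳ i)
  fromPol-∈ {P ∷ Ps} (dhs ∷ _) {i = i} (here refl) i∈
    rewrite fromPol-∉ Ps {i} (λ Q∈ → DisjointHulls-disjoint (All.lookup dhs Q∈) i∈) =
    IsNext-map ∈clockwise⁻ ∈clockwise⁺ (cycle-∈ (clockwise-sorted P) (∈clockwise⁺ i∈))
  fromPol-∈ {Q ∷ Ps} (dhs ∷ nc) {P} {i} (there P∈) i∈ =
    subst (IsNext (_∈ P) i)
      (sym (cycle-∉ (clockwise c Q)
        λ y∈ → DisjointHulls-disjoint (All.lookup dhs P∈) (∈clockwise⁻ y∈) (next∈ ih))) ih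
    where ih = fromPol-∈ nc P∈ i∈

  IsPolygon : Subset (suc n) → Set
  IsPolygon P = ∃[ a ] ∃[ b ] a ∈ P × b ∈ P × a ≢ b

  module _ {Ps : List (Subset (suc n))} (nc : Noncrossing c Ps) where
    private
      y : Permutation′ (suc n)
      y = fromPol c Ps

    -- A vertex of `P` outside of the orbit would lie under one of its edges, but each edge leads to
    -- the next vertex of `P`.
    fromPol-orbit : ∀ {P i} → P ∈ₗ Ps → i ∈ P → orbit y i ≡ P
    fromPol-orbit {P} {i} P∈ i∈ = ⊆-antisym orbit⊆ ⊆orbit
      where
      orbit⊆ : orbit y i ⊆ P
      orbit⊆ = orbit-induction y (_∈ P) (λ j∈ → next∈ (fromPol-∈ nc P∈ j∈)) i∈
      ⊆orbit : P ⊆ orbit y i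
      ⊆orbit {j} j∈ = decidable-stable (j ∈? orbit y i) λ j∉ →
        let o , o∈ , cy = orbit-cover y j∉ λ fix → j∉ (subst (_∈ orbit y i)
                            (sym (alone (fromPol-∈ nc P∈ i∈) fix j∈)) (orbit-refl y))
        in none-between (fromPol-∈ nc P∈ (orbit⊆ o∈)) j∈ cy

    private
      polygonOf : ∀ i → Any (i ∈_) Ps ⊎ (y ⟨$⟩ʳ i ≡ i)
      polygonOf i with Any.any? (i ∈?_) Ps
      ... | yes any = inj₁ any
      ... | no none = inj₂ (fromPol-∉ Ps (λ P∈ i∈ → none (lose P∈ i∈)))

    Gap-fromPol : Gap y
    Gap-fromPol .gap {i} {j} cy with polygonOf i | polygonOf j
    ... | inj₂ fix | _ = contradiction (sym fix) (C⇒≢₁₃ cy)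
    ... | inj₁ _ | inj₂ fix = subst (λ a → C i a (y ⟨$⟩ʳ i)) (sym fix) cy
    ... | inj₁ anyP | inj₁ anyQ with P , P∈ , i∈ ← find anyP | Q , Q∈ , j∈ ← find anyQ
                                 with Noncrossing-∈ nc P∈ Q∈
    ... | inj₁ refl = contradiction cy (none-between (fromPol-∈ nc P∈ i∈) j∈)
    ... | inj₂ dh with yi∈ ← next∈ (fromPol-∈ nc P∈ i∈) | yj∈ ← next∈ (fromPol-∈ nc Q∈ j∈)
                  with C-total (λ eq → DisjointHulls-disjoint dh i∈ (subst (_∈ Q) (sym eq) yj∈))
                               (λ eq → DisjointHulls-disjoint dh yi∈ (subst (_∈ Q) eq yj∈)) (C⇒≢₁₃ cy)
    ... | inj₁ good = good
    -- If `y j` left the arc, the chord from `j` to `y j` would cross the chord from `i` to `y i`.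
    ... | inj₂ bad = contradiction (C-rot bad) (DisjointHulls-noncrossing dh i∈ yi∈ j∈ yj∈ cy)

    Pol-fromPol⁻ : ∀ {P} → P ∈ₗ Pol y → P ∈ₗ Ps
    Pol-fromPol⁻ P∈ with i , i∈ , refl ← ∈Pol⁻ y P∈ with polygonOf i
    ... | inj₂ fix = contradiction fix (∈supp⁻ y i∈)
    ... | inj₁ any with P , P∈ , i∈P ← find any = subst (_∈ₗ Ps) (sym (fromPol-orbit P∈ i∈P)) P∈

    Pol-fromPol⁺ : ∀ {P} → P ∈ₗ Ps → IsPolygon P → P ∈ₗ Pol y
    Pol-fromPol⁺ {P} P∈ (a , b , a∈ , b∈ , a≢b) = subst (_∈ₗ Pol y) (fromPol-orbit P∈ a∈)
      (∈Pol⁺ y (≢⇒∈supp y (subst (b ∈_) (sym (fromPol-orbit P∈ a∈)) b∈) (a≢b ∘ sym)))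

  module _ {x : Permutation′ (suc n)} (gx : Gap x) where
    Gap-IsNext : ∀ {i} → IsNext (_∈ orbit x i) i (x ⟨$⟩ʳ i)
    Gap-IsNext = record { next∈ = orbit-image x ; none-between = orbit-∉gap gx ; alone = λ eq → fixed-orbit x eq }

    Noncrossing-Pol : Noncrossing c (Pol x)
    Noncrossing-Pol = AllPairs-map-∈ dh (unique-Pol x)
      where
      dh : ∀ {P Q} → P ∈ₗ Pol x → Q ∈ₗ Pol x → P ≢ Q → DisjointHulls c P Q
      dh P∈ Q∈ P≢Q = disjointHulls disjoint crossing
        where
        disjoint : ∀ {i} → i ∈ _ → i ∉ _
        disjoint i∈P i∈Q = P≢Q (trans (Pol-orbit x P∈ i∈P) (sym (Pol-orbit x Q∈ i∈Q)))
        crossing : ∀ {p p′ q q′} → p ∈ _ → p′ ∈ _ → q ∈ _ → q′ ∈ _ → C p q p′ → ¬ C p′ q′ p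
        crossing p∈ p′∈ q∈ q′∈ pqp′ p′q′p =
          disjoint (subst (_ ∈_) (sym (Pol-orbit x P∈ p∈))
              (orbits-noncrossing gx (subst (_ ∈_) (Pol-orbit x P∈ p∈) p′∈) (subst (_ ∈_) (Pol-orbit x Q∈ q∈) q′∈)
                pqp′ p′q′p)) q∈

    IsPolygon-Pol : ∀ {P} → P ∈ₗ Pol x → IsPolygon P
    IsPolygon-Pol P∈ with i , i∈ , refl ← ∈Pol⁻ x P∈ =
      i , x ⟨$⟩ʳ i , orbit-refl x , orbit-image x , ∈supp⁻ x i∈ ∘ sym

-- The sets D and U

module _ {x : Permutation′ n} where
  private
    someMin? : Decidable (λ i → Any (λ P → IsMin P i) (Pol x))
    someMin? i = Any.any? (λ P → isMin? P i) (Pol x)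

    someMax? : Decidable (λ i → Any (λ P → IsMax P i) (Pol x))
    someMax? i = Any.any? (λ P → isMax? P i) (Pol x)

  ∈D⁺ : ∀ {i j} → j ∈ orbit x i → i Fin.< j → i ∈ D x
  ∈D⁺ {i} {j} j∈ i<j = x∈p∧x∉q⇒x∈p─q (≢⇒∈supp x j∈ (λ { refl → Fin.<-irrefl refl i<j })) λ i∈t →
    let P , P∈ , i∈P , max = find (∈⟦⟧⁻ someMax? i∈t) in
    ℕ.<⇒≱ i<j (max j (subst (j ∈_) (sym (Pol-orbit x P∈ i∈P)) j∈))

  ∈D⁻ : ∀ {i} → i ∈ D x → ∃[ j ] j ∈ orbit x i × i Fin.< j
  ∈D⁻ {i} i∈D with any? (λ j → (j ∈? orbit x i) ×-dec (i Fin.<? j))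
  ... | yes p = p
  ... | no none = contradiction (∈⟦⟧⁺ someMax? (lose (∈Pol⁺ x (p─q⊆p _ _ i∈D)) (orbit-refl x , max)))
                    (∉─ (supp x) _ i∈D)
    where
    max : ∀ j → j ∈ orbit x i → j Fin.≤ i
    max j j∈ = ℕ.≮⇒≥ λ i<j → none (j , j∈ , i<j)

  ∈U⁺ : ∀ {i j} → j ∈ orbit x i → j Fin.< i → i ∈ U x
  ∈U⁺ {i} {j} j∈ j<i = x∈p∧x∉q⇒x∈p─q (≢⇒∈supp x j∈ (λ { refl → Fin.<-irrefl refl j<i })) λ i∈t →
    let P , P∈ , i∈P , min = find (∈⟦⟧⁻ someMin? i∈t) in
    ℕ.<⇒≱ j<i (min j (subst (j ∈_) (sym (Pol-orbit x P∈ i∈P)) j∈))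

  ∈U⁻ : ∀ {i} → i ∈ U x → ∃[ j ] j ∈ orbit x i × j Fin.< i
  ∈U⁻ {i} i∈U with any? (λ j → (j ∈? orbit x i) ×-dec (j Fin.<? i))
  ... | yes p = p
  ... | no none = contradiction (∈⟦⟧⁺ someMin? (lose (∈Pol⁺ x (p─q⊆p _ _ i∈U)) (orbit-refl x , min)))
                    (∉─ (supp x) _ i∈U)
    where
    min : ∀ j → j ∈ orbit x i → i Fin.≤ j
    min j j∈ = ℕ.≮⇒≥ λ j<i → none (j , j∈ , j<i)

  initialIndices⊆supp : initialIndices x ⊆ supp x
  initialIndices⊆supp i∈ = let P , P∈ , i∈P , _ = find (∈⟦⟧⁻ someMin? i∈) in Pol⊆supp x P∈ i∈P

  terminalIndices⊆supp : terminalIndices x ⊆ supp x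
  terminalIndices⊆supp i∈ = let P , P∈ , i∈P , _ = find (∈⟦⟧⁻ someMax? i∈) in Pol⊆supp x P∈ i∈P

  D⊆supp : D x ⊆ supp x
  D⊆supp = p─q⊆p (supp x) (terminalIndices x)

  U⊆supp : U x ⊆ supp x
  U⊆supp = p─q⊆p (supp x) (initialIndices x)

  supp⊆D∪U : ∀ {i} → i ∈ supp x → i ∈ D x ⊎ i ∈ U x
  supp⊆D∪U {i} i∈ with Fin.<-cmp i (x ⟨$⟩ʳ i)
  ... | tri< i<xi _ _ = inj₁ (∈D⁺ (orbit-image x) i<xi)
  ... | tri≈ _ eq _ = contradiction (sym eq) (∈supp⁻ x i∈)
  ... | tri> _ _ xi<i = inj₂ (∈U⁺ (orbit-image x) xi<i)

  -- No vertex of a polygon is both initial and terminal. Formulas for `D` and `U` therefore settle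
  -- the initial and the terminal indices as well.
  initialIndices≡D─U : initialIndices x ≡ D x ─ U x
  initialIndices≡D─U = ⊆-antisym ⊆₁ ⊆₂
    where
    ⊆₁ : initialIndices x ⊆ D x ─ U x
    ⊆₁ i∈ with ∉U ← (λ i∈U → ∉─ (supp x) (initialIndices x) i∈U i∈) with supp⊆D∪U (initialIndices⊆supp i∈)
    ... | inj₁ i∈D = x∈p∧x∉q⇒x∈p─q i∈D ∉U
    ... | inj₂ i∈U = contradiction i∈U ∉U
    ⊆₂ : D x ─ U x ⊆ initialIndices x
    ⊆₂ {i} i∈ = decidable-stable (i ∈? initialIndices x) λ i∉ →
      ∉─ (D x) (U x) i∈ (x∈p∧x∉q⇒x∈p─q (D⊆supp (p─q⊆p (D x) (U x) i∈)) i∉)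

  terminalIndices≡U─D : terminalIndices x ≡ U x ─ D x
  terminalIndices≡U─D = ⊆-antisym ⊆₁ ⊆₂
    where
    ⊆₁ : terminalIndices x ⊆ U x ─ D x
    ⊆₁ i∈ with ∉D ← (λ i∈D → ∉─ (supp x) (terminalIndices x) i∈D i∈) with supp⊆D∪U (terminalIndices⊆supp i∈)
    ... | inj₁ i∈D = contradiction i∈D ∉D
    ... | inj₂ i∈U = x∈p∧x∉q⇒x∈p─q i∈U ∉D
    ⊆₂ : U x ─ D x ⊆ terminalIndices x
    ⊆₂ {i} i∈ = decidable-stable (i ∈? terminalIndices x) λ i∉ →
      ∉─ (U x) (D x) i∈ (x∈p∧x∉q⇒x∈p─q (U⊆supp (p─q⊆p (U x) (D x) i∈)) i∉)

-- A noncrossing permutation is determined by D and U: the polygons crossed by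
-- a horizontal line are ordered from left to right, and the next label on the
-- left (right) belongs to the leftmost (rightmost) one of them.
module Determination {c : Permutation′ (suc n)} (layout : Layout c) where
  open Layout layout
  open Diagrams layout

  private
    -- The state of a sweep through the labels from below: cycles are compared only on labels
    -- already passed.
    Below : ℕ → Permutation′ (suc n) → Permutation′ (suc n) → Set
    Below m x y = ∀ {i j} → toℕ i < m → toℕ j < m → j ∈ orbit x i → j ∈ orbit y i

    -- The largest label `b*` below `ℓ` in the cycle of `b` in `x` shares its cycle in `y` with `ℓ`,
    -- so it lies in `D y` and hence in `D x`. Its cycle in `x` thus goes on upwards, and `ℓ` has to
    -- be skipped.
    reaches : ∀ {x y} ℓ {b} → D y ⊆ D x → Below (toℕ ℓ) x y → toℕ b < toℕ ℓ → ℓ ∈ orbit y b →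
              ℓ ∉ orbit x b → ∃[ e ] toℕ ℓ < toℕ e × e ∈ orbit x b
    reaches {x} {y} ℓ {b} D⊆ below b<ℓ ℓ∈y ℓ∉x = go (∈D⁻ {x = x} (D⊆ (∈D⁺ {x = y} ℓ∈b* (proj₂ Sb*))))
      where
      S : Fin (suc n) → Set
      S i = i ∈ orbit x b × i Fin.< ℓ
      b*-max = maximum {_⋖_ = Fin._<_} {S = S} Fin._<?_ Fin.<-trans Fin.<-irrefl
                 (λ i → (i ∈? orbit x b) ×-dec (i Fin.<? ℓ)) (orbit-refl x , b<ℓ)
      b* : Fin (suc n)
      b* = proj₁ b*-max
      Sb* : S b*
      Sb* = proj₁ (proj₂ b*-max)
      ℓ∈b* : ℓ ∈ orbit y b*
      ℓ∈b* = orbit-trans y (orbit-sym y (below b<ℓ (proj₂ Sb*) (proj₁ Sb*))) ℓ∈y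
      go : ∃[ e ] e ∈ orbit x b* × b* Fin.< e → ∃[ e ] toℕ ℓ < toℕ e × e ∈ orbit x b
      go (e , e∈ , b*<e) with e∈b ← orbit-trans x (proj₁ Sb*) e∈ | Fin.<-cmp ℓ e
      ... | tri< ℓ<e _ _ = e , ℓ<e , e∈b
      ... | tri≈ _ refl _ = contradiction e∈b ℓ∉x
      ... | tri> _ _ e<ℓ = contradiction b*<e (proj₂ (proj₂ b*-max) (e∈b , e<ℓ))

    -- By `U` the label `ℓ` is also joined downwards in `y`, say to `b`. If `b` and `j` lay on
    -- different cycles, both the cycle of `b` in `x` and that of `j` in `y` would bypass `ℓ` and
    -- reach above it.
    below-step : ∀ {x y} ℓ → Gap x → Gap y → D x ≡ D y → U x ≡ U y →
                 Below (toℕ ℓ) x y → Below (toℕ ℓ) y x →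
                 ∀ {j} → toℕ j < toℕ ℓ → j ∈ orbit x ℓ → j ∈ orbit y ℓ
    below-step {x} {y} ℓ gx gy D≡ U≡ xy yx {j} j<ℓ j∈ with b , b∈ , b<ℓ ← ∈U⁻ {x = y} (subst (ℓ ∈_) U≡ (∈U⁺ {x = x} j∈ j<ℓ)) =
      decidable-stable (j ∈? orbit y ℓ) λ j∉ →
        let e , ℓ<e , e∈ = reaches {x} {y} ℓ (λ {i} → subst (i ∈_) (sym D≡)) xy b<ℓ (orbit-sym y b∈) (ℓ∉x j∉)
            d , ℓ<d , d∈ = reaches {y} {x} ℓ (λ {i} → subst (i ∈_) D≡) yx j<ℓ (orbit-sym x j∈) (j∉ ∘ orbit-sym y)
        in contra j∉ ℓ<e e∈ ℓ<d d∈
      where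
      ℓ∉x : j ∉ orbit y ℓ → ℓ ∉ orbit x b
      ℓ∉x j∉ ℓ∈ = j∉ (orbit-trans y b∈ (xy b<ℓ j<ℓ (orbit-trans x ℓ∈ j∈)))
      contra : ∀ {e d} → j ∉ orbit y ℓ → toℕ ℓ < toℕ e → e ∈ orbit x b → toℕ ℓ < toℕ d → d ∈ orbit y j → ⊥
      contra {e} {d} j∉ ℓ<e e∈ ℓ<d d∈
        -- The order of `j` and `b` as seen from `ℓ` decides which of the two diagrams has the
        -- crossing: `ℓ` and `b` against `j` and `d` in `y`, or `ℓ` and `j` against `b` and `e` in
        -- `x`.
        with C-total {ℓ} {j} {b} (λ { refl → ℕ.<-irrefl refl j<ℓ }) (λ { refl → j∉ b∈ })
               (λ { refl → ℕ.<-irrefl refl b<ℓ }) | ℓ ∈? L c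
      ... | inj₁ ℓjb | yes ℓ∈L = j∉ (orbits-noncrossing gy b∈ d∈ ℓjb (C-rot (left ℓ∈L b<ℓ ℓ<d)))
      ... | inj₂ ℓbj | yes ℓ∈L = ℓ∉x j∉ (orbit-sym x (orbits-noncrossing gx j∈ e∈ ℓbj (C-rot (left ℓ∈L j<ℓ ℓ<e))))
      ... | inj₁ ℓjb | no ℓ∉L = ℓ∉x j∉ (orbit-sym x (orbit-trans x
              (orbits-noncrossing gx j∈ (orbit-sym x e∈) (right ℓ∉L j<ℓ ℓ<e) (C-rot ℓjb)) (orbit-sym x e∈)))
      ... | inj₂ ℓbj | no ℓ∉L = j∉ (orbit-trans y
              (orbits-noncrossing gy b∈ (orbit-sym y d∈) (right ℓ∉L b<ℓ ℓ<d) (C-rot ℓbj)) (orbit-sym y d∈))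

    below : ∀ {x y} → Gap x → Gap y → D x ≡ D y → U x ≡ U y → ∀ m → m ≤ suc n → Below m x y × Below m y x
    below gx gy D≡ U≡ zero _ = (λ ()) , (λ ())
    below {x} {y} gx gy D≡ U≡ (suc m) m<N with xy , yx ← below {x} {y} gx gy D≡ U≡ m (ℕ.<⇒≤ m<N) =
      extend {x} {y} xy (step {x} {y} gx gy D≡ U≡ xy yx) ,
      extend {y} {x} yx (step {y} {x} gy gx (sym D≡) (sym U≡) yx xy)
      where
      Step : Permutation′ (suc n) → Permutation′ (suc n) → Set
      Step x y = ∀ {ℓ j} → toℕ ℓ ≡ m → toℕ j < m → j ∈ orbit x ℓ → j ∈ orbit y ℓ
      step : ∀ {x y} → Gap x → Gap y → D x ≡ D y → U x ≡ U y → Below m x y → Below m y x → Step x y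
      step {x} {y} gx gy D≡ U≡ xy yx {ℓ} refl = below-step {x} {y} ℓ gx gy D≡ U≡ xy yx
      extend : ∀ {x y} → Below m x y → Step x y → Below (suc m) x y
      extend {x} {y} xy st {i} {j} i< j< j∈ with ℕ.m<1+n⇒m<n∨m≡n i< | ℕ.m<1+n⇒m<n∨m≡n j<
      ... | inj₁ i<m | inj₁ j<m = xy i<m j<m j∈
      ... | inj₂ i≡m | inj₁ j<m = st i≡m j<m j∈
      ... | inj₁ i<m | inj₂ j≡m = orbit-sym y (st j≡m i<m (orbit-sym x j∈))
      ... | inj₂ i≡m | inj₂ j≡m with refl ← Fin.toℕ-injective (trans i≡m (sym j≡m)) = orbit-refl y

  D-U-determine : ∀ {x y} → Gap x → Gap y → D x ≡ D y → U x ≡ U y → x ≈ y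
  D-U-determine {x} {y} gx gy D≡ U≡ i with xy , yx ← below {x} {y} gx gy D≡ U≡ (suc n) ℕ.≤-refl =
    IsNext-unique (Gap-IsNext gx)
      (IsNext-map (λ {j} → yx (Fin.toℕ<n i) (Fin.toℕ<n j)) (λ {j} → xy (Fin.toℕ<n i) (Fin.toℕ<n j)) (Gap-IsNext gy))

-- Adding vertices to polygons

Pointwise-∈ˡ : {R : A → B → Set} {xs : List A} {ys : List B} {a : A} →
               Pointwise R xs ys → a ∈ₗ xs → ∃[ b ] b ∈ₗ ys × R a b
Pointwise-∈ˡ (r ∷ _) (here refl) = -, here refl , r
Pointwise-∈ˡ (_ ∷ rs) (there a∈) = let b , b∈ , r = Pointwise-∈ˡ rs a∈ in b , there b∈ , r

Pointwise-∈ʳ : {R : A → B → Set} {xs : List A} {ys : List B} {b : B} →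
               Pointwise R xs ys → b ∈ₗ ys → ∃[ a ] a ∈ₗ xs × R a b
Pointwise-∈ʳ (r ∷ _) (here refl) = -, here refl , r
Pointwise-∈ʳ (_ ∷ rs) (there b∈) = let a , a∈ , r = Pointwise-∈ʳ rs b∈ in a , there a∈ , r

Pointwise-map : {R : A → B → Set} {f : A → B} {xs : List A} →
                (∀ {a} → a ∈ₗ xs → R a (f a)) → Pointwise R xs (List.map f xs)
Pointwise-map {xs = []} _ = []
Pointwise-map {xs = x ∷ xs} r = r (here refl) ∷ Pointwise-map (r ∘ there)

minimum : {P : Subset n} {i : Fin n} → i ∈ P → ∃[ a ] IsMin P a
minimum {P = P} i∈ =
  let a , a∈ , min = maximum {_⋖_ = λ a b → b Fin.< a} {S = _∈ P} (λ a b → b Fin.<? a) (λ p q → Fin.<-trans q p)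
                       (λ { refl → Fin.<-irrefl refl }) (_∈? P) i∈
  in a , a∈ , λ j j∈ → ℕ.≮⇒≥ (min j∈)

greatest : {P : Subset n} {i : Fin n} → i ∈ P → ∃[ b ] IsMax P b
greatest {P = P} i∈ =
  let b , b∈ , max = maximum {_⋖_ = Fin._<_} {S = _∈ P} Fin._<?_ Fin.<-trans Fin.<-irrefl (_∈? P) i∈
  in b , b∈ , λ j j∈ → ℕ.≮⇒≥ (max j∈)

if-dec : {P : Set} (P? : Dec P) (a b : A) →
         (P × (if does P? then a else b) ≡ a) ⊎ (¬ P × (if does P? then a else b) ≡ b)
if-dec (yes p) a b = inj₁ (p , refl)
if-dec (no ¬p) a b = inj₂ (¬p , refl)

-- `Nested` with arbitrary vertices below and above `k` as witnesses, which is easier to carry along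
-- when polygons change.
record Spans (P : Subset n) (k : Fin n) : Set where
  constructor spans
  field
    {lower upper} : Fin n
    k∉ : k ∉ P
    lower∈ : lower ∈ P
    lower< : toℕ lower < toℕ k
    upper∈ : upper ∈ P
    <upper : toℕ k < toℕ upper

Nested⇒Spans : {P : Subset n} {k : Fin n} → Nested P k → Spans P k
Nested⇒Spans (k∉ , (a , (a∈ , _) , a<k) , (b , (b∈ , _) , k<b)) = spans k∉ a∈ a<k b∈ k<b

Spans⇒Nested : {P : Subset n} {k : Fin n} → Spans P k → Nested P k
Spans⇒Nested (spans k∉ a∈ a<k b∈ k<b) =
  k∉ , (let a , min = minimum a∈ in a , min , ℕ.≤-<-trans (proj₂ min _ a∈) a<k)
     , (let b , max = greatest b∈ in b , max , ℕ.<-≤-trans k<b (proj₂ max _ b∈))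

module Insertion {c : Permutation′ (suc n)} (layout : Layout c) where
  open Layout layout
  open Diagrams layout

  -- As new vertices are spanned by the old polygon, an extension changes neither its smallest nor
  -- its largest vertex.
  record Extends (K : Fin (suc n) → Set) (P P′ : Subset (suc n)) : Set where
    field
      grows : P ⊆ P′
      origin : ∀ {i} → i ∈ P′ → i ∈ P ⊎ (K i × Spans P i)

  open Extends public

  Extends-refl : ∀ {K P} → Extends K P P
  Extends-refl = record { grows = λ i∈ → i∈ ; origin = inj₁ }

  -- `Admits` freed from `replace`: the enlarged polygon is compared directly with the other ones.
  record Fits (Ps : List (Subset (suc n))) (k : Fin (suc n)) (P : Subset (suc n)) : Set where
    field
      spanned : Spans P k
      disjoint : ∀ {Q} → Q ∈ₗ Ps → Q ≢ P → DisjointHulls c (P ∪ ⁅ k ⁆) Q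
    open Spans spanned public

  private
    substitute : (P P′ Q : Subset (suc n)) → Subset (suc n)
    substitute P P′ Q = if does (Q ≟ˢ P) then P′ else Q

    substitute-≡ : ∀ P P′ → substitute P P′ P ≡ P′
    substitute-≡ P P′ = cong (λ b → if b then P′ else P) (dec-true (P ≟ˢ P) refl)

    substitute-≢ : ∀ {P P′ Q} → Q ≢ P → substitute P P′ Q ≡ Q
    substitute-≢ {P} {P′} {Q} Q≢P = cong (λ b → if b then P′ else Q) (dec-false (Q ≟ˢ P) Q≢P)

    adjoin⁻ : ∀ {P : Subset (suc n)} {k i} → i ∈ P ∪ ⁅ k ⁆ → i ∈ P ⊎ i ≡ k
    adjoin⁻ {P} {k} i∈ with x∈p∪q⁻ P ⁅ k ⁆ i∈
    ... | inj₁ i∈P = inj₁ i∈P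
    ... | inj₂ i∈k = inj₂ (x∈⁅y⁆⇒x≡y k i∈k)

    adjoin⁺ : ∀ {P : Subset (suc n)} {k} → P ⊆ P ∪ ⁅ k ⁆
    adjoin⁺ i∈ = x∈p∪q⁺ (inj₁ i∈)

    new∈ : ∀ {P : Subset (suc n)} {k} → k ∈ P ∪ ⁅ k ⁆
    new∈ {k = k} = x∈p∪q⁺ (inj₂ (x∈⁅x⁆ k))

  module _ {Ps : List (Subset (suc n))} (nc : Noncrossing c Ps) {k : Fin (suc n)} where
    Fits⇒Admits : ∀ {P} → Fits Ps k P → Admits c Ps k P
    Fits⇒Admits {P} fits = Spans⇒Nested spanned , AllPairs.map⁺ (AllPairs-map-∈ dh nc)
      where
      open Fits fits
      r = substitute P (P ∪ ⁅ k ⁆)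
      dh : ∀ {Q Q′} → Q ∈ₗ Ps → Q′ ∈ₗ Ps → DisjointHulls c Q Q′ → DisjointHulls c (r Q) (r Q′)
      dh {Q} {Q′} Q∈ Q′∈ d with Q ≟ˢ P | Q′ ≟ˢ P
      ... | yes refl | yes refl = contradiction lower∈ (DisjointHulls-disjoint d lower∈)
      ... | yes refl | no Q′≢P = disjoint Q′∈ Q′≢P
      ... | no Q≢P | yes refl = DisjointHulls-sym (disjoint Q∈ Q≢P)
      ... | no _ | no _ = d

    Admits⇒Fits : ∀ {P} → P ∈ₗ Ps → Admits c Ps k P → Fits Ps k P
    Admits⇒Fits {P} P∈ (nested , nc′) = record { spanned = Nested⇒Spans nested ; disjoint = dh }
      where
      dh : ∀ {Q} → Q ∈ₗ Ps → Q ≢ P → DisjointHulls c (P ∪ ⁅ k ⁆) Q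
      dh {Q} Q∈ Q≢P = subst₂ (DisjointHulls c) (substitute-≡ P (P ∪ ⁅ k ⁆)) (substitute-≢ Q≢P)
        (pick (AllPairs-∈ (AllPairs.map⁻ nc′) P∈ Q∈))
        where
        pick : P ≡ Q ⊎ DisjointHulls c (substitute P (P ∪ ⁅ k ⁆) P) (substitute P (P ∪ ⁅ k ⁆) Q)
                     ⊎ DisjointHulls c (substitute P (P ∪ ⁅ k ⁆) Q) (substitute P (P ∪ ⁅ k ⁆) P) →
               DisjointHulls c (substitute P (P ∪ ⁅ k ⁆) P) (substitute P (P ∪ ⁅ k ⁆) Q)
        pick (inj₁ eq) = contradiction (sym eq) Q≢P
        pick (inj₂ (inj₁ d)) = d
        pick (inj₂ (inj₂ d)) = DisjointHulls-sym d

    module _ (k∈L : k ∈ L c) where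
      -- Seen from `k` on the left, vertices below `k` come before those above. The chord from `k`
      -- to the nearer of the two upper vertices therefore crosses the chord between the lower and
      -- the upper vertex of the other polygon.
      Fits-unique : ∀ {P Q} → P ∈ₗ Ps → Q ∈ₗ Ps → Fits Ps k P → Fits Ps k Q → P ≡ Q
      Fits-unique {P} {Q} P∈ Q∈ fP fQ = decidable-stable (P ≟ˢ Q)
        λ P≢Q → clash (FP.disjoint Q∈ (P≢Q ∘ sym)) (FQ.disjoint P∈ P≢Q)
        where
        module FP = Fits fP
        module FQ = Fits fQ
        clash : DisjointHulls c (P ∪ ⁅ k ⁆) Q → DisjointHulls c (Q ∪ ⁅ k ⁆) P → ⊥
        clash dPQ dQP with C-total {k} {FP.upper} {FQ.upper} (λ eq → FP.k∉ (subst (_∈ P) (sym eq) FP.upper∈))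
               (λ eq → DisjointHulls-disjoint dPQ (adjoin⁺ FP.upper∈) (subst (_∈ Q) (sym eq) FQ.upper∈))
               (λ eq → FQ.k∉ (subst (_∈ Q) (sym eq) FQ.upper∈))
        ... | inj₁ kbb′ = DisjointHulls-noncrossing dPQ new∈ (adjoin⁺ FP.upper∈) FQ.lower∈ FQ.upper∈
                (left k∈L FQ.lower< FP.<upper) (C-rot kbb′)
        ... | inj₂ kb′b = DisjointHulls-noncrossing dQP new∈ (adjoin⁺ FQ.upper∈) FP.lower∈ FP.upper∈
                (left k∈L FP.lower< FQ.<upper) (C-rot kb′b)

      module _ (k∉Ps : ∀ {P} → P ∈ₗ Ps → k ∉ P) where
        private
          Open : Fin (suc n) → Set
          Open z = Any (λ P → Nested P k × z ∈ P) Ps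

        -- A polygon `Q` crossing a chord from `k` to `P` would have a vertex beyond `z`, the last
        -- candidate. The positions of its two vertices relative to the level of `k` are excluded
        -- one by one.
        Fits-last : ∀ {P z} → P ∈ₗ Ps → Spans P k → z ∈ P → (∀ {z′} → Open z′ → ¬ C k z z′) → Fits Ps k P
        Fits-last {P} {z} P∈ sp z∈ last = record { spanned = sp ; disjoint = disjoint }
          where
          open Spans sp
          open-P : ∀ {i} → i ∈ P → Open i
          open-P i∈ = lose P∈ (Spans⇒Nested sp , i∈)
          ∈P⇒≢k : ∀ {i} → i ∈ P → k ≢ i
          ∈P⇒≢k i∈ refl = k∉ i∈
          module _ {Q : Subset (suc n)} (Q∈ : Q ∈ₗ Ps) (dh : DisjointHulls c P Q) where
            ∈Q⇒≢k : ∀ {i} → i ∈ Q → k ≢ i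
            ∈Q⇒≢k i∈ refl = k∉Ps Q∈ i∈
            -- If `q′` came between `p` and `z`, the chord from `q` to `q′` would cross the one from
            -- `p` to `z`.
            beyond-z : ∀ {p q q′} → p ∈ P → q ∈ Q → q′ ∈ Q → C k q p → C k p q′ → C k z q′
            beyond-z {p} {q} {q′} p∈ q∈ q′∈ kqp kpq′ with C-compare (∈P⇒≢k p∈) (∈P⇒≢k z∈) (last (open-P p∈))
            ... | inj₁ refl = kpq′
            ... | inj₂ kpz with C-total (∈P⇒≢k z∈)
                                  (λ eq → DisjointHulls-disjoint dh z∈ (subst (_∈ Q) (sym eq) q′∈)) (∈Q⇒≢k q′∈)
            ... | inj₁ kzq′ = kzq′
            ... | inj₂ kq′z = contradiction (C-rot² (C-drop kqp kpz))
                    (DisjointHulls-noncrossing dh p∈ z∈ q′∈ q∈ (C-drop kpq′ kq′z))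
            no-crossing : ∀ {p q q′} → p ∈ P → q ∈ Q → q′ ∈ Q → C k q p → ¬ C k p q′
            no-crossing {p} {q} {q′} p∈ q∈ q′∈ kqp kpq′
              with kzq′ ← beyond-z p∈ q∈ q′∈ kqp kpq′ | Fin.<-cmp q k | Fin.<-cmp q′ k
            ... | tri≈ _ eq _ | _ = ∈Q⇒≢k q∈ (sym eq)
            ... | _ | tri≈ _ eq _ = ∈Q⇒≢k q′∈ (sym eq)
            -- `Q` spans `k` itself, so that `q′` competes with `z`.
            ... | tri< q<k _ _ | tri> _ _ k<q′ =
              last (lose Q∈ (Spans⇒Nested (spans (k∉Ps Q∈) q∈ q<k q′∈ k<q′) , q′∈)) kzq′
            ... | tri> _ _ k<q | tri< q′<k _ _ = C-asym (C-trans kqp kpq′) (left k∈L q′<k k<q)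
            -- The upper vertex of `P` comes after `q′` and hence after `z`.
            ... | tri< _ _ _ | tri< q′<k _ _ = last (open-P upper∈) (C-trans kzq′ (left k∈L q′<k <upper))
            -- The lower vertex of `P` comes before `q`, so that `P` crosses `Q` even without `k`.
            ... | tri> _ _ k<q | tri> _ _ _ with kaq ← left k∈L lower< k<q =
              DisjointHulls-noncrossing dh lower∈ p∈ q∈ q′∈ (C-drop kaq kqp) (C-rot (C-drop (C-trans kaq kqp) kpq′))
          disjoint : ∀ {Q} → Q ∈ₗ Ps → Q ≢ P → DisjointHulls c (P ∪ ⁅ k ⁆) Q
          disjoint {Q} Q∈ Q≢P with Noncrossing-∈ nc P∈ Q∈
          ... | inj₁ eq = contradiction (sym eq) Q≢P
          ... | inj₂ dh = disjointHulls apart crossing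
            where
            apart : ∀ {i} → i ∈ P ∪ ⁅ k ⁆ → i ∉ Q
            apart i∈ i∈Q with adjoin⁻ i∈
            ... | inj₁ i∈P = DisjointHulls-disjoint dh i∈P i∈Q
            ... | inj₂ refl = k∉Ps Q∈ i∈Q
            crossing : ∀ {p p′ q q′} → p ∈ P ∪ ⁅ k ⁆ → p′ ∈ P ∪ ⁅ k ⁆ → q ∈ Q → q′ ∈ Q → C p q p′ → ¬ C p′ q′ p
            crossing p∈ p′∈ q∈ q′∈ pqp′ p′q′p with adjoin⁻ p∈ | adjoin⁻ p′∈
            ... | inj₁ p∈P | inj₁ p′∈P = DisjointHulls-noncrossing dh p∈P p′∈P q∈ q′∈ pqp′ p′q′p
            ... | inj₁ p∈P | inj₂ refl = no-crossing Q∈ dh p∈P q′∈ q∈ p′q′p (C-rot² pqp′)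
            ... | inj₂ refl | inj₁ p′∈P = no-crossing Q∈ dh p′∈P q∈ q′∈ pqp′ (C-rot² p′q′p)
            ... | inj₂ refl | inj₂ refl = C⇒≢₁₃ pqp′ refl

        -- Of the vertices of the polygons spanning k, the last one clockwise from
        -- k lies on the polygon that the horizontal line through k meets first.
        Fits-exists : ∀ {P} → P ∈ₗ Ps → Spans P k → ∃[ P ] P ∈ₗ Ps × Fits Ps k P
        Fits-exists {P} P∈ sp =
          let z , open-z , last = maximum {_⋖_ = C k} {S = Open} (C? k) C-trans (λ { refl cy → C⇒≢₂₃ cy refl })
                (λ z → Any.any? (λ P → nested? P k ×-dec (z ∈? P)) Ps)
                (lose P∈ (Spans⇒Nested sp , Spans.upper∈ sp))
              P₀ , P₀∈ , nested , z∈ = find open-z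
          in P₀ , P₀∈ , Fits-last P₀∈ (Nested⇒Spans nested) z∈ last

        module _ {P₀ : Subset (suc n)} (P₀∈ : P₀ ∈ₗ Ps) (fits : Fits Ps k P₀) where
          private
            grow : Subset (suc n) → Subset (suc n)
            grow P = if does (admits? c Ps k P) then P ∪ ⁅ k ⁆ else P
            same : ∀ {Q} → Q ∈ₗ Ps → Dec (Q ≡ P₀) → grow Q ≡ substitute P₀ (P₀ ∪ ⁅ k ⁆) Q
            same {Q} Q∈ Q≟P₀ = [ admitted Q≟P₀ , refused Q≟P₀ ]′ (if-dec (admits? c Ps k Q) (Q ∪ ⁅ k ⁆) Q)
              where
              admitted : Dec (Q ≡ P₀) → Admits c Ps k Q × grow Q ≡ Q ∪ ⁅ k ⁆ → grow Q ≡ substitute P₀ (P₀ ∪ ⁅ k ⁆) Q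
              admitted _ (adm , eq) with refl ← Fits-unique Q∈ P₀∈ (Admits⇒Fits Q∈ adm) fits =
                trans eq (sym (substitute-≡ Q (Q ∪ ⁅ k ⁆)))
              refused : Dec (Q ≡ P₀) → ¬ Admits c Ps k Q × grow Q ≡ Q → grow Q ≡ substitute P₀ (P₀ ∪ ⁅ k ⁆) Q
              refused (yes refl) (¬adm , _) = contradiction (Fits⇒Admits fits) ¬adm
              refused (no Q≢P₀) (_ , eq) = trans eq (sym (substitute-≢ Q≢P₀))
            -- `addVertex` enlarges every admitting polygon; by uniqueness this is `P₀` alone.
            add≡ : addVertex c Ps k ≡ replace P₀ (P₀ ∪ ⁅ k ⁆) Ps
            add≡ = List.map-cong-local (All.tabulate λ {Q} Q∈ → same Q∈ (Q ≟ˢ P₀))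
            extended : ∀ {P} → Extends (_≡ k) P (grow P)
            extended {P} = [ admitted , (λ (_ , eq) → subst (Extends (_≡ k) P) (sym eq) Extends-refl) ]′
                             (if-dec (admits? c Ps k P) (P ∪ ⁅ k ⁆) P)
              where
              new : Spans P k → ∀ {i} → i ∈ P ∪ ⁅ k ⁆ → i ∈ P ⊎ (i ≡ k × Spans P i)
              new sp i∈ with adjoin⁻ i∈
              ... | inj₁ i∈P = inj₁ i∈P
              ... | inj₂ refl = inj₂ (refl , sp)
              admitted : Admits c Ps k P × grow P ≡ P ∪ ⁅ k ⁆ → Extends (_≡ k) P (grow P)
              admitted ((nested , _) , eq) = subst (Extends (_≡ k) P) (sym eq)
                (record { grows = adjoin⁺ ; origin = new (Nested⇒Spans nested) })

          addVertex-noncrossing : Noncrossing c (addVertex c Ps k)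
          addVertex-noncrossing = subst (Noncrossing c) (sym add≡) (proj₂ (Fits⇒Admits fits))

          addVertex-extends : Pointwise (Extends (_≡ k)) Ps (addVertex c Ps k)
          addVertex-extends = Pointwise-map (λ _ → extended)

          addVertex-∈ : P₀ ∪ ⁅ k ⁆ ∈ₗ addVertex c Ps k
          addVertex-∈ = subst (P₀ ∪ ⁅ k ⁆ ∈ₗ_) (sym add≡)
            (subst (_∈ₗ replace P₀ (P₀ ∪ ⁅ k ⁆) Ps) (substitute-≡ P₀ (P₀ ∪ ⁅ k ⁆))
              (∈-map⁺ (substitute P₀ (P₀ ∪ ⁅ k ⁆)) P₀∈))

  Spans-grows : ∀ {K P P′ k} → Extends K P P′ → k ∉ P′ → Spans P k → Spans P′ k
  Spans-grows ext k∉ (spans _ a∈ a<k b∈ k<b) = spans k∉ (grows ext a∈) a<k (grows ext b∈) k<b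

  -- An added vertex serving as a witness can be replaced by an old vertex further out, since it is
  -- itself spanned by `P`.
  Spans-origin : ∀ {K P P′ k} → Extends K P P′ → Spans P′ k → Spans P k
  Spans-origin {P = P} {k = k} ext (spans k∉ a∈ a<k b∈ k<b) =
    let a′ , a′∈ , a′≤a = lowered (origin ext a∈)
        b′ , b′∈ , b≤b′ = raised (origin ext b∈)
    in spans (k∉ ∘ grows ext) a′∈ (ℕ.≤-<-trans a′≤a a<k) b′∈ (ℕ.<-≤-trans k<b b≤b′)
    where
    lowered : ∀ {K a} → a ∈ P ⊎ (K × Spans P a) → ∃[ a′ ] a′ ∈ P × toℕ a′ ≤ toℕ a
    lowered (inj₁ a∈) = -, a∈ , ℕ.≤-refl
    lowered (inj₂ (_ , sp)) = -, Spans.lower∈ sp , ℕ.<⇒≤ (Spans.lower< sp)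
    raised : ∀ {K b} → b ∈ P ⊎ (K × Spans P b) → ∃[ b′ ] b′ ∈ P × toℕ b ≤ toℕ b′
    raised (inj₁ b∈) = -, b∈ , ℕ.≤-refl
    raised (inj₂ (_ , sp)) = -, Spans.upper∈ sp , ℕ.<⇒≤ (Spans.<upper sp)

  Extends-trans : ∀ {K K′ K″ : Fin (suc n) → Set} {P P′ P″} → (∀ {i} → K i → K″ i) → (∀ {i} → K′ i → K″ i) →
                  Extends K P P′ → Extends K′ P′ P″ → Extends K″ P P″
  Extends-trans {K″ = K″} {P} {P″ = P″} K⊆ K′⊆ e e′ = record { grows = grows e′ ∘ grows e ; origin = from }
    where
    from : ∀ {i} → i ∈ P″ → i ∈ P ⊎ (K″ i × Spans P i)
    from i∈ with origin e′ i∈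
    ... | inj₂ (k , sp) = inj₂ (K′⊆ k , Spans-origin e sp)
    ... | inj₁ i∈′ with origin e i∈′
    ... | inj₁ i∈P = inj₁ i∈P
    ... | inj₂ (k , sp) = inj₂ (K⊆ k , sp)

  private
    Addable : List (Subset (suc n)) → Fin (suc n) → Set
    Addable Ps k = k ∈ L c × (∀ {P} → P ∈ₗ Ps → k ∉ P) × ∃[ P ] P ∈ₗ Ps × Spans P k

    Addable-step : ∀ {Ps Ps′ k l} → l ≢ k → Pointwise (Extends (_≡ k)) Ps Ps′ → Addable Ps l → Addable Ps′ l
    Addable-step {Ps} {Ps′} {k} {l} l≢k ext (l∈L , l∉ , P , P∈ , sp)
      with P′ , P′∈ , e ← Pointwise-∈ˡ ext P∈ = l∈L , l∉′ , P′ , P′∈ , Spans-grows e (l∉′ P′∈) sp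
      where
      l∉′ : ∀ {Q} → Q ∈ₗ Ps′ → l ∉ Q
      l∉′ Q∈ l∈ with P , P∈ , e ← Pointwise-∈ʳ ext Q∈ with origin e l∈
      ... | inj₁ l∈P = l∉ P∈ l∈P
      ... | inj₂ (l≡k , _) = l≢k l≡k

  addVertices : ∀ ks {Ps} → Noncrossing c Ps → Unique ks → (∀ {k} → k ∈ₗ ks → Addable Ps k) →
    Noncrossing c (foldl (addVertex c) Ps ks)
    × Pointwise (Extends (_∈ₗ ks)) Ps (foldl (addVertex c) Ps ks)
    × (∀ {k} → k ∈ₗ ks → ∃[ P ] P ∈ₗ foldl (addVertex c) Ps ks × k ∈ P)
  addVertices [] nc _ _ = nc , Pointwise.refl Extends-refl , λ ()
  addVertices (k ∷ ks) {Ps} nc (k≢ ∷ u) addable =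
    let nc₂ , ext₂ , cover = rest
    in nc₂ , Pointwise.transitive (Extends-trans (λ { refl → here refl }) there) ext ext₂ , covered ext₂ cover
    where
    Qs : List (Subset (suc n))
    Qs = foldl (addVertex c) (addVertex c Ps k) ks
    k∈L : k ∈ L c
    k∈L = proj₁ (addable (here refl))
    k∉ : ∀ {P} → P ∈ₗ Ps → k ∉ P
    k∉ = proj₁ (proj₂ (addable (here refl)))
    fitting : ∃[ P ] P ∈ₗ Ps × Fits Ps k P
    fitting = let P , P∈ , sp = proj₂ (proj₂ (addable (here refl))) in Fits-exists nc k∈L k∉ P∈ sp
    P₀∈ = proj₁ (proj₂ fitting)
    fits = proj₂ (proj₂ fitting)
    ext : Pointwise (Extends (_≡ k)) Ps (addVertex c Ps k)
    ext = addVertex-extends nc k∈L k∉ P₀∈ fits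
    rest = addVertices ks (addVertex-noncrossing nc k∈L k∉ P₀∈ fits) u
             (λ l∈ → Addable-step (λ l≡k → All.lookup k≢ l∈ (sym l≡k)) ext (addable (there l∈)))
    covered : Pointwise (Extends (_∈ₗ ks)) (addVertex c Ps k) Qs →
              (∀ {l} → l ∈ₗ ks → ∃[ P ] P ∈ₗ Qs × l ∈ P) →
              ∀ {l} → l ∈ₗ k ∷ ks → ∃[ P ] P ∈ₗ Qs × l ∈ P
    covered ext₂ cover (there l∈) = cover l∈
    covered ext₂ cover (here refl) =
      let P , P∈ , e = Pointwise-∈ˡ ext₂ (addVertex-∈ nc k∈L k∉ P₀∈ fits) in P , P∈ , grows e new∈

Pointwise-mapʳ : {R : A → B → Set} {S : A → B → Set} {f : B → B} {xs : List A} {ys : List B} →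
                 (∀ {a b} → R a b → S a (f b)) → Pointwise R xs ys → Pointwise S xs (List.map f ys)
Pointwise-mapʳ g [] = []
Pointwise-mapʳ g (r ∷ rs) = g r ∷ Pointwise-mapʳ g rs

-- Used for `D` and `U` in both orders, whose differences are the initial and the terminal indices.
exchange-─ : {S T M N : Subset n} → M ⊆ T → (∀ {i} → i ∈ N → i ∉ S) → ((S ─ M) ∪ N) ─ ((T ─ M) ∪ N) ≡ S ─ T
exchange-─ {S = S} {T} {M} {N} M⊆T N∉S = ⊆-antisym ⊆₁ ⊆₂
  where
  ⊆₁ : ((S ─ M) ∪ N) ─ ((T ─ M) ∪ N) ⊆ S ─ T
  ⊆₁ {i} i∈ with i∉ ← ∉─ ((S ─ M) ∪ N) ((T ─ M) ∪ N) i∈ | x∈p∪q⁻ (S ─ M) N (p─q⊆p _ ((T ─ M) ∪ N) i∈)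
  ... | inj₂ i∈N = contradiction (x∈p∪q⁺ (inj₂ i∈N)) i∉
  ... | inj₁ i∈S─M = x∈p∧x∉q⇒x∈p─q (p─q⊆p S M i∈S─M)
    λ i∈T → i∉ (x∈p∪q⁺ (inj₁ (x∈p∧x∉q⇒x∈p─q i∈T (∉─ S M i∈S─M))))
  ⊆₂ : S ─ T ⊆ ((S ─ M) ∪ N) ─ ((T ─ M) ∪ N)
  ⊆₂ {i} i∈ = x∈p∧x∉q⇒x∈p─q (x∈p∪q⁺ (inj₁ (x∈p∧x∉q⇒x∈p─q i∈S (i∉T ∘ M⊆T))))
    λ i∈′ → [ i∉T ∘ p─q⊆p T M , (λ i∈N → N∉S i∈N i∈S) ]′ (x∈p∪q⁻ (T ─ M) N i∈′)
    where
    i∈S = p─q⊆p S T i∈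
    i∉T = ∉─ S T i∈

exchange-back : {S M N : Subset n} → M ⊆ S → (∀ {i} → i ∈ S → i ∉ N) → (((S ─ M) ∪ N) ─ N) ∪ M ≡ S
exchange-back {S = S} {M} {N} M⊆S S∉N = ⊆-antisym ⊆₁ ⊆₂
  where
  ⊆₁ : (((S ─ M) ∪ N) ─ N) ∪ M ⊆ S
  ⊆₁ i∈ with x∈p∪q⁻ (((S ─ M) ∪ N) ─ N) M i∈
  ... | inj₂ i∈M = M⊆S i∈M
  ... | inj₁ i∈′ with x∈p∪q⁻ (S ─ M) N (p─q⊆p _ N i∈′)
  ... | inj₁ i∈S─M = p─q⊆p S M i∈S─M
  ... | inj₂ i∈N = contradiction i∈N (∉─ ((S ─ M) ∪ N) N i∈′)
  ⊆₂ : S ⊆ (((S ─ M) ∪ N) ─ N) ∪ M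
  ⊆₂ {i} i∈ with i ∈? M
  ... | yes i∈M = x∈p∪q⁺ (inj₂ i∈M)
  ... | no i∉M = x∈p∪q⁺ (inj₁ (x∈p∧x∉q⇒x∈p─q (x∈p∪q⁺ (inj₁ (x∈p∧x∉q⇒x∈p─q i∈ i∉M))) (S∉N i∈)))

exchange-twice : {S S′ S″ M M′ N N′ : Subset n} → S′ ≡ (S ─ M) ∪ N → S″ ≡ (S′ ─ M′) ∪ N′ → M′ ≡ N → N′ ≡ M →
                 M ⊆ S → (∀ {i} → i ∈ S → i ∉ N) → S″ ≡ S
exchange-twice refl refl refl refl = exchange-back

-- The involution

module _ {c x : Permutation′ (suc n)} where
  ∈M⁺ : ∀ {i} → i ∈ D x → i ∈ U x → i ∈ L c → i ∈ M c x
  ∈M⁺ i∈D i∈U i∈L = x∈p∩q⁺ (i∈D , x∈p∩q⁺ (i∈U , i∈L))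

  ∈M⁻ : ∀ {i} → i ∈ M c x → i ∈ D x × i ∈ U x × i ∈ L c
  ∈M⁻ i∈ = let i∈D , i∈UL = x∈p∩q⁻ (D x) (U x ∩ L c) i∈ in i∈D , x∈p∩q⁻ (U x) (L c) i∈UL

  private
    inN? : Decidable (λ k → k ∈ L c ─ supp x × Any (λ P → Nested P k) (Pol x))
    inN? k = (k ∈? L c ─ supp x) ×-dec Any.any? (λ P → nested? P k) (Pol x)

  ∈N⁺ : ∀ {P k} → k ∈ L c → k ∉ supp x → P ∈ₗ Pol x → Spans P k → k ∈ N c x
  ∈N⁺ k∈L k∉ P∈ sp = ∈⟦⟧⁺ inN? (x∈p∧x∉q⇒x∈p─q k∈L k∉ , lose P∈ (Spans⇒Nested sp))

  ∈N⁻ : ∀ {k} → k ∈ N c x → k ∈ L c × k ∉ supp x × ∃[ P ] P ∈ₗ Pol x × Spans P k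
  ∈N⁻ {k} k∈ =
    let k∈L─ , any = ∈⟦⟧⁻ inN? k∈
        P , P∈ , nested = find any
    in p─q⊆p (L c) (supp x) k∈L─ , ∉─ (L c) (supp x) k∈L─ , P , P∈ , Nested⇒Spans nested

-- The effect on polygons and on the sets D, U, M and N

module Modification {c : Permutation′ (suc n)} (layout : Layout c)
  {x : Permutation′ (suc n)} (gx : Layout.Gap layout x) where
  open Layout layout
  open Diagrams layout
  open Insertion layout

  -- All that matters about the polygon `Q` made from `P`; the order of the insertions is forgotten.
  record Modified (P Q : Subset (suc n)) : Set where
    field
      kept : ∀ {i} → i ∈ P → i ∉ M c x → i ∈ Q
      ∉M : ∀ {i} → i ∈ Q → i ∉ M c x
      source : ∀ {i} → i ∈ Q → i ∈ P ⊎ (i ∈ N c x × Spans P i)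

  open Modified public

  record Hull (P Q : Subset (suc n)) : Set where
    field
      {lo hi} : Fin (suc n)
      lo∈P : lo ∈ P
      hi∈P : hi ∈ P
      lo∈Q : lo ∈ Q
      hi∈Q : hi ∈ Q
      lo≤P : ∀ {i} → i ∈ P → toℕ lo ≤ toℕ i
      P≤hi : ∀ {i} → i ∈ P → toℕ i ≤ toℕ hi
      lo≤Q : ∀ {i} → i ∈ Q → toℕ lo ≤ toℕ i
      Q≤hi : ∀ {i} → i ∈ Q → toℕ i ≤ toℕ hi
      lo<hi : toℕ lo < toℕ hi

  -- The minimum and the maximum of P lie outside of M, so that they survive in Q.
  hull : ∀ {P Q} → P ∈ₗ Pol x → Modified P Q → Hull P Q
  hull {P} {Q} P∈ mod =
    let i , j , i∈ , j∈ , i≢j = IsPolygon-Pol gx P∈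
        a , a∈ , min = minimum i∈
        b , b∈ , max = greatest i∈
    in record
      { lo∈P = a∈ ; hi∈P = b∈
      ; lo∈Q = kept mod a∈ (min∉M a∈ min) ; hi∈Q = kept mod b∈ (max∉M b∈ max)
      ; lo≤P = min _ ; P≤hi = max _
      ; lo≤Q = λ k∈ → [ min _ , (λ (_ , sp) → ℕ.<⇒≤ (ℕ.≤-<-trans (min _ (Spans.lower∈ sp)) (Spans.lower< sp))) ]′ (source mod k∈)
      ; Q≤hi = λ k∈ → [ max _ , (λ (_ , sp) → ℕ.<⇒≤ (ℕ.<-≤-trans (Spans.<upper sp) (max _ (Spans.upper∈ sp)))) ]′ (source mod k∈)
      ; lo<hi = ℕ.≰⇒> λ b≤a → i≢j (Fin.toℕ-injective (ℕ.≤-antisym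
          (ℕ.≤-trans (max i i∈) (ℕ.≤-trans b≤a (min j j∈))) (ℕ.≤-trans (max j j∈) (ℕ.≤-trans b≤a (min i i∈))))) }
    where
    min∉M : ∀ {a} → a ∈ P → (∀ j → j ∈ P → a Fin.≤ j) → a ∉ M c x
    min∉M a∈ min a∈M =
      let j , j∈ , j<a = ∈U⁻ {x = x} (proj₁ (proj₂ (∈M⁻ {c = c} {x} a∈M)))
      in ℕ.<⇒≱ j<a (min j (subst (j ∈_) (sym (Pol-orbit x P∈ a∈)) j∈))
    max∉M : ∀ {b} → b ∈ P → (∀ j → j ∈ P → j Fin.≤ b) → b ∉ M c x
    max∉M b∈ max b∈M =
      let j , j∈ , b<j = ∈D⁻ {x = x} (proj₁ (∈M⁻ {c = c} {x} b∈M))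
      in ℕ.<⇒≱ b<j (max j (subst (j ∈_) (sym (Pol-orbit x P∈ b∈)) j∈))

  module _ {Qs : List (Subset (suc n))} (nc : Noncrossing c Qs) (mods : Pointwise Modified (Pol x) Qs)
    (cover : ∀ {k} → k ∈ N c x → ∃[ Q ] Q ∈ₗ Qs × k ∈ Q) where
    private
      y : Permutation′ (suc n)
      y = fromPol c Qs

      ∈orbit-y : ∀ {Q i j} → Q ∈ₗ Qs → i ∈ Q → j ∈ Q → j ∈ orbit y i
      ∈orbit-y {j = j} Q∈ i∈ j∈ = subst (j ∈_) (sym (fromPol-orbit nc Q∈ i∈)) j∈

      -- Vertices of `y`, surviving vertices of `x` and new vertices all give such a pair, and its
      -- extremes are shared by `P` and `Q`.
      record Pair (i : Fin (suc n)) : Set where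
        field
          {P Q} : Subset (suc n)
          P∈ : P ∈ₗ Pol x
          Q∈ : Q ∈ₗ Qs
          mod : Modified P Q
          i∈Q : i ∈ Q
        open Hull (hull P∈ mod) public

      pair-y : ∀ {i} → i ∈ supp y → Pair i
      pair-y {i} i∈ =
        let Q∈ = Pol-fromPol⁻ nc (∈Pol⁺ y i∈)
            P , P∈ , mod = Pointwise-∈ʳ mods Q∈
        in record { P∈ = P∈ ; Q∈ = Q∈ ; mod = mod ; i∈Q = orbit-refl y }

      pair-kept : ∀ {i} → i ∈ supp x → i ∉ M c x → Pair i
      pair-kept {i} i∈ i∉M =
        let P∈ = ∈Pol⁺ x i∈
            Q , Q∈ , mod = Pointwise-∈ˡ mods P∈
        in record { P∈ = P∈ ; Q∈ = Q∈ ; mod = mod ; i∈Q = kept mod (orbit-refl x) i∉M }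

      N⇒∉supp : ∀ {i} → i ∈ N c x → i ∉ supp x
      N⇒∉supp i∈ = proj₁ (proj₂ (∈N⁻ {c = c} {x} i∈))

      M⇒∈supp : ∀ {i} → i ∈ M c x → i ∈ supp x
      M⇒∈supp i∈ = D⊆supp {x = x} (proj₁ (∈M⁻ {c = c} {x} i∈))

      pair-new : ∀ {i} → i ∈ N c x → ∃[ p ] Spans (Pair.P {i} p) i
      pair-new {i} i∈N =
        let Q , Q∈ , i∈Q = cover i∈N
            P , P∈ , mod = Pointwise-∈ʳ mods Q∈
        in record { P∈ = P∈ ; Q∈ = Q∈ ; mod = mod ; i∈Q = i∈Q } ,
           [ (λ i∈P → contradiction (Pol⊆supp x P∈ i∈P) (N⇒∉supp i∈N)) , proj₂ ]′ (source mod i∈Q)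

      pair-supp : ∀ {i} → Pair i → i ∈ supp y
      pair-supp {i} p = ∈supp⁺ y λ fix →
        let lo≡ = fixed-orbit y fix (∈orbit-y Q∈ i∈Q lo∈Q)
            hi≡ = fixed-orbit y fix (∈orbit-y Q∈ i∈Q hi∈Q)
        in ℕ.<-irrefl (cong toℕ (trans lo≡ (sym hi≡))) lo<hi
        where open Pair p

    -- `P` and `Q` have the same maximum `hi`, so a common vertex lies below it in both or in
    -- neither; a new vertex lies strictly below it.
    D-modified : D y ≡ (D x ─ M c x) ∪ N c x
    D-modified = ⊆-antisym ⊆₁ ⊆₂
      where
      ⊆₁ : D y ⊆ (D x ─ M c x) ∪ N c x
      ⊆₁ {i} i∈ = x∈p∪q⁺ ([ inj₁ ∘ old , inj₂ ∘ proj₁ ]′ (source mod i∈Q))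
        where
        open Pair (pair-y (D⊆supp {x = y} i∈))
        old : i ∈ P → i ∈ D x ─ M c x
        old i∈P =
          let j , j∈ , i<j = ∈D⁻ {x = y} i∈
              j∈Q = subst (j ∈_) (fromPol-orbit nc Q∈ i∈Q) j∈
          in x∈p∧x∉q⇒x∈p─q
               (∈D⁺ {x = x} (subst (hi ∈_) (Pol-orbit x P∈ i∈P) hi∈P) (ℕ.<-≤-trans i<j (Q≤hi j∈Q))) (∉M mod i∈Q)
      ⊆₂ : (D x ─ M c x) ∪ N c x ⊆ D y
      ⊆₂ {i} i∈ = [ old , new ]′ (x∈p∪q⁻ (D x ─ M c x) (N c x) i∈)
        where
        old : i ∈ D x ─ M c x → i ∈ D y
        old i∈D─M =
          let i∈D = p─q⊆p (D x) (M c x) i∈D─M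
              i∉M = ∉─ (D x) (M c x) i∈D─M
              j , j∈ , i<j = ∈D⁻ {x = x} i∈D
              open Pair (pair-kept (D⊆supp {x = x} i∈D) i∉M)
          in ∈D⁺ {x = y} (∈orbit-y Q∈ i∈Q hi∈Q) (ℕ.<-≤-trans i<j (P≤hi j∈))
        new : i ∈ N c x → i ∈ D y
        new i∈N =
          let p , sp = pair-new i∈N
              open Pair p
          in ∈D⁺ {x = y} (∈orbit-y Q∈ i∈Q hi∈Q) (ℕ.<-≤-trans (Spans.<upper sp) (P≤hi (Spans.upper∈ sp)))

    U-modified : U y ≡ (U x ─ M c x) ∪ N c x
    U-modified = ⊆-antisym ⊆₁ ⊆₂
      where
      ⊆₁ : U y ⊆ (U x ─ M c x) ∪ N c x
      ⊆₁ {i} i∈ = x∈p∪q⁺ ([ inj₁ ∘ old , inj₂ ∘ proj₁ ]′ (source mod i∈Q))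
        where
        open Pair (pair-y (U⊆supp {x = y} i∈))
        old : i ∈ P → i ∈ U x ─ M c x
        old i∈P =
          let j , j∈ , j<i = ∈U⁻ {x = y} i∈
              j∈Q = subst (j ∈_) (fromPol-orbit nc Q∈ i∈Q) j∈
          in x∈p∧x∉q⇒x∈p─q
               (∈U⁺ {x = x} (subst (lo ∈_) (Pol-orbit x P∈ i∈P) lo∈P) (ℕ.≤-<-trans (lo≤Q j∈Q) j<i)) (∉M mod i∈Q)
      ⊆₂ : (U x ─ M c x) ∪ N c x ⊆ U y
      ⊆₂ {i} i∈ = [ old , new ]′ (x∈p∪q⁻ (U x ─ M c x) (N c x) i∈)
        where
        old : i ∈ U x ─ M c x → i ∈ U y
        old i∈U─M =
          let i∈U = p─q⊆p (U x) (M c x) i∈U─M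
              i∉M = ∉─ (U x) (M c x) i∈U─M
              j , j∈ , j<i = ∈U⁻ {x = x} i∈U
              open Pair (pair-kept (U⊆supp {x = x} i∈U) i∉M)
          in ∈U⁺ {x = y} (∈orbit-y Q∈ i∈Q lo∈Q) (ℕ.≤-<-trans (lo≤P j∈) j<i)
        new : i ∈ N c x → i ∈ U y
        new i∈N =
          let p , sp = pair-new i∈N
              open Pair p
          in ∈U⁺ {x = y} (∈orbit-y Q∈ i∈Q lo∈Q) (ℕ.≤-<-trans (lo≤P (Spans.lower∈ sp)) (Spans.lower< sp))

    -- A label of `M c y` that came from both `D x` and `U x` would have been in `M c x`, and so
    -- removed.
    M-modified : M c y ≡ N c x
    M-modified = ⊆-antisym ⊆₁ ⊆₂
      where
      ⊆₁ : M c y ⊆ N c x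
      ⊆₁ {i} i∈ =
        let i∈D , i∈U , i∈L = ∈M⁻ {c = c} {y} i∈
        in [ (λ i∈D─M → [ (λ i∈U─M → contradiction
                               (∈M⁺ {c = c} {x} (p─q⊆p (D x) (M c x) i∈D─M) (p─q⊆p (U x) (M c x) i∈U─M) i∈L)
                               (∉─ (D x) (M c x) i∈D─M))
                         , (λ i∈N → i∈N) ]′ (x∈p∪q⁻ (U x ─ M c x) (N c x) (subst (i ∈_) U-modified i∈U)))
           , (λ i∈N → i∈N) ]′ (x∈p∪q⁻ (D x ─ M c x) (N c x) (subst (i ∈_) D-modified i∈D))
      ⊆₂ : N c x ⊆ M c y
      ⊆₂ {i} i∈ = ∈M⁺ {c = c} {y} (subst (i ∈_) (sym D-modified) (x∈p∪q⁺ (inj₂ i∈)))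
                    (subst (i ∈_) (sym U-modified) (x∈p∪q⁺ (inj₂ i∈))) (proj₁ (∈N⁻ {c = c} {x} i∈))

    Qs-polygons : ∀ {Q} → Q ∈ₗ Qs → IsPolygon Q
    Qs-polygons Q∈ =
      let P , P∈ , mod = Pointwise-∈ʳ mods Q∈
          open Hull (hull P∈ mod)
      in lo , hi , lo∈Q , hi∈Q , λ eq → ℕ.<-irrefl (cong toℕ eq) lo<hi

    -- A removed vertex lies strictly between the extremes of its polygon, which survive, so it
    -- becomes nested. Conversely, every label nested in `x` and lying in `L c` has become a vertex.
    N-modified : N c y ≡ M c x
    N-modified = ⊆-antisym ⊆₁ ⊆₂
      where
      ⊆₁ : N c y ⊆ M c x
      ⊆₁ {i} i∈ = decidable-stable (i ∈? M c x) λ i∉M → i∉y (pair-supp (pair-kept i∈x i∉M))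
        where
        i∈L : i ∈ L c
        i∈L = proj₁ (∈N⁻ {c = c} {y} i∈)
        i∉y : i ∉ supp y
        i∉y = proj₁ (proj₂ (∈N⁻ {c = c} {y} i∈))
        i∈x : i ∈ supp x
        -- If `x` fixed `i`, this label would be nested in the polygon of `x` with the same
        -- extremes, hence belong to `N c x` and be a vertex of `y`.
        i∈x = decidable-stable (i ∈? supp x) λ i∉x →
          let Q , Q∈ , sp = proj₂ (proj₂ (∈N⁻ {c = c} {y} i∈))
              P , P∈ , mod = Pointwise-∈ʳ mods (Pol-fromPol⁻ nc Q∈)
              open Hull (hull P∈ mod)
              spP = spans (i∉x ∘ Pol⊆supp x P∈) lo∈P (ℕ.≤-<-trans (lo≤Q (Spans.lower∈ sp)) (Spans.lower< sp))
                          hi∈P (ℕ.<-≤-trans (Spans.<upper sp) (Q≤hi (Spans.upper∈ sp)))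
          in i∉y (pair-supp (proj₁ (pair-new (∈N⁺ {c = c} {x} i∈L i∉x P∈ spP))))
      ⊆₂ : M c x ⊆ N c y
      ⊆₂ {i} i∈ =
        let P∈ = ∈Pol⁺ x (M⇒∈supp i∈)
            Q , Q∈ , mod = Pointwise-∈ˡ mods P∈
            open Hull (hull P∈ mod)
            i∉Q = λ i∈Q → ∉M mod i∈Q i∈
            off = λ {k} (k∈ : k ∈ Q) (eq : toℕ k ≡ toℕ i) → i∉Q (subst (_∈ Q) (Fin.toℕ-injective eq) k∈)
            i∉y = λ i∈y → ∉M (Pair.mod (pair-y i∈y)) (Pair.i∈Q (pair-y i∈y)) i∈
        in ∈N⁺ {c = c} {y} (proj₂ (proj₂ (∈M⁻ {c = c} {x} i∈))) i∉y (Pol-fromPol⁺ nc Q∈ (Qs-polygons Q∈))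
             (spans i∉Q lo∈Q (ℕ.≤∧≢⇒< (lo≤P (orbit-refl x)) (off lo∈Q))
                        hi∈Q (ℕ.≤∧≢⇒< (P≤hi (orbit-refl x)) (off hi∈Q ∘ sym)))

    -- Disjoint nonempty polygons are distinct, so `Qs` lists the polygons of `y` without
    -- repetition.
    length-modified : length (Pol x) ≡ length (Pol y)
    length-modified = trans (Pointwise.Pointwise-length mods) (ℕ.≤-antisym
      (unique-⊆⇒length≤ unique (λ Q∈ → Pol-fromPol⁺ nc Q∈ (Qs-polygons Q∈)))
      (unique-⊆⇒length≤ (unique-Pol y) (Pol-fromPol⁻ nc)))
      where
      unique : Unique Qs
      unique = AllPairs-map-∈ (λ Q∈ _ dh eq →
        let a , _ , a∈ , _ = Qs-polygons Q∈ in DisjointHulls-disjoint dh a∈ (subst (a ∈_) eq a∈)) nc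

-- Properties of the map

module Involution {c : Permutation′ (suc n)} (layout : Layout c) where
  open Layout layout
  open Diagrams layout
  open Insertion layout
  open Determination layout

  module _ {x : Permutation′ (suc n)} (gx : Gap x) where
    open Modification layout gx

    private
      K : List (Fin (suc n))
      K = filter (_∈? N c x) (allFin (suc n))

      K⁻ : ∀ {k} → k ∈ₗ K → k ∈ N c x
      K⁻ k∈ = proj₂ (∈-filter⁻ (_∈? N c x) {xs = allFin (suc n)} k∈)

      K⁺ : ∀ {k} → k ∈ N c x → k ∈ₗ K
      K⁺ {k} = ∈-filter⁺ (_∈? N c x) (∈-allFin k)

      added : Noncrossing c (addN c x) × Pointwise (Extends (_∈ₗ K)) (Pol x) (addN c x)
              × (∀ {k} → k ∈ₗ K → ∃[ P ] P ∈ₗ addN c x × k ∈ P)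
      added = addVertices K (Noncrossing-Pol gx) (Unique.filter⁺ (_∈? N c x) (allFin⁺ (suc n)))
        λ k∈ → let k∈L , k∉ , spanned = ∈N⁻ {c = c} {x} (K⁻ k∈)
               in k∈L , (λ P∈ k∈P → k∉ (Pol⊆supp x P∈ k∈P)) , spanned

      Qs : List (Subset (suc n))
      Qs = List.map (_─ M c x) (addN c x)

      nc : Noncrossing c Qs
      nc = AllPairs.map⁺ (AllPairs.map (λ {P} {Q} → DisjointHulls-⊆ (p─q⊆p P (M c x)) (p─q⊆p Q (M c x))) (proj₁ added))

      modified : ∀ {P P′} → Extends (_∈ₗ K) P P′ → Modified P (P′ ─ M c x)
      modified {P} {P′} ext = record
        { kept = λ i∈ i∉M → x∈p∧x∉q⇒x∈p─q (grows ext i∈) i∉M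
        ; ∉M = ∉─ P′ (M c x)
        ; source = λ i∈ → [ inj₁ , (λ (k , sp) → inj₂ (K⁻ k , sp)) ]′ (origin ext (p─q⊆p P′ (M c x) i∈)) }

      mods : Pointwise Modified (Pol x) Qs
      mods = Pointwise-mapʳ modified (proj₁ (proj₂ added))

      cover : ∀ {k} → k ∈ N c x → ∃[ Q ] Q ∈ₗ Qs × k ∈ Q
      cover k∈ =
        let P , P∈ , k∈P = proj₂ (proj₂ added) (K⁺ k∈)
        in P ─ M c x , ∈-map⁺ (_─ M c x) P∈ ,
           x∈p∧x∉q⇒x∈p─q k∈P (λ k∈M → proj₁ (proj₂ (∈N⁻ {c = c} {x} k∈)) (D⊆supp {x = x} (proj₁ (∈M⁻ {c = c} {x} k∈M))))

    Gap-inv : Gap (inv c x)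
    Gap-inv = Gap-fromPol nc

    D-inv : D (inv c x) ≡ (D x ─ M c x) ∪ N c x
    D-inv = D-modified nc mods cover

    U-inv : U (inv c x) ≡ (U x ─ M c x) ∪ N c x
    U-inv = U-modified nc mods cover

    M-inv : M c (inv c x) ≡ N c x
    M-inv = M-modified nc mods cover

    N-inv : N c (inv c x) ≡ M c x
    N-inv = N-modified nc mods cover

    length-Pol-inv : length (Pol x) ≡ length (Pol (inv c x))
    length-Pol-inv = length-modified nc mods cover

    private
      ∈N⇒∉D : ∀ {i} → i ∈ N c x → i ∉ D x
      ∈N⇒∉D i∈N i∈D = proj₁ (proj₂ (∈N⁻ {c = c} {x} i∈N)) (D⊆supp {x = x} i∈D)

      ∈N⇒∉U : ∀ {i} → i ∈ N c x → i ∉ U x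
      ∈N⇒∉U i∈N i∈U = proj₁ (proj₂ (∈N⁻ {c = c} {x} i∈N)) (U⊆supp {x = x} i∈U)

      M⊆D : M c x ⊆ D x
      M⊆D i∈ = proj₁ (∈M⁻ {c = c} {x} i∈)

      M⊆U : M c x ⊆ U x
      M⊆U i∈ = proj₁ (proj₂ (∈M⁻ {c = c} {x} i∈))

    initialIndices-inv : initialIndices (inv c x) ≡ initialIndices x
    initialIndices-inv = begin
      initialIndices (inv c x) ≡⟨ initialIndices≡D─U {x = inv c x} ⟩
      D (inv c x) ─ U (inv c x) ≡⟨ cong (_─ U (inv c x)) D-inv ⟩
      ((D x ─ M c x) ∪ N c x) ─ U (inv c x) ≡⟨ cong (((D x ─ M c x) ∪ N c x) ─_) U-inv ⟩
      ((D x ─ M c x) ∪ N c x) ─ ((U x ─ M c x) ∪ N c x) ≡⟨ exchange-─ M⊆U ∈N⇒∉D ⟩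
      D x ─ U x ≡⟨ initialIndices≡D─U {x = x} ⟨
      initialIndices x ∎
      where open ≡-Reasoning

    terminalIndices-inv : terminalIndices (inv c x) ≡ terminalIndices x
    terminalIndices-inv = begin
      terminalIndices (inv c x) ≡⟨ terminalIndices≡U─D {x = inv c x} ⟩
      U (inv c x) ─ D (inv c x) ≡⟨ cong (_─ D (inv c x)) U-inv ⟩
      ((U x ─ M c x) ∪ N c x) ─ D (inv c x) ≡⟨ cong (((U x ─ M c x) ∪ N c x) ─_) D-inv ⟩
      ((U x ─ M c x) ∪ N c x) ─ ((D x ─ M c x) ∪ N c x) ≡⟨ exchange-─ M⊆D ∈N⇒∉U ⟩
      U x ─ D x ≡⟨ terminalIndices≡U─D {x = x} ⟨
      terminalIndices x ∎
      where open ≡-Reasoning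

  inv-involutive : ∀ {x} → Gap x → inv c (inv c x) ≈ x
  inv-involutive {x} gx = D-U-determine {inv c (inv c x)} {x} (Gap-inv {inv c x} gy) gx D≡ U≡
    where
    ∉N : ∀ {S} → S ⊆ supp x → ∀ {i} → i ∈ S → i ∉ N c x
    ∉N S⊆ i∈ i∈N = proj₁ (proj₂ (∈N⁻ {c = c} {x} i∈N)) (S⊆ i∈)
    gy : Gap (inv c x)
    gy = Gap-inv {x} gx
    D≡ : D (inv c (inv c x)) ≡ D x
    D≡ = exchange-twice (D-inv {x} gx) (D-inv {inv c x} gy) (M-inv {x} gx) (N-inv {x} gx)
           (λ i∈ → proj₁ (∈M⁻ {c = c} {x} i∈)) (∉N (D⊆supp {x = x}))
    U≡ : U (inv c (inv c x)) ≡ U x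
    U≡ = exchange-twice (U-inv {x} gx) (U-inv {inv c x} gy) (M-inv {x} gx) (N-inv {x} gx)
           (λ i∈ → proj₁ (proj₂ (∈M⁻ {c = c} {x} i∈))) (∉N (U⊆supp {x = x}))

-- Compatibility with pointwise equality

module _ {x y : Permutation′ n} (x≈y : x ≈ y) where
  orbit-cong : ∀ i → orbit x i ≡ orbit y i
  orbit-cong i = ⊆-antisym
    (orbit-induction x (_∈ orbit y i) (λ {j} j∈ → subst (_∈ orbit y i) (sym (x≈y j)) (orbit-step y j∈)) (orbit-refl y))
    (orbit-induction y (_∈ orbit x i) (λ {j} j∈ → subst (_∈ orbit x i) (x≈y j) (orbit-step x j∈)) (orbit-refl x))

  supp-cong : supp x ≡ supp y
  supp-cong = ⊆-antisym
    (λ {i} i∈ → ∈supp⁺ y (λ fix → ∈supp⁻ x i∈ (trans (x≈y i) fix)))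
    (λ {i} i∈ → ∈supp⁺ x (λ fix → ∈supp⁻ y i∈ (trans (sym (x≈y i)) fix)))

  Pol-cong : Pol x ≡ Pol y
  Pol-cong = trans
    (cong (λ S → List.deduplicate _≟ˢ_ (List.map (orbit x) (filter (_∈? S) (allFin n)))) supp-cong)
    (cong (List.deduplicate _≟ˢ_) (List.map-cong orbit-cong (filter (_∈? supp y) (allFin n))))

-- Apart from `c`, the result depends on the permutation only through its support and its list of
-- polygons. These are plain data, so pointwise equality of the arguments yields equality of the
-- results.
inv-cong : {c x y : Permutation′ (suc n)} → x ≈ y → inv c x ≡ inv c y
inv-cong {n} {c} {x} {y} x≈y =
  cong₂ (λ (S , T) Ps → inv′ S T Ps) (cong₂ _,_ M≡ N≡) Pol≡
  where
  inv′ : Subset (suc n) → Subset (suc n) → List (Subset (suc n)) → Permutation′ (suc n)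
  inv′ S T Ps = fromPol c (List.map (_─ S) (foldl (addVertex c) Ps (filter (_∈? T) (allFin (suc n)))))
  supp≡ : supp x ≡ supp y
  supp≡ = supp-cong {x = x} {y} x≈y
  Pol≡ : Pol x ≡ Pol y
  Pol≡ = Pol-cong {x = x} {y} x≈y
  D≡ : D x ≡ D y
  D≡ = cong₂ (λ S Ps → S ─ ⟦ (λ i → Any.any? (λ P → isMax? P i) Ps) ⟧) supp≡ Pol≡
  U≡ : U x ≡ U y
  U≡ = cong₂ (λ S Ps → S ─ ⟦ (λ i → Any.any? (λ P → isMin? P i) Ps) ⟧) supp≡ Pol≡
  M≡ : M c x ≡ M c y
  M≡ = cong₂ (λ S T → S ∩ T ∩ L c) D≡ U≡
  N≡ : N c x ≡ N c y
  N≡ = cong₂ (λ S Ps → ⟦ (λ k → (k ∈? L c ─ S) ×-dec Any.any? (λ P → nested? P k) Ps) ⟧) supp≡ Pol≡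

-- From a Coxeter element to its layout and factorisation

module _ {n : ℕ} {c : Permutation′ (suc (suc n))} (coxeter : IsStandardCoxeter c) where
  private
    ks : List (Fin (suc n))
    ks = proj₁ coxeter
    ks↭ : ks ↭ allFin (suc n)
    ks↭ = proj₁ (proj₂ coxeter)
    c≈ : c ≈ ∏ (List.map s ks)
    c≈ = proj₂ (proj₂ coxeter)

  coxeterLayout : Layout c
  coxeterLayout = CoxeterLayout.layout c ks
    (Permutation.Unique-resp-↭ (setoid (Fin (suc n))) (↭⇒↭ₛ (↭-sym ks↭)) (allFin⁺ (suc n)))
    (λ k → ∈-resp-↭ (↭-sym ks↭) (∈-allFin k)) c≈

  coxeterFactors : ∃[ ts ] All IsTransposition ts × ∏ ts ≈ c × length ts ≡ suc n
  coxeterFactors = List.map s ks ,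
    All.map⁺ (All.universal (λ k → transpose-isTransposition λ eq →
      ℕ.<⇒≢ (toℕ-inject₁-<suc k) (cong toℕ eq)) ks) ,
    (λ i → sym (c≈ i)) ,
    trans (List.length-map s ks) (trans (↭-length ks↭) (length-allFin (suc n)))

inv-properties : {c : Permutation′ (suc n)} → Layout c →
  (∃[ ts ] All IsTransposition ts × ∏ ts ≈ c × length ts ≡ n) →
  (∀ x → InNC c x → InNC c (inv c x))
    × (∀ x y → InNC c x → InNC c y → x ≈ y → inv c x ≈ inv c y)
    × (∀ x → InNC c x → inv c (inv c x) ≈ x)
    × (∀ x → InNC c x →
        D (inv c x) ≡ (D x ─ M c x) ∪ N c x
        × U (inv c x) ≡ (U x ─ M c x) ∪ N c x)
    × (∀ x → InNC c x →
        initialIndices (inv c x) ≡ initialIndices x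
        × terminalIndices (inv c x) ≡ terminalIndices x)
    × (∀ x → InNC c x → length (Pol x) ≡ length (Pol (inv c x)))
inv-properties {n} {c} layout factors =
  (λ x x∈ → Gap⇒NC (inv c x) (Gap-inv {x} (NC⇒Gap x x∈)))
  , (λ x y _ _ x≈y i → cong (_⟨$⟩ʳ i) (inv-cong {c = c} {x} {y} x≈y))
  , (λ x x∈ → inv-involutive {x} (NC⇒Gap x x∈))
  , (λ x x∈ → D-inv {x} (NC⇒Gap x x∈) , U-inv {x} (NC⇒Gap x x∈))
  , (λ x x∈ → initialIndices-inv {x} (NC⇒Gap x x∈) , terminalIndices-inv {x} (NC⇒Gap x x∈))
  , (λ x x∈ → length-Pol-inv {x} (NC⇒Gap x x∈))
  where
  open Layout layout
  open Involution layout
  module Order = AbsoluteOrder key key-injective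
  NC⇒Gap : ∀ x → InNC c x → Gap x
  NC⇒Gap x = Order.NC⇒Gap {c} successor transitive first factors {x}
  Gap⇒NC : ∀ x → Gap x → InNC c x
  Gap⇒NC x = Order.Gap⇒NC {c} successor transitive first factors {x}

lemma3p6 : ∀ (n : ℕ) → 1 ≤ n →
    (c : Permutation′ (suc n)) → IsStandardCoxeter c →
    (∀ x → InNC c x → InNC c (inv c x))
    × (∀ x y → InNC c x → InNC c y → x ≈ y → inv c x ≈ inv c y)
    × (∀ x → InNC c x → inv c (inv c x) ≈ x)
    × (∀ x → InNC c x →
    D (inv c x) ≡ (D x ─ M c x) ∪ N c x
    × U (inv c x) ≡ (U x ─ M c x) ∪ N c x)
    × (∀ x → InNC c x →
    initialIndices (inv c x) ≡ initialIndices x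
    × terminalIndices (inv c x) ≡ terminalIndices x)
    × (∀ x → InNC c x → length (Pol x) ≡ length (Pol (inv c x)))
lemma3p6 (suc n) _ c coxeter = inv-properties (coxeterLayout {c = c} coxeter) (coxeterFactors {c = c} coxeter)
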